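{- In the MMV-RAM model with parameter $s$, the matrix multiplication unit (MMU) and the vector unit (VCU) complement each other in the following sense: 1. The VCU can compute non-linear element-wise functions, such as $\mathrm{ReLU}$ ($t\mapsto\max(t,0)$), on a vector $\mathbf{x}$ in a single step, while the MMU cannot execute such operations. 2. The MMU can multiply two matrices $\mathbf{A}$ and $\mathbf{B}$ with sizes $n\times s$ and $s\times s$ in one step. However, any MMV-RAM algorithm that uses only the scalar and vector units to compute $\mathbf{A}\mathbf{B}$, and executes work that scales polynomially in $s$, requires $\Omega\!\left(\frac{\log(s)}{\log(\log(s))}\right)$ steps. 3. There exists a linear vector transformation (a permutation of the entries) which can be efficiently implemented in the VCU in one step and linear work, but which requires $\Omega(s)$ calls to the MMU.
   Context: All logarithms are base two. MMV-RAM model. Fix an integer parameter $s\ge 2$, independent of the input length. The machine has a main memory and three units; each step executes one instruction of one unit. (i) The scalar unit performs basic arithmetic, address calculations and logic operations. (ii) The vector unit (VCU) executes one vector instruction on vectors of arbitrary length $n$ read from consecutive memory words. Each vector instruction is given by a uniform family of AC[0] Boolean circuits: gates $\{\wedge,\vee,\neg\}$ with unbounded fan-in, constant depth, and size (number of edges) polynomial in $n$, in the number $B$ of bits per element, and in $s$. Element-wise $\wedge,\vee,\neg$ are available by default; an algorithm may use a fixed set of further instructions given by such circuit families. (iii) The matrix multiplication unit (MMU) multiplies an $n\times s$ matrix by an $s\times s$ matrix in a single step ($n$ arbitrary), reading the matrices from consecutive memory words in row-major order and returning the result in row-major order. The step complexity is the number of executed steps; the work is the sum of the costs of the executed instructions.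 A vector instruction costs the size of its circuit; multiplying an $n\times s$ by an $s\times s$ matrix costs $\mathcal{M}(n)$, which depends linearly on $n$ and also depends on the bit-width of the entries. Matrix and vector entries are $B$-bit integers. Calls to the MMU alone (items 1 and 3): the vector $\mathbf{x}$ is the content of the memory, and the only allowed operations are reading and writing consecutive positions between memory and the MMU, together with left and right multiplications. A right multiplication reads $ks$ consecutive entries ($k$ arbitrary, arbitrary starting position), views them as a row-major $k\times s$ matrix $\mathbf{X}$, and writes back $\mathbf{X}\mathbf{B}_s$ for an arbitrary $s\times s$ matrix $\mathbf{B}_s$. A left multiplication reads $s^2$ consecutive entries, views them as a row-major $s\times s$ matrix $\mathbf{X}$, and writes back $\mathbf{A}_{k\times s}\mathbf{X}$ for an arbitrary $k\times s$ matrix $\mathbf{A}_{k\times s}$. The other matrix factor in each operation is independent of the data in $\mathbf{x}$. A sequence of such operations implements a vector transformation if it returns the correct result for every input vector. Item 3 concerns vectors whose length is sufficiently large compared to $s$. -}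

module Defs where

open import Data.Bool.Base using (Bool; true; false; not; _∧_; _∨_; _xor_; if_then_else_)
open import Data.Fin.Base using (Fin; toℕ; splitAt)
open import Data.Fin.Permutation using (Permutation′; _⟨$⟩ʳ_)
open import Data.Fin.Subset using (Subset; ⊥; ⁅_⁆; ∣_∣; _∈_)
open import Data.Integer.Base as ℤ using (ℤ; +_; -[1+_]; 0ℤ; 1ℤ; -1ℤ)
import Data.Integer.Properties as ℤ
open import Data.List.Base as List using (List; []; _∷_; length)
open import Data.List.Relation.Unary.All using (All)
open import Data.Maybe.Base using (Maybe; just; nothing)
open import Data.Nat.Base using (ℕ; zero; suc; _+_; _*_; _^_; _≤_; _<_; _≡ᵇ_)
open import Data.Product.Base using (∃; _×_; _,_; proj₁)
open import Data.Sum.Base using (_⊎_; [_,_]′)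
open import Data.Vec.Base as Vec using (Vec; []; _∷_; lookup; tabulate; concat; group; zipWith; _++_)
open import Algebra.Properties.CommutativeMonoid.Sum ℤ.+-0-commutativeMonoid using (sum)
open import Function.Base using (_∘_)
open import Function.Bundles using (_⇔_)
open import Relation.Binary.PropositionalEquality using (_≡_; _≢_)
open import Relation.Nullary using (¬_; does)

-- Least significant bit first, two's complement.
Word : ℕ → Set
Word B = Vec Bool B

⟦_⟧ : ∀ {B} → Word B → ℤ
⟦ [] ⟧             = 0ℤ
⟦ b ∷ [] ⟧         = if b then -1ℤ else 0ℤ
⟦ b ∷ w@(_ ∷ _) ⟧  = (if b then 1ℤ else 0ℤ) ℤ.+ (+ 2) ℤ.* ⟦ w ⟧

-- Reduction modulo 2 ^ B; _/ℕ_ rounds towards -∞.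
fromℤ : ∀ B → ℤ → Word B
fromℤ zero    z = []
fromℤ (suc B) z = (z ℤ.%ℕ 2 ≡ᵇ 1) ∷ fromℤ B (z ℤ./ℕ 2)

infixl 6 _+ʷ_
infixl 7 _*ʷ_

_+ʷ_ _*ʷ_ : ∀ {B} → Word B → Word B → Word B
_+ʷ_ {B} x y = fromℤ B (⟦ x ⟧ ℤ.+ ⟦ y ⟧)
_*ʷ_ {B} x y = fromℤ B (⟦ x ⟧ ℤ.* ⟦ y ⟧)

relu : ∀ {B} → Word B → Word B
relu {B} x = fromℤ B (⟦ x ⟧ ℤ.⊔ 0ℤ)

Linear : ∀ {B} → (Word B → Word B) → Set
Linear f = (∀ x y → f (x +ʷ y) ≡ f x +ʷ f y) × (∀ a x → f (a *ʷ x) ≡ a *ʷ f x)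

permute : ∀ {A : Set} {n} → Permutation′ n → Vec A n → Vec A n
permute π x = tabulate λ i → lookup x (π ⟨$⟩ʳ i)

Matrix : Set → ℕ → ℕ → Set
Matrix A m n = Vec (Vec A n) m

entry : ∀ {A : Set} {m n} → Matrix A m n → Fin m → Fin n → A
entry X i j = lookup (lookup X i) j

infixl 7 _⊗_

-- The inner products are exact; only the results wrap around to B bits.
_⊗_ : ∀ {B m n l} → Matrix (Word B) m n → Matrix (Word B) n l → Matrix (Word B) m l
_⊗_ {B} X Y = tabulate λ i → tabulate λ j →
  fromℤ B (sum λ k → ⟦ entry X i k ⟧ ℤ.* ⟦ entry Y k j ⟧)

data Op : Set where
  and or neg : Op

data Gate (m : ℕ) : Set where
  ⋀ ⋁ : Subset m → Gate m
  ~_  : Fin m → Gate m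

op : ∀ {m} → Gate m → Op
op (⋀ _) = and
op (⋁ _) = or
op (~ _) = neg

fanin : ∀ {m} → Gate m → Subset m
fanin (⋀ p) = p
fanin (⋁ p) = p
fanin (~ h) = ⁅ h ⁆

evalGate : ∀ {m} → Vec Bool m → Gate m → Bool
evalGate v (⋀ p) = Vec.foldr′ _∧_ true  (zipWith (λ c b → not c ∨ b) p v)
evalGate v (⋁ p) = Vec.foldr′ _∨_ false (zipWith _∧_ p v)
evalGate v (~ h) = not (lookup v h)

-- Acyclic circuits with the gates sorted by depth: a gate may read the inputs
-- and every gate of a strictly earlier level.  Nodes 0, …, i - 1 are the
-- inputs; the gates follow, level by level.
data Levels (i : ℕ) : (nodes depth : ℕ) → Set where
  inputs : Levels i i 0
  _▷_    : ∀ {m w d} → Levels i m d → Vec (Gate m) w → Levels i (m + w) (suc d)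

evalLevels : ∀ {i m d} → Levels i m d → Vec Bool i → Vec Bool m
evalLevels inputs   x = x
evalLevels (C ▷ gs) x = let v = evalLevels C x in v ++ Vec.map (evalGate v) gs

wires : ∀ {i m d} → Levels i m d → ℕ
wires inputs   = 0
wires (C ▷ gs) = wires C + Vec.sum (Vec.map (∣_∣ ∘ fanin) gs)

opAt : ∀ {i m d} → Levels i m d → Fin m → Maybe Op
opAt inputs            g = nothing
opAt (_▷_ {m = m} C gs) g = [ opAt C , just ∘ op ∘ lookup gs ]′ (splitAt m g)

faninAt : ∀ {i m d} → Levels i m d → Fin m → Subset m
faninAt inputs                    g = ⊥
faninAt (_▷_ {m = m} {w = w} C gs) g =
  [ faninAt C , fanin ∘ lookup gs ]′ (splitAt m g) ++ ⊥ {w}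

record Circuit (i o : ℕ) : Set where
  field
    {nodes depth} : ℕ
    levels        : Levels i nodes depth
    outputs       : Vec (Fin nodes) o

  eval : Vec Bool i → Vec Bool o
  eval x = Vec.map (lookup (evalLevels levels x)) outputs

  -- Number of edges.  An output is a sink of its own, with one incoming edge,
  -- so that moving data is not free.
  size : ℕ
  size = wires levels + o

-- First-order formulas over ℕ with + and ×, all quantifiers bounded by terms.
data Term (v : ℕ) : Set where
  var     : Fin v → Term v
  lit     : ℕ → Term v
  _⊕_ _⊙_ : Term v → Term v → Term v

data Formula (v : ℕ) : Set where
  _≐_ _≺_   : Term v → Term v → Formula v
  ¬′_       : Formula v → Formula v
  _∧′_ _∨′_ : Formula v → Formula v → Formula v
  ∃≺ ∀≺     : Term v → Formula (suc v) → Formula v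

term : ∀ {v} → Term v → Vec ℕ v → ℕ
term (var x) ρ = lookup ρ x
term (lit k) ρ = k
term (t ⊕ u) ρ = term t ρ + term u ρ
term (t ⊙ u) ρ = term t ρ * term u ρ

Holds : ∀ {v} → Formula v → Vec ℕ v → Set
Holds (t ≐ u)  ρ = term t ρ ≡ term u ρ
Holds (t ≺ u)  ρ = term t ρ < term u ρ
Holds (¬′ φ)   ρ = ¬ Holds φ ρ
Holds (φ ∧′ ψ) ρ = Holds φ ρ × Holds ψ ρ
Holds (φ ∨′ ψ) ρ = Holds φ ρ ⊎ Holds ψ ρ
Holds (∃≺ t φ) ρ = ∃ λ x → x < term t ρ × Holds φ (x ∷ ρ)
Holds (∀≺ t φ) ρ = ∀ x → x < term t ρ → Holds φ (x ∷ ρ)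

-- DLOGTIME-uniformity, the usual uniformity for AC[0], in its first-order form
-- (Barrington, Immerman, Straubing): the direct connection language is
-- definable by formulas over + and × whose quantifiers range over numbers
-- polynomially bounded in n, B and s.
record Uniform {i o : ℕ → ℕ → ℕ} (C : ∀ n B s → Circuit (i n B) (o n B)) : Set where
  open Circuit
  field
    node   : Formula 4
    gate   : Op → Formula 4
    edge   : Formula 5
    output : Formula 5
    node⇔   : ∀ n B s g → Holds node (n ∷ B ∷ s ∷ g ∷ []) ⇔ g < nodes (C n B s)
    gate⇔   : ∀ n B s f g →
              Holds (gate f) (n ∷ B ∷ s ∷ toℕ g ∷ []) ⇔ opAt (levels (C n B s)) g ≡ just f
    edge⇔   : ∀ n B s h g →
              Holds edge (n ∷ B ∷ s ∷ toℕ h ∷ toℕ g ∷ []) ⇔ h ∈ faninAt (levels (C n B s)) g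
    output⇔ : ∀ n B s j g →
              Holds output (n ∷ B ∷ s ∷ toℕ j ∷ toℕ g ∷ []) ⇔ lookup (outputs (C n B s)) j ≡ g

-- Operands and result are vectors of n words, presented to the circuit operand
-- by operand and word by word.
record VectorOp : Set where
  open Circuit
  field
    arity         : ℕ
    circuit       : ∀ n B s → Circuit (arity * (n * B)) (n * B)
    constantDepth : ∃ λ d → ∀ n B s → depth (circuit n B s) ≤ d
    polynomial    : ∃ λ k → ∀ n B s → size (circuit n B s) ≤ k + (n + B + s) ^ k
    uniform       : Uniform circuit

  apply : ∀ {B} (s n : ℕ) → Vec (Vec (Word B) n) arity → Vec (Word B) n
  apply {B} s n xs = proj₁ (group n B (eval (circuit n B s) (concat (Vec.map concat xs))))

  cost : (s B n : ℕ) → ℕ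
  cost s B n = size (circuit n B s)

Memory : ℕ → Set
Memory B = ℕ → Word B

_[_≔_] : ∀ {A : Set} → (ℕ → A) → ℕ → A → (ℕ → A)
(M [ a ≔ w ]) x = if x ≡ᵇ a then w else M x

read : ∀ {A : Set} → (ℕ → A) → ℕ → ∀ n → Vec A n
read M a n = tabulate λ i → M (a + toℕ i)

write : ∀ {A : Set} {n} → (ℕ → A) → ℕ → Vec A n → (ℕ → A)
write M a []      = M
write M a (w ∷ x) = write M (suc a) x [ a ≔ w ]

-- Matrices are stored in row-major order.
readMatrix : ∀ {A : Set} → (ℕ → A) → ℕ → ∀ m n → Matrix A m n
readMatrix M a m n = proj₁ (group m n (read M a (m * n)))

writeMatrix : ∀ {A : Set} {m n} → (ℕ → A) → ℕ → Matrix A m n → (ℕ → A)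
writeMatrix M a X = write M a (concat X)

Reg : Set
Reg = ℕ

data ScalarOp : Set where
  add sub mul div mod equal less bitand bitor bitxor : ScalarOp

data Instr (ops : List VectorOp) : Set where
  const       : (d : Reg) → ℤ → Instr ops
  scalar      : ScalarOp → (d a b : Reg) → Instr ops
  load        : (d a : Reg) → Instr ops
  store       : (a b : Reg) → Instr ops
  jump        : (a : Reg) (target : ℕ) → Instr ops
  vand vor    : (d a b n : Reg) → Instr ops
  vnot        : (d a n : Reg) → Instr ops
  vector      : (f : Fin (length ops)) (d : Reg)
                (as : Vec Reg (VectorOp.arity (List.lookup ops f))) (n : Reg) → Instr ops
  matmul      : (d a b n : Reg) → Instr ops

data Unit : Set where
  SU VCU MMU : Unit

unit : ∀ {ops} → Instr ops → Unit
unit (const _ _)      = SU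
unit (scalar _ _ _ _) = SU
unit (load _ _)       = SU
unit (store _ _)      = SU
unit (jump _ _)       = SU
unit (vand _ _ _ _)   = VCU
unit (vor _ _ _ _)    = VCU
unit (vnot _ _ _)     = VCU
unit (vector _ _ _ _) = VCU
unit (matmul _ _ _ _) = MMU

-- The instruction set is fixed.  The code may depend on s, which is a parameter
-- of the machine.
record Algorithm : Set where
  field
    ops  : List VectorOp
    code : (s : ℕ) → List (Instr ops)

open Algorithm public

Uses : Unit → Algorithm → Set
Uses u P = ∀ s → All (λ c → unit c ≡ u) (code P s)

Avoids : Unit → Algorithm → Set
Avoids u P = ∀ s → All (λ c → unit c ≢ u) (code P s)

-- Registers hold arbitrary integers, so that addresses and lengths are not
-- limited by B.  Storing a register keeps its B low-order bits.
record State (B : ℕ) : Set where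
  constructor state
  field
    pc  : ℕ
    reg : Reg → ℤ
    mem : Memory B

open State public

truth : Bool → ℤ
truth b = if b then 1ℤ else 0ℤ

bitwise : ℕ → (Bool → Bool → Bool) → ℤ → ℤ → ℤ
bitwise B f x y = ⟦ zipWith f (fromℤ B x) (fromℤ B y) ⟧

-- Division by zero yields zero.
alu : ℕ → ScalarOp → ℤ → ℤ → ℤ
alu B add    x y             = x ℤ.+ y
alu B sub    x y             = x ℤ.- y
alu B mul    x y             = x ℤ.* y
alu B div    x (+ zero)      = 0ℤ
alu B div    x y@(+ suc _)   = x ℤ./ y
alu B div    x y@(-[1+ _ ])  = x ℤ./ y
alu B mod    x (+ zero)      = 0ℤ
alu B mod    x y@(+ suc _)   = + (x ℤ.% y)
alu B mod    x y@(-[1+ _ ])  = + (x ℤ.% y)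
alu B equal  x y             = truth (does (x ℤ.≟ y))
alu B less   x y             = truth (does (x ℤ.<? y))
alu B bitand x y             = bitwise B _∧_ x y
alu B bitor  x y             = bitwise B _∨_ x y
alu B bitxor x y             = bitwise B _xor_ x y

module _ {B : ℕ} (σ : State B) where

  -- The content of a register as an address or a length.
  nat : Reg → ℕ
  nat r = ℤ.∣ reg σ r ∣

  setReg : Reg → ℤ → State B
  setReg d z = record σ { pc = suc (pc σ) ; reg = reg σ [ d ≔ z ] }

  setMem : Memory B → State B
  setMem M = record σ { pc = suc (pc σ) ; mem = M }

  vec : Reg → ∀ n → Vec (Word B) n
  vec a n = read (mem σ) (nat a) n

exec : ∀ {ops B} → (s : ℕ) → Instr ops → State B → State B
exec s (const d z) σ = setReg σ d z
exec {B = B} s (scalar f d a b) σ = setReg σ d (alu B f (reg σ a) (reg σ b))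
exec s (load d a) σ = setReg σ d ⟦ mem σ (nat σ a) ⟧
exec {B = B} s (store a b) σ = setMem σ (mem σ [ nat σ a ≔ fromℤ B (reg σ b) ])
exec s (jump a target) σ =
  record σ { pc = if does (reg σ a ℤ.≟ 0ℤ) then suc (pc σ) else target }
exec s (vand d a b n) σ =
  setMem σ (write (mem σ) (nat σ d)
    (zipWith (zipWith _∧_) (vec σ a (nat σ n)) (vec σ b (nat σ n))))
exec s (vor d a b n) σ =
  setMem σ (write (mem σ) (nat σ d)
    (zipWith (zipWith _∨_) (vec σ a (nat σ n)) (vec σ b (nat σ n))))
exec s (vnot d a n) σ =
  setMem σ (write (mem σ) (nat σ d) (Vec.map (Vec.map not) (vec σ a (nat σ n))))
exec {ops} s (vector f d as n) σ =
  setMem σ (write (mem σ) (nat σ d)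
    (VectorOp.apply (List.lookup ops f) s (nat σ n) (Vec.map (λ a → vec σ a (nat σ n)) as)))
exec s (matmul d a b n) σ =
  setMem σ (writeMatrix (mem σ) (nat σ d)
    (readMatrix (mem σ) (nat σ a) (nat σ n) s ⊗ readMatrix (mem σ) (nat σ b) s s))

-- The multiplication of an n × s by an s × s matrix of B-bit entries costs
-- n * κ B s.  The elementwise instructions are charged the edges of their
-- circuits: per bit, one gate of fan-in 2 or 1 and one output edge.
cost : ∀ {ops B} → (κ : ℕ → ℕ → ℕ) (s : ℕ) → Instr ops → State B → ℕ
cost             κ s (const _ _)      σ = 1
cost             κ s (scalar _ _ _ _) σ = 1
cost             κ s (load _ _)       σ = 1
cost             κ s (store _ _)      σ = 1
cost             κ s (jump _ _)       σ = 1
cost {B = B}     κ s (vand _ _ _ n)   σ = 3 * (nat σ n * B)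
cost {B = B}     κ s (vor _ _ _ n)    σ = 3 * (nat σ n * B)
cost {B = B}     κ s (vnot _ _ n)     σ = 2 * (nat σ n * B)
cost {ops} {B}   κ s (vector f _ _ n) σ = VectorOp.cost (List.lookup ops f) s B (nat σ n)
cost {B = B}     κ s (matmul _ _ _ n) σ = nat σ n * κ B s

module _ {ops : List VectorOp} {B : ℕ} (κ : ℕ → ℕ → ℕ) (s : ℕ) (p : List (Instr ops)) where

  fetch : ℕ → Maybe (Instr ops)
  fetch i = List.head (List.drop i p)

  -- Run σ t w σ′: from σ the program halts in σ′, after t steps of total cost w.
  data Run (σ : State B) : (t w : ℕ) → State B → Set where
    halt : fetch (pc σ) ≡ nothing → Run σ 0 0 σ
    step : ∀ {c t w σ′} → fetch (pc σ) ≡ just c → Run (exec s c σ) t w σ′ →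
           Run σ (suc t) (cost κ s c σ + w) σ′

-- The input occupies the memory from address 0 on, followed by zeros.  The
-- registers hold n, s, B, the addresses of the operands and finally the address
-- of the result, which is that of the first cell after the input.
start : ∀ {B l} → (n s : ℕ) → List ℕ → Vec (Word B) l → State B
start {B} {l} n s addrs x =
  state 0 (registers (n ∷ s ∷ B ∷ addrs List.++ l ∷ [])) (write (λ _ → fromℤ B 0ℤ) 0 x)
  where
  registers : List ℕ → Reg → ℤ
  registers []       _       = 0ℤ
  registers (k ∷ ks) zero    = + k
  registers (k ∷ ks) (suc r) = registers ks r

MapsIn : (κ : ℕ → ℕ → ℕ) (P : Algorithm) (s : ℕ) {B n : ℕ} →
         (x y : Vec (Word B) n) (t w : ℕ) → Set
MapsIn κ P s {B} {n} x y t w =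
  ∃ λ σ → Run κ s (code P s) (start n s (0 ∷ []) x) t w σ × read (mem σ) n n ≡ y

MultipliesIn : (κ : ℕ → ℕ → ℕ) (P : Algorithm) (s : ℕ) {B n : ℕ} →
               (X : Matrix (Word B) n s) (Y : Matrix (Word B) s s) (t w : ℕ) → Set
MultipliesIn κ P s {B} {n} X Y t w =
  ∃ λ σ → Run κ s (code P s) (start n s (0 ∷ n * s ∷ []) (concat X ++ concat Y)) t w σ ×
          readMatrix (mem σ) (n * s + s * s) n s ≡ X ⊗ Y

data Call (B s N : ℕ) : Set where
  right : ∀ {k} (src dst : ℕ) → src + k * s ≤ N → dst + k * s ≤ N →
          Matrix (Word B) s s → Call B s N
  left  : ∀ {k} (src dst : ℕ) → src + s * s ≤ N → dst + k * s ≤ N →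
          Matrix (Word B) k s → Call B s N

call : ∀ {B s N} → Memory B → Call B s N → Memory B
call {s = s} M (right {k} src dst _ _ Y) = writeMatrix M dst (readMatrix M src k s ⊗ Y)
call {s = s} M (left      src dst _ _ X) = writeMatrix M dst (X ⊗ readMatrix M src s s)

calls : ∀ {B s N} → List (Call B s N) → Vec (Word B) N → Vec (Word B) N
calls {B} {N = N} cs x = read (List.foldl call (write (λ _ → fromℤ B 0ℤ) 0 x) cs) 0 N

Implements : ∀ {B s N} → List (Call B s N) → (Vec (Word B) N → Vec (Word B) N) → Set
Implements cs f = ∀ x → calls cs x ≡ f x

{-# OPTIONS --safe #-}

-- The lower bound of item 2 simulates all the inputs at once.  A restriction
-- fixes some bits of the right factor so that the program counter and the
-- registers are the same for all remaining inputs, while every memory bit has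
-- certificates of O(log s) input bits.  A vector instruction adds O(1) layers of
-- gates, and each layer costs a factor O(log s) in the number of free bits, by
-- the switching lemma; its proof sums weights over all restrictions, so that an
-- averaging argument yields one restriction that is good for all gates and keeps
-- enough bits free.  A load fixes the certificates of the B bits of one word.
-- With a left factor of entries -1, bit b of column j of the product flips
-- whenever bit b of an entry of column j of the right factor does; at the end
-- all free bits therefore lie in the s B certificates of one row of the product,
-- whence s ≤ (log s)^O(T).
--
-- In item 3 the permutation is reversal.  After c calls a cell depends only on
-- the cells f p, for (1 + 2s + s²)^c monotone maps f (shifts and constants) that
-- do not depend on the cell p.  A monotone map meets the reversal at most once,
-- so reversal of n > (1 + 2s + s²)^s entries needs at least s calls.

module Submission where

open import Defs
open import Data.Bool.Base using (Bool; true; false; not; _∧_; _∨_; _xor_; if_then_else_)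
open import Data.Bool.Properties as Bool using (⇔→≡)
open import Data.Fin using (#_)
open import Data.Fin.Base using (Fin; zero; suc; toℕ; fromℕ; fromℕ<; combine; remQuot; splitAt; _↑ˡ_; _↑ʳ_; opposite)
open import Data.Fin.Permutation using (Permutation′; reverse)
import Data.Fin.Properties as Fin
open import Data.Fin.Subset using (Subset; ⊥; ⁅_⁆; ∣_∣; _∪_) renaming (_∈_ to _∈ˢ_)
open import Data.Fin.Subset.Properties using (∣⁅x⁆∣≡1; ∉⊥; x∈⁅y⁆⇒x≡y; x∈⁅x⁆; x∈p∪q⁺; x∈p∪q⁻)
open import Data.Integer.Base as ℤ using (ℤ; 0ℤ; 1ℤ; -1ℤ)
import Data.Integer.DivMod as ℤ
import Data.Integer.Properties as ℤ
import Data.Integer.Tactic.RingSolver as ℤ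
open import Data.List.Base as List using (List; []; _∷_; length)
open import Data.List.Membership.Propositional using (_∈_; _∉_)
import Data.List.Membership.DecPropositional as Dec
open import Data.List.Membership.Propositional.Properties using (∈-++⁺ˡ; ∈-++⁺ʳ; ∈-map⁺; ∈-cartesianProductWith⁺; ∈-lookup)
import Data.List.Properties as List
open import Data.List.Relation.Unary.All as All using (All; []; _∷_)
import Data.List.Relation.Unary.All.Properties as All
open import Data.List.Relation.Unary.AllPairs using ([]; _∷_)
open import Data.List.Relation.Unary.Any as Any using (Any; here; there)
import Data.List.Relation.Unary.Any.Properties as Any
open import Data.List.Relation.Unary.Unique.Propositional using (Unique)
import Data.List.Relation.Unary.Unique.DecPropositional.Properties as Unique
open import Data.Maybe.Base using (Maybe; just; nothing; fromMaybe)
open import Data.Maybe.Properties using (just-injective)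
open import Data.Nat.Base
import Data.Nat.Divisibility as ℕ
open import Data.Nat.Induction using (<-rec)
open import Data.Nat.Logarithm
open import Data.Nat.Properties
open import Data.Nat.Tactic.RingSolver using (solve-∀)
open import Data.Product.Base using (Σ; ∃; ∃₂; _×_; _,_; proj₁; proj₂)
open import Data.Sum.Base as Sum using (_⊎_; inj₁; inj₂)
open import Data.Vec.Base as Vec using (Vec; []; _∷_; map; lookup; tabulate; zipWith; _++_; _[_]≔_; concat; group; replicate)
open import Data.Vec.Properties as Vec using (lookup∘update; lookup∘update′; []≔-commutes; []≔-idempotent; []≔-lookup; lookup-map; lookup-zipWith; lookup-concat; lookup∘tabulate; tabulate∘lookup; tabulate-cong; lookup-replicate; lookup-++ˡ; lookup-++ʳ; ∷-injective; []=⇒lookup; lookup⇒[]=; map-replicate)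
import Algebra.Properties.AbelianGroup ℤ.+-0-abelianGroup as ℤ+
open import Algebra.Properties.CommutativeMonoid.Sum ℤ.+-0-commutativeMonoid using (sum; sum-cong-≗)
open import Function.Base using (_∘_; id)
open import Function.Bundles using (_⇔_; mk⇔; module Equivalence)
open import Function.Definitions using (Injective)
open import Relation.Binary.Definitions using (tri<; tri≈; tri>)
open import Relation.Binary.PropositionalEquality
open import Relation.Nullary using (¬_; Dec; yes; no; contradiction; does; _×-dec_)

-- The obstacle in item 2 is adaptivity: lengths, addresses and jumps depend on the input through
-- `load`, so a run is not one circuit. Once the registers are common to a subcube, a vector step is
-- a single circuit there, and the work bound, which speaks of each input separately, bounds its
-- wires. The certificate size `τ = suc k * suc ⌊log₂ s⌋` is chosen once: `2 ^ suc τ` is at least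
-- `rate` times the `s ^ k` wires, so a union bound over a layer succeeds and every layer returns to
-- certificates of size `τ`. Certificates are closed under negation, so one invariant serves all
-- gates and all memory bits. The switching lemma is proved by induction over the terms, without an
-- encoding of bad restrictions. Probabilities are natural-number weights, 1 for a variable left
-- free against `K` for each bit, so nothing is divided, and the correlation caused by conditioning
-- is confined to the inequality `Growing`. The constants come from `K = 8 * τ`, where `8` is the
-- price of one literal, and from halving the survival rate `1 / (2 * K + 1)` to pay for bad
-- restrictions.

-- Sums over restrictions

Restriction : ℕ → Set
Restriction V = Vec (Maybe Bool) V

∑ : ∀ {V} → (Restriction V → ℕ) → ℕ
∑ {zero}  h = h []
∑ {suc V} h = ∑ (h ∘ (nothing ∷_)) + (∑ (h ∘ (just false ∷_)) + ∑ (h ∘ (just true ∷_)))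

∑-mono : ∀ {V} {g h : Restriction V → ℕ} → (∀ ρ → g ρ ≤ h ρ) → ∑ g ≤ ∑ h
∑-mono {zero}  g≤h = g≤h []
∑-mono {suc V} g≤h =
  +-mono-≤ (∑-mono {V} λ ρ → g≤h _) (+-mono-≤ (∑-mono {V} λ ρ → g≤h _) (∑-mono {V} λ ρ → g≤h _))

∑-cong : ∀ {V} {g h : Restriction V → ℕ} → (∀ ρ → g ρ ≡ h ρ) → ∑ g ≡ ∑ h
∑-cong {zero}  g≡h = g≡h []
∑-cong {suc V} g≡h =
  cong₂ _+_ (∑-cong {V} λ ρ → g≡h _) (cong₂ _+_ (∑-cong {V} λ ρ → g≡h _) (∑-cong {V} λ ρ → g≡h _))

∑-+ : ∀ {V} (g h : Restriction V → ℕ) → ∑ (λ ρ → g ρ + h ρ) ≡ ∑ g + ∑ h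
∑-+ {zero}  g h = refl
∑-+ {suc V} g h
  rewrite ∑-+ (g ∘ (nothing ∷_)) (h ∘ (nothing ∷_))
        | ∑-+ (g ∘ (just false ∷_)) (h ∘ (just false ∷_))
        | ∑-+ (g ∘ (just true ∷_)) (h ∘ (just true ∷_))
  = lemma (∑ (g ∘ (nothing ∷_))) _ (∑ (g ∘ (just false ∷_))) _ (∑ (g ∘ (just true ∷_))) _
  where
  lemma : ∀ a b c d e f → (a + b) + ((c + d) + (e + f)) ≡ (a + (c + e)) + (b + (d + f))
  lemma = solve-∀

∑-* : ∀ {V} c (h : Restriction V → ℕ) → ∑ (λ ρ → c * h ρ) ≡ c * ∑ h
∑-* {zero}  c h = refl
∑-* {suc V} c h
  rewrite ∑-* c (h ∘ (nothing ∷_)) | ∑-* c (h ∘ (just false ∷_)) | ∑-* c (h ∘ (just true ∷_))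
  = lemma c (∑ (h ∘ (nothing ∷_))) (∑ (h ∘ (just false ∷_))) (∑ (h ∘ (just true ∷_)))
  where
  lemma : ∀ c x y z → c * x + (c * y + c * z) ≡ c * (x + (y + z))
  lemma = solve-∀

∑-zero : ∀ {V} {h : Restriction V → ℕ} → (∀ ρ → h ρ ≡ 0) → ∑ h ≡ 0
∑-zero {h = h} h≡0 = trans (∑-cong h≡0) (∑-* 0 h)

-- Multiplying a weight by `δ` conditions it on the value at one variable. `nothing` is a third
-- value, so being free is conditioned on in the same way.
δ : Maybe Bool → Maybe Bool → ℕ
δ nothing  nothing  = 1
δ nothing  (just c) = 0
δ (just b) nothing  = 0
δ (just b) (just c) = if b xor c then 0 else 1

δ-true : ∀ a b {n} → δ a b ≡ suc n → a ≡ b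
δ-true nothing      nothing      _ = refl
δ-true (just false) (just false) _ = refl
δ-true (just true)  (just true)  _ = refl
δ-true (just false) (just true)  ()
δ-true (just true)  (just false) ()

δ-assume : ∀ a b {x y} → (a ≡ b → x ≡ y) → δ a b * x ≡ δ a b * y
δ-assume a b f with δ a b in eq
... | zero  = refl
... | suc n = cong (suc n *_) (f (δ-true a b eq))

δ-assume-≤ : ∀ a b {x y} → (a ≡ b → x ≤ y) → δ a b * x ≤ δ a b * y
δ-assume-≤ a b f with δ a b in eq
... | zero  = z≤n
... | suc n = *-monoʳ-≤ (suc n) (f (δ-true a b eq))

∑-head : ∀ {V} a (g : Restriction (suc V) → ℕ) →
         ∑ (λ ρ → δ a (lookup ρ zero) * g ρ) ≡ ∑ (g ∘ (a ∷_))
∑-head {V} nothing      g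
  rewrite ∑-zero {V} {λ ρ → 0} (λ _ → refl)
        | ∑-* 1 (g ∘ (nothing ∷_)) = lemma _
  where
  lemma : ∀ x → x + 0 + 0 ≡ x
  lemma = solve-∀
∑-head {V} (just false) g
  rewrite ∑-zero {V} {λ ρ → 0} (λ _ → refl)
        | ∑-* 1 (g ∘ (just false ∷_)) = lemma _
  where
  lemma : ∀ x → x + 0 + 0 ≡ x
  lemma = solve-∀
∑-head {V} (just true)  g
  rewrite ∑-zero {V} {λ ρ → 0} (λ _ → refl)
        | ∑-* 1 (g ∘ (just true ∷_)) = lemma _
  where
  lemma : ∀ x → x + 0 ≡ x
  lemma = solve-∀

-- Overwriting `v` is a bijection from the restrictions with value `c` at `v` to those with value
-- `a`. The switching argument moves mass between restrictions through this change of variables.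
∑-shift : ∀ {V} (v : Fin V) a c (h : Restriction V → ℕ) →
          ∑ (λ ρ → δ a (lookup ρ v) * h ρ) ≡ ∑ (λ ρ → δ c (lookup ρ v) * h (ρ [ v ]≔ a))
∑-shift zero    a c h = trans (∑-head a h) (sym (∑-head c (λ ρ → h (ρ [ zero ]≔ a))))
∑-shift (suc v) a c h =
  cong₂ _+_ (∑-shift v a c _) (cong₂ _+_ (∑-shift v a c _) (∑-shift v a c _))

-- Håstad's induction conditions the random restriction on the first term being
-- falsified.  The result is no longer a product distribution, but fixing a free
-- variable still multiplies the weight by at least K.
Growing : ∀ {V} → ℕ → (Restriction V → ℕ) → Set
Growing K w = ∀ ρ v b → K * w (ρ [ v ]≔ nothing) ≤ w (ρ [ v ]≔ just b)

-- Canonical decision trees and the switching lemma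

Literal Cube DNF : ℕ → Set
Literal V = Fin V × Bool
Cube V    = List (Literal V)
DNF V     = List (Cube V)

Distinct : ∀ {V} → Cube V → Set
Distinct C = Unique (List.map proj₁ C)

clash : Bool → Maybe Bool → Bool
clash b     nothing      = false
clash true  (just c)     = not c
clash false (just c)     = c

falsified : ∀ {V} → Cube V → Restriction V → Bool
falsified []            ρ = false
falsified ((v , b) ∷ C) ρ = clash b (lookup ρ v) ∨ falsified C ρ

ind : Bool → ℕ
ind b = if b then 1 else 0

satisfied : ∀ {V} → Cube V → Restriction V → ℕ
satisfied []            ρ = 1
satisfied ((v , b) ∷ C) ρ = δ (just b) (lookup ρ v) * satisfied C ρ

module _ {V : ℕ} where

  -- The flag records whether a variable of the term has been queried. If none was, a satisfied term
  -- makes the DNF constant and ends the tree, hence 0. After a query the tree goes on with the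
  -- remaining terms even where the term has become satisfied, and `t ∸ 1` stays at 0 once the
  -- length is used up. Both only overcount, and later only the vanishing of the count matters.
  query : Bool → Cube V → (ℕ → Restriction V → ℕ) → ℕ → Restriction V → ℕ
  query false []            k t ρ = 0
  query true  []            k t ρ = k t ρ
  query e     ((v , b) ∷ C) k t ρ =
    δ (just b) (lookup ρ v) * query e C k t ρ +
    δ nothing (lookup ρ v) * (query true C k (t ∸ 1) (ρ [ v ]≔ just false) +
                              query true C k (t ∸ 1) (ρ [ v ]≔ just true))

  -- The number of paths of length t in the canonical decision tree of the DNF
  -- under ρ: the first term not falsified has all its free variables queried.
  paths : DNF V → ℕ → Restriction V → ℕ
  paths _       zero    ρ = 1
  paths []      (suc t) ρ = 0
  paths (C ∷ F) (suc t) ρ =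
    query false C (paths F) (suc t) ρ + ind (falsified C ρ) * paths F (suc t) ρ

  ≔-undo : ∀ (ρ : Restriction V) v c → just c ≡ lookup ρ v →
           (ρ [ v ]≔ nothing) [ v ]≔ just c ≡ ρ
  ≔-undo ρ v c eq =
    trans ([]≔-idempotent ρ v) (trans (cong (ρ [ v ]≔_) eq) ([]≔-lookup ρ v))

  satisfied-≔ : ∀ C (ρ : Restriction V) v a → All (λ l → v ≢ proj₁ l) C →
                satisfied C (ρ [ v ]≔ a) ≡ satisfied C ρ
  satisfied-≔ []            ρ v a []          = refl
  satisfied-≔ ((u , b) ∷ C) ρ v a (v≢u ∷ v∉C) =
    cong₂ (λ x y → δ (just b) x * y) (lookup∘update′ (v≢u ∘ sym) ρ a) (satisfied-≔ C ρ v a v∉C)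

  module _ {K : ℕ} where

    -- Freeing `v` itself makes the left side 0, and an update elsewhere does not touch the factor.
    -- `growing-free` holds for the same reason, because updates at different variables commute.
    growing-δ : ∀ (w : Restriction V → ℕ) v b → Growing K w →
                Growing K (λ ρ → δ (just b) (lookup ρ v) * w ρ)
    growing-δ w v b g ρ u c with v Fin.≟ u
    ... | yes refl rewrite lookup∘update v ρ nothing = ≤-trans (≤-reflexive (*-zeroʳ K)) z≤n
    ... | no v≢u
      rewrite lookup∘update′ v≢u ρ nothing | lookup∘update′ v≢u ρ (just c) = begin
        K * (d * w (ρ [ u ]≔ nothing)) ≡⟨ lemma K d _ ⟩
        d * (K * w (ρ [ u ]≔ nothing)) ≤⟨ *-monoʳ-≤ d (g ρ u c) ⟩
        d * w (ρ [ u ]≔ just c)        ∎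
      where
      open ≤-Reasoning
      d = δ (just b) (lookup ρ v)
      lemma : ∀ x y z → x * (y * z) ≡ y * (x * z)
      lemma = solve-∀

    growing-free : ∀ (w : Restriction V → ℕ) v b → Growing K w →
                   Growing K (λ ρ → δ (just b) (lookup ρ v) * w (ρ [ v ]≔ nothing))
    growing-free w v b g ρ u c with v Fin.≟ u
    ... | yes refl rewrite lookup∘update v ρ nothing = ≤-trans (≤-reflexive (*-zeroʳ K)) z≤n
    ... | no v≢u
      rewrite lookup∘update′ v≢u ρ nothing | lookup∘update′ v≢u ρ (just c)
            | []≔-commutes {x = nothing} {y = nothing} ρ u v (v≢u ∘ sym)
            | []≔-commutes {x = just c} {y = nothing} ρ u v (v≢u ∘ sym) = begin
        K * (d * w ((ρ [ v ]≔ nothing) [ u ]≔ nothing)) ≡⟨ lemma K d _ ⟩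
        d * (K * w ((ρ [ v ]≔ nothing) [ u ]≔ nothing)) ≤⟨ *-monoʳ-≤ d (g _ u c) ⟩
        d * w ((ρ [ v ]≔ nothing) [ u ]≔ just c)        ∎
      where
      open ≤-Reasoning
      d = δ (just b) (lookup ρ v)
      lemma : ∀ x y z → x * (y * z) ≡ y * (x * z)
      lemma = solve-∀

    clash-≔ : ∀ C (ρ : Restriction V) v b →
              ind (falsified C (ρ [ v ]≔ nothing)) ≤ ind (falsified C (ρ [ v ]≔ just b))
    clash-≔ []            ρ v b = z≤n
    clash-≔ ((u , c) ∷ C) ρ v b with u Fin.≟ v
    ... | no u≢v rewrite lookup∘update′ u≢v ρ nothing | lookup∘update′ u≢v ρ (just b)
      with clash c (lookup ρ u)
    ...   | true  = ≤-refl
    ...   | false = clash-≔ C ρ v b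
    clash-≔ ((u , c) ∷ C) ρ v b | yes refl
      rewrite lookup∘update u ρ nothing | lookup∘update u ρ (just b)
      with clash c (just b)
    ...   | true  = ind-≤1 (falsified C (ρ [ v ]≔ nothing))
      where
      ind-≤1 : ∀ b → ind b ≤ 1
      ind-≤1 true  = ≤-refl
      ind-≤1 false = z≤n
    ...   | false = clash-≔ C ρ v b

    -- A falsified literal stays falsified when more variables are fixed (`clash-≔`), so this
    -- conditioning favours fixed variables, the direction that `Growing` asks for. Conditioning on
    -- a term not being falsified could destroy it.
    growing-falsified : ∀ (w : Restriction V → ℕ) C → Growing K w →
                        Growing K (λ ρ → w ρ * ind (falsified C ρ))
    growing-falsified w C g ρ v b = begin
      K * (w (ρ [ v ]≔ nothing) * ind (falsified C (ρ [ v ]≔ nothing))) ≡⟨ *-assoc K _ _ ⟨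
      K * w (ρ [ v ]≔ nothing) * ind (falsified C (ρ [ v ]≔ nothing))   ≤⟨ *-mono-≤ (g ρ v b) (clash-≔ C ρ v b) ⟩
      w (ρ [ v ]≔ just b) * ind (falsified C (ρ [ v ]≔ just b))         ∎
      where open ≤-Reasoning

    2^-pred : ∀ t → 2 ^ t ≤ 2 * 2 ^ (t ∸ 1)
    2^-pred zero    = s≤s z≤n
    2^-pred (suc t) = ≤-refl

    base : Bool → ℕ
    base e = if e then K else 0

    -- Induction over the literals. A fixed literal only conditions the weight. A free one has two
    -- branches; each costs a factor 2 for the shorter length and a factor 2 from
    -- `K + 8 * length C ≤ K + K`, which makes the `8` per literal. Divided by `K`, the factor is
    -- `8 * length C / K` before any query; once a variable has been queried `base` adds 1, because
    -- at the end of the term `hyp` gains nothing. The right side counts only the mass that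
    -- satisfies the term, which `switching` needs.
    query-bound : ∀ {k} →
      (∀ t w → Growing K w → 2 ^ t * ∑ (λ ρ → w ρ * k t ρ) ≤ ∑ w) →
      ∀ e C → Distinct C → 8 * length C ≤ K → ∀ t w → Growing K w →
      K * (2 ^ t * ∑ (λ ρ → w ρ * query e C k t ρ)) ≤
      (base e + 8 * length C) * ∑ (λ ρ → w ρ * satisfied C ρ)
    query-bound hyp false [] _ _ t w g
      rewrite ∑-zero {h = λ ρ → w ρ * 0} (λ ρ → *-zeroʳ (w ρ)) | *-zeroʳ (2 ^ t) | *-zeroʳ K = z≤n
    query-bound hyp true [] _ _ t w g
      rewrite ∑-cong {g = λ ρ → w ρ * 1} {h = w} (λ ρ → *-identityʳ (w ρ)) | +-identityʳ K =
      *-monoʳ-≤ K (hyp t w g)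
    query-bound {k} hyp e ((v , b) ∷ C) (v∉C ∷ distinct) 8C≤K t w g = begin
      K * (2 ^ t * ∑ (λ ρ → w ρ * query e ((v , b) ∷ C) k t ρ))
        ≡⟨ cong (λ z → K * (2 ^ t * z)) split ⟩
      K * (2 ^ t * (S₁ + (S₂ false + S₂ true)))
        ≡⟨ lemma₁ K (2 ^ t) S₁ (S₂ false) (S₂ true) ⟩
      K * (2 ^ t * S₁) + (K * (2 ^ t * S₂ false) + K * (2 ^ t * S₂ true))
        ≤⟨ +-mono-≤ fixed (+-mono-≤ (free false) (free true)) ⟩
      (base e + 8 * length C) * A + (4 * A + 4 * A)
        ≡⟨ lemma₂ (base e) (length C) A ⟩
      (base e + 8 * suc (length C)) * A ∎
      where
      open ≤-Reasoning
      8C≤K′ : 8 * length C ≤ K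
      8C≤K′ = ≤-trans (*-monoʳ-≤ 8 (n≤1+n (length C))) 8C≤K
      A S₁ : ℕ
      A  = ∑ (λ ρ → w ρ * satisfied ((v , b) ∷ C) ρ)
      w₁ : Restriction V → ℕ
      w₁ ρ = δ (just b) (lookup ρ v) * w ρ
      w₂ : Bool → Restriction V → ℕ
      w₂ c ρ = δ (just c) (lookup ρ v) * w (ρ [ v ]≔ nothing)
      h : Bool → Restriction V → ℕ
      h c ρ = w ρ * query true C k (t ∸ 1) (ρ [ v ]≔ just c)
      S₁ = ∑ (λ ρ → w₁ ρ * query e C k t ρ)
      S₂ : Bool → ℕ
      S₂ c = ∑ (λ ρ → δ nothing (lookup ρ v) * h c ρ)
      lemma₀ : ∀ w d q n x y → w * (d * q + n * (x + y)) ≡ d * w * q + (n * (w * x) + n * (w * y))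
      lemma₀ = solve-∀
      lemma₁ : ∀ k p x y z → k * (p * (x + (y + z))) ≡ k * (p * x) + (k * (p * y) + k * (p * z))
      lemma₁ = solve-∀
      lemma₂ : ∀ e l a → (e + 8 * l) * a + (4 * a + 4 * a) ≡ (e + 8 * suc l) * a
      lemma₂ = solve-∀
      split : ∑ (λ ρ → w ρ * query e ((v , b) ∷ C) k t ρ) ≡ S₁ + (S₂ false + S₂ true)
      split = trans (∑-cong λ ρ → lemma₀′ e ρ)
                (trans (∑-+ {V} _ _) (cong (S₁ +_) (∑-+ {V} _ _)))
        where
        lemma₀′ : ∀ e ρ → w ρ * query e ((v , b) ∷ C) k t ρ ≡ w₁ ρ * query e C k t ρ +
                  (δ nothing (lookup ρ v) * h false ρ + δ nothing (lookup ρ v) * h true ρ)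
        lemma₀′ false ρ = lemma₀ (w ρ) (δ (just b) (lookup ρ v)) _ (δ nothing (lookup ρ v)) _ _
        lemma₀′ true  ρ = lemma₀ (w ρ) (δ (just b) (lookup ρ v)) _ (δ nothing (lookup ρ v)) _ _
      fixed : K * (2 ^ t * S₁) ≤ (base e + 8 * length C) * A
      fixed = subst (λ z → K * (2 ^ t * S₁) ≤ (base e + 8 * length C) * z)
                (∑-cong λ ρ → lemma₃ (δ (just b) (lookup ρ v)) (w ρ) (satisfied C ρ))
                (query-bound hyp e C distinct 8C≤K′ t w₁ (growing-δ w v b g))
        where
        lemma₃ : ∀ d w s → d * w * s ≡ w * (d * s)
        lemma₃ = solve-∀
      S₂-shift : ∀ c → S₂ c ≡ ∑ (λ ρ → w₂ c ρ * query true C k (t ∸ 1) ρ)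
      S₂-shift c = trans (∑-shift v nothing (just c) (h c)) (∑-cong λ ρ →
        trans (δ-assume (just c) (lookup ρ v) λ eq →
                 cong (λ σ → w (ρ [ v ]≔ nothing) * query true C k (t ∸ 1) σ) (≔-undo ρ v c eq))
              (sym (*-assoc (δ (just c) (lookup ρ v)) _ _)))
      v∉ : All (λ l → v ≢ proj₁ l) C
      v∉ = go C v∉C
        where
        go : ∀ C → All (v ≢_) (List.map proj₁ C) → All (λ l → v ≢ proj₁ l) C
        go []      []       = []
        go (_ ∷ C) (p ∷ ps) = p ∷ go C ps
      -- Moving the mass from the value `c` at `v` to the value `b` demanded by the literal
      -- satisfies the longer term, and `Growing` pays for the factor `K`.
      swap : ∀ c → K * ∑ (λ ρ → w₂ c ρ * satisfied C ρ) ≤ A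
      swap c = begin
        K * ∑ (λ ρ → w₂ c ρ * satisfied C ρ)
          ≡⟨ cong (K *_) (∑-cong λ ρ → *-assoc (δ (just c) (lookup ρ v)) _ _) ⟩
        K * ∑ (λ ρ → δ (just c) (lookup ρ v) * (w (ρ [ v ]≔ nothing) * satisfied C ρ))
          ≡⟨ cong (K *_) (∑-shift v (just c) (just b) _) ⟩
        K * ∑ (λ ρ → δ (just b) (lookup ρ v) *
                     (w ((ρ [ v ]≔ just c) [ v ]≔ nothing) * satisfied C (ρ [ v ]≔ just c)))
          ≡⟨ ∑-* {V} K _ ⟨
        ∑ (λ ρ → K * (δ (just b) (lookup ρ v) *
                     (w ((ρ [ v ]≔ just c) [ v ]≔ nothing) * satisfied C (ρ [ v ]≔ just c))))
          ≤⟨ ∑-mono pointwise ⟩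
        A ∎
        where
        lemma₄ : ∀ k d w s → k * (d * (w * s)) ≡ d * (k * w * s)
        lemma₄ = solve-∀
        lemma₅ : ∀ w d s → d * (w * s) ≡ w * (d * s)
        lemma₅ = solve-∀
        pointwise : ∀ ρ → K * (δ (just b) (lookup ρ v) *
                      (w ((ρ [ v ]≔ just c) [ v ]≔ nothing) * satisfied C (ρ [ v ]≔ just c))) ≤
                    w ρ * satisfied ((v , b) ∷ C) ρ
        pointwise ρ
          rewrite satisfied-≔ C ρ v (just c) v∉ | []≔-idempotent {x = just c} {y = nothing} ρ v = begin
          K * (d * (w (ρ [ v ]≔ nothing) * satisfied C ρ)) ≡⟨ lemma₄ K d _ _ ⟩
          d * (K * w (ρ [ v ]≔ nothing) * satisfied C ρ)   ≤⟨ δ-assume-≤ (just b) (lookup ρ v) (λ eq →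
              *-monoˡ-≤ (satisfied C ρ) (≤-trans (g ρ v b) (≤-reflexive (cong w
                (trans (cong (ρ [ v ]≔_) eq) ([]≔-lookup ρ v)))))) ⟩
          d * (w ρ * satisfied C ρ)                        ≡⟨ lemma₅ (w ρ) d _ ⟩
          w ρ * (d * satisfied C ρ)                        ∎
          where d = δ (just b) (lookup ρ v)
      free : ∀ c → K * (2 ^ t * S₂ c) ≤ 4 * A
      free c = begin
        K * (2 ^ t * S₂ c)                                ≤⟨ *-monoʳ-≤ K (*-monoˡ-≤ (S₂ c) (2^-pred t)) ⟩
        K * (2 * 2 ^ (t ∸ 1) * S₂ c)                      ≡⟨ lemma₆ K (2 ^ (t ∸ 1)) (S₂ c) ⟩
        2 * (K * (2 ^ (t ∸ 1) * S₂ c))                    ≡⟨ cong (λ z → 2 * (K * (2 ^ (t ∸ 1) * z))) (S₂-shift c) ⟩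
        2 * (K * (2 ^ (t ∸ 1) * ∑ (λ ρ → w₂ c ρ * query true C k (t ∸ 1) ρ)))
          ≤⟨ *-monoʳ-≤ 2 (query-bound hyp true C distinct 8C≤K′ (t ∸ 1) (w₂ c) (growing-free w v c g)) ⟩
        2 * ((K + 8 * length C) * Z)                      ≤⟨ *-monoʳ-≤ 2 (*-monoˡ-≤ Z (+-monoʳ-≤ K 8C≤K′)) ⟩
        2 * ((K + K) * Z)                                 ≡⟨ lemma₇ K Z ⟩
        4 * (K * Z)                                       ≤⟨ *-monoʳ-≤ 4 (swap c) ⟩
        4 * A                                             ∎
        where
        Z = ∑ (λ ρ → w₂ c ρ * satisfied C ρ)
        lemma₆ : ∀ k p s → k * (2 * p * s) ≡ 2 * (k * (p * s))
        lemma₆ = solve-∀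
        lemma₇ : ∀ k z → 2 * ((k + k) * z) ≡ 4 * (k * z)
        lemma₇ = solve-∀

    satisfied+falsified≤1 : ∀ C (ρ : Restriction V) → satisfied C ρ + ind (falsified C ρ) ≤ 1
    satisfied+falsified≤1 []            ρ = ≤-refl
    satisfied+falsified≤1 ((v , b) ∷ C) ρ with b | lookup ρ v
    ... | true  | nothing    = ≤-trans (m≤n+m _ (satisfied C ρ)) (satisfied+falsified≤1 C ρ)
    ... | false | nothing    = ≤-trans (m≤n+m _ (satisfied C ρ)) (satisfied+falsified≤1 C ρ)
    ... | true  | just true  rewrite +-identityʳ (satisfied C ρ) = satisfied+falsified≤1 C ρ
    ... | false | just false rewrite +-identityʳ (satisfied C ρ) = satisfied+falsified≤1 C ρ
    ... | true  | just false = ≤-refl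
    ... | false | just true  = ≤-refl

  Narrow : ℕ → Cube V → Set
  Narrow K C = Distinct C × 8 * length C ≤ K

  -- The paths that query the first term are charged to the mass on which it is satisfied, all
  -- others to the mass on which it is falsified. The two are disjoint, so the bound does not grow
  -- with the number of terms.
  switching : ∀ {K} .{{_ : NonZero K}} F → All (Narrow K) F → ∀ t w → Growing K w →
              2 ^ t * ∑ (λ ρ → w ρ * paths F t ρ) ≤ ∑ w
  switching F _ zero w g = ≤-reflexive (trans (*-identityˡ _) (∑-cong λ ρ → *-identityʳ (w ρ)))
  switching [] [] (suc t) w g
    rewrite ∑-zero {h = λ ρ → w ρ * 0} (λ ρ → *-zeroʳ (w ρ)) | *-zeroʳ (2 ^ suc t) = z≤n
  switching {K} (C ∷ F) ((distinct , 8C≤K) ∷ narrow) (suc t) w g = begin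
    2 ^ suc t * ∑ (λ ρ → w ρ * paths (C ∷ F) (suc t) ρ)
      ≡⟨ cong (2 ^ suc t *_) (trans (∑-cong λ ρ → lemma₁ (w ρ) _ (ind (falsified C ρ)) _) (∑-+ {V} _ _)) ⟩
    2 ^ suc t * (S₁ + S₂)
      ≡⟨ *-distribˡ-+ (2 ^ suc t) S₁ S₂ ⟩
    2 ^ suc t * S₁ + 2 ^ suc t * S₂
      ≤⟨ +-mono-≤ (*-cancelˡ-≤ K (≤-trans
           (query-bound (switching F narrow) false C distinct 8C≤K (suc t) w g)
           (*-monoˡ-≤ (∑ (λ ρ → w ρ * satisfied C ρ)) 8C≤K)))
           (switching F narrow (suc t) _ (growing-falsified {K} w C g)) ⟩
    ∑ (λ ρ → w ρ * satisfied C ρ) + ∑ (λ ρ → w ρ * ind (falsified C ρ))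
      ≡⟨ ∑-+ {V} _ _ ⟨
    ∑ (λ ρ → w ρ * satisfied C ρ + w ρ * ind (falsified C ρ))
      ≤⟨ ∑-mono (λ ρ → ≤-trans (≤-reflexive (sym (*-distribˡ-+ (w ρ) _ _)))
           (≤-trans (*-monoʳ-≤ (w ρ) (satisfied+falsified≤1 {K} C ρ)) (≤-reflexive (*-identityʳ (w ρ))))) ⟩
    ∑ w ∎
    where
    open ≤-Reasoning
    S₁ = ∑ (λ ρ → w ρ * query false C (paths F) (suc t) ρ)
    S₂ = ∑ (λ ρ → w ρ * ind (falsified C ρ) * paths F (suc t) ρ)
    lemma₁ : ∀ w q i p → w * (q + i * p) ≡ w * q + w * i * p
    lemma₁ = solve-∀

-- Subcubes, certificates and what the canonical tree decides

infix 4 _⊨_ _⊑_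

record _⊨_ {V} (x : Vec Bool V) (ρ : Restriction V) : Set where
  constructor mk⊨
  field value : ∀ v b → lookup ρ v ≡ just b → lookup x v ≡ b

record _⊑_ {V} (ρ σ : Restriction V) : Set where
  constructor mk⊑
  field fixes : ∀ v b → lookup ρ v ≡ just b → lookup σ v ≡ just b

open _⊨_ public
open _⊑_ public

⊨-⊑ : ∀ {V} {ρ σ : Restriction V} {x} → ρ ⊑ σ → x ⊨ σ → x ⊨ ρ
⊨-⊑ ρ⊑σ x⊨σ = mk⊨ λ v b eq → value x⊨σ v b (fixes ρ⊑σ v b eq)

⊑-refl : ∀ {V} {ρ : Restriction V} → ρ ⊑ ρ
⊑-refl = mk⊑ λ _ _ eq → eq

⊑-trans : ∀ {V} {ρ σ τ : Restriction V} → ρ ⊑ σ → σ ⊑ τ → ρ ⊑ τ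
⊑-trans ρ⊑σ σ⊑τ = mk⊑ λ v b eq → fixes σ⊑τ v b (fixes ρ⊑σ v b eq)

⊨-≔ : ∀ {V} {ρ : Restriction V} {x} v {b} → lookup x v ≡ b → x ⊨ ρ → x ⊨ ρ [ v ]≔ just b
⊨-≔ {ρ = ρ} {x} v {b} xv x⊨ρ = mk⊨ go
  where
  go : ∀ u c → lookup (ρ [ v ]≔ just b) u ≡ just c → lookup x u ≡ c
  go u c eq with u Fin.≟ v
  ... | yes refl = trans xv (just-injective (trans (sym (lookup∘update v ρ (just b))) eq))
  ... | no u≢v   = value x⊨ρ u c (trans (sym (lookup∘update′ u≢v ρ (just b))) eq)

Agree : ∀ {V} → List (Fin V) → Vec Bool V → Vec Bool V → Set
Agree M x y = All (λ v → lookup y v ≡ lookup x v) M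

-- Certificate complexity at most t on the subcube ρ.
Cert : ∀ {V} → ℕ → Restriction V → (Vec Bool V → Bool) → Set
Cert t ρ f = ∀ x → x ⊨ ρ →
             ∃ λ M → length M ≤ t × (∀ y → y ⊨ ρ → Agree M x y → f y ≡ f x)

cert-⊑ : ∀ {V t} {ρ σ : Restriction V} {f} → ρ ⊑ σ → Cert t ρ f → Cert t σ f
cert-⊑ ρ⊑σ cert x x⊨σ with cert x (⊨-⊑ ρ⊑σ x⊨σ)
... | M , M≤t , ok = M , M≤t , λ y y⊨σ → ok y (⊨-⊑ ρ⊑σ y⊨σ)

Satisfies : ∀ {V} → Vec Bool V → Cube V → Set
Satisfies x = All (λ l → lookup x (proj₁ l) ≡ proj₂ l)

falsified-≔ : ∀ {V} C (ρ : Restriction V) v a → All (v ≢_) (List.map proj₁ C) →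
              falsified C (ρ [ v ]≔ a) ≡ falsified C ρ
falsified-≔ []            ρ v a []          = refl
falsified-≔ ((u , b) ∷ C) ρ v a (v≢u ∷ v∉C) =
  cong₂ (λ x y → clash b x ∨ y) (lookup∘update′ (v≢u ∘ sym) ρ a) (falsified-≔ C ρ v a v∉C)

clash-false : ∀ b c → clash b (just c) ≡ false → c ≡ b
clash-false true  true  _ = refl
clash-false false false _ = refl

clash-true : ∀ b a → clash b a ≡ true → a ≡ just (not b)
clash-true true  (just false) _ = refl
clash-true false (just true)  _ = refl

∨-false : ∀ a b → a ∨ b ≡ false → a ≡ false × b ≡ false
∨-false false false _ = refl , refl

module _ {V : ℕ} where

  falsified⇒¬satisfies : ∀ (C : Cube V) ρ x → falsified C ρ ≡ true → x ⊨ ρ → ¬ Satisfies x C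
  falsified⇒¬satisfies ((v , b) ∷ C) ρ x f x⊨ρ (xv ∷ xC) with clash b (lookup ρ v) in eq
  ... | false = falsified⇒¬satisfies C ρ x f x⊨ρ xC
  ... | true  = not-≢ b (trans (sym xv) (value x⊨ρ v (not b) (clash-true b (lookup ρ v) eq)))
    where
    not-≢ : ∀ b → b ≢ not b
    not-≢ true  ()
    not-≢ false ()

  extend : ∀ C (x y : Vec Bool V) {v b} → lookup x v ≡ lookup y v →
           (Satisfies x C ⇔ Satisfies y C) → Satisfies x ((v , b) ∷ C) ⇔ Satisfies y ((v , b) ∷ C)
  extend C x y xv e = mk⇔ (λ { (p ∷ ps) → trans (sym xv) p ∷ Equivalence.to e ps })
                    (λ { (p ∷ ps) → trans xv p ∷ Equivalence.from e ps })

  module _ {k : ℕ → Restriction V → ℕ} {G : Vec Bool V → Set}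
    (hyp : ∀ t ρ x → x ⊨ ρ → k t ρ ≡ 0 →
           ∃ λ M → length M < t × (∀ y → y ⊨ ρ → Agree M x y → G x ⇔ G y))
    where

    -- `G` stands for the terms that follow `C`. The list consists of the variables queried along
    -- the path of `x`, so it settles both at once.
    Decides : Cube V → ℕ → Restriction V → Vec Bool V → Set
    Decides C t ρ x = ∃ λ M → length M < t ×
      (∀ y → y ⊨ ρ → Agree M x y → (Satisfies x C ⇔ Satisfies y C) × (G x ⇔ G y))

    shorten : ∀ {m} t → m < t ∸ 1 → suc m < t
    shorten (suc t) m<t = s<s m<t

    pick : ∀ b {q r : ℕ} → q + r + 0 ≡ 0 → (if b then r else q) ≡ 0
    pick false {zero} _ = refl
    pick true  {zero} {zero} _ = refl

    query-true-decides : ∀ C t ρ x → Distinct C → falsified C ρ ≡ false → x ⊨ ρ →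
                         query true C k t ρ ≡ 0 → Decides C t ρ x

    query-free-decides : ∀ v b C t ρ x → Distinct ((v , b) ∷ C) → falsified C ρ ≡ false → x ⊨ ρ →
      query true C k (t ∸ 1) (ρ [ v ]≔ just false) + query true C k (t ∸ 1) (ρ [ v ]≔ just true) + 0 ≡ 0 →
      Decides ((v , b) ∷ C) t ρ x
    query-free-decides v b C t ρ x (v∉C ∷ distinct) f x⊨ρ q≡0
      with query-true-decides C (t ∸ 1) (ρ [ v ]≔ just (lookup x v)) x distinct
             (trans (falsified-≔ C ρ v (just (lookup x v)) v∉C) f) (⊨-≔ v refl x⊨ρ) q′
      where
      q′ : query true C k (t ∸ 1) (ρ [ v ]≔ just (lookup x v)) ≡ 0
      q′ with lookup x v
      ... | false = pick false q≡0
      ... | true  = pick true {query true C k (t ∸ 1) (ρ [ v ]≔ just false)} q≡0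
    ... | M , M<t , ok = v ∷ M , shorten t M<t , λ { y y⊨ρ (yv ∷ yM) →
      let sat , g = ok y (⊨-≔ v yv y⊨ρ) yM
      in extend C x y (sym yv) sat , g }

    query-true-decides [] t ρ x _ _ x⊨ρ q≡0 with hyp t ρ x x⊨ρ q≡0
    ... | M , M<t , ok = M , M<t , λ y y⊨ρ yM → mk⇔ (λ _ → []) (λ _ → []) , ok y y⊨ρ yM
    query-true-decides ((v , b) ∷ C) t ρ x (v∉C ∷ distinct) f x⊨ρ q≡0
      with lookup ρ v in eq
    ... | nothing = query-free-decides v b C t ρ x (v∉C ∷ distinct) f x⊨ρ q≡0
    ... | just c
      with refl ← clash-false b c (proj₁ (∨-false (clash b (just c)) _ f))
      with query-true-decides C t ρ x distinct (proj₂ (∨-false (clash b (just c)) _ f)) x⊨ρ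
             (no-query b q≡0)
      where
      no-query : ∀ c {q} → δ (just c) (just c) * q + 0 ≡ 0 → q ≡ 0
      no-query true  {zero} _ = refl
      no-query false {zero} _ = refl
    ...   | M , M<t , ok = M , M<t , λ y y⊨ρ yM →
      let sat , g = ok y y⊨ρ yM
      in extend C x y (trans (value x⊨ρ v c eq) (sym (value y⊨ρ v c eq))) sat , g

    -- The count is also 0 when every literal is already fixed to true; then the term holds on the
    -- whole subcube and the later terms are irrelevant. Hence the first alternative, in which
    -- nothing is said about `G`.
    query-false-decides : ∀ C t ρ x → Distinct C → falsified C ρ ≡ false → x ⊨ ρ →
                          query false C k t ρ ≡ 0 → (∀ y → y ⊨ ρ → Satisfies y C) ⊎ Decides C t ρ x
    query-false-decides [] t ρ x _ _ _ _ = inj₁ λ _ _ → []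
    query-false-decides ((v , b) ∷ C) t ρ x (v∉C ∷ distinct) f x⊨ρ q≡0
      with lookup ρ v in eq
    ... | nothing = inj₂ (query-free-decides v b C t ρ x (v∉C ∷ distinct) f x⊨ρ q≡0)
    ... | just c
      with refl ← clash-false b c (proj₁ (∨-false (clash b (just c)) _ f))
      with query-false-decides C t ρ x distinct (proj₂ (∨-false (clash b (just c)) _ f)) x⊨ρ
             (no-query b q≡0)
      where
      no-query : ∀ c {q} → δ (just c) (just c) * q + 0 ≡ 0 → q ≡ 0
      no-query true  {zero} _ = refl
      no-query false {zero} _ = refl
    ...   | inj₁ sat = inj₁ λ y y⊨ρ → value y⊨ρ v c eq ∷ sat y y⊨ρ
    ...   | inj₂ (M , M<t , ok) = inj₂ (M , M<t , λ y y⊨ρ yM →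
      let sat , g = ok y y⊨ρ yM
      in extend C x y (trans (value x⊨ρ v c eq) (sym (value y⊨ρ v c eq))) sat , g)

  any-∷ : ∀ (x y : Vec Bool V) {C F} → Satisfies x C ⇔ Satisfies y C →
          Any (Satisfies x) F ⇔ Any (Satisfies y) F →
          Any (Satisfies x) (C ∷ F) ⇔ Any (Satisfies y) (C ∷ F)
  any-∷ x y e f = mk⇔ (λ { (here p) → here (Equivalence.to e p) ; (there p) → there (Equivalence.to f p) })
                  (λ { (here p) → here (Equivalence.from e p) ; (there p) → there (Equivalence.from f p) })

  -- The path of `x` in the canonical tree has fewer than `t` queries, and an input that answers
  -- them alike follows the same path. A falsified first term is skipped.
  paths-decide : ∀ F → All Distinct F → ∀ t ρ x → x ⊨ ρ → paths F t ρ ≡ 0 →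
                 ∃ λ M → length M < t × (∀ y → y ⊨ ρ → Agree M x y →
                                         Any (Satisfies x) F ⇔ Any (Satisfies y) F)
  paths-decide F       _ zero    ρ x x⊨ρ ()
  paths-decide []      _ (suc t) ρ x x⊨ρ _ = [] , z<s , λ _ _ _ → mk⇔ (λ ()) (λ ())
  paths-decide (C ∷ F) (dC ∷ dF) (suc t) ρ x x⊨ρ p≡0 with falsified C ρ in eq
  ... | true  = let M , M<t , ok = paths-decide F dF (suc t) ρ x x⊨ρ
                                     (trans (sym (+-identityʳ _)) (m+n≡0⇒n≡0 (query false C (paths F) (suc t) ρ) p≡0))
                in M , M<t , λ y y⊨ρ yM → any-∷ x y
                     (mk⇔ (λ s → contradiction s (falsified⇒¬satisfies C ρ x eq x⊨ρ))
                          (λ s → contradiction s (falsified⇒¬satisfies C ρ y eq y⊨ρ)))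
                     (ok y y⊨ρ yM)
  ... | false with query-false-decides (paths-decide F dF) C (suc t) ρ x dC eq x⊨ρ
                     (m+n≡0⇒m≡0 _ p≡0)
  ...   | inj₁ sat = [] , z<s , λ y y⊨ρ _ → mk⇔ (λ _ → here (sat y y⊨ρ)) (λ _ → here (sat x x⊨ρ))
  ...   | inj₂ (M , M<t , ok) = M , M<t , λ y y⊨ρ yM →
          let e , f = ok y y⊨ρ yM in any-∷ x y e f

  Computes : DNF V → Restriction V → (Vec Bool V → Bool) → Set
  Computes F ρ f = ∀ x → x ⊨ ρ → Any (Satisfies x) F ⇔ f x ≡ true

  paths-cert : ∀ {F ρ f} t → All Distinct F → Computes F ρ f → paths F (suc t) ρ ≡ 0 → Cert t ρ f
  paths-cert {F} {ρ} t dF computes p≡0 x x⊨ρ =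
    let M , M<t , ok = paths-decide F dF (suc t) ρ x x⊨ρ p≡0
    in M , s≤s⁻¹ M<t , λ y y⊨ρ yM → ⇔→≡ (mk⇔
         (λ fy → Equivalence.to (computes x x⊨ρ) (Equivalence.from (ok y y⊨ρ yM)
                   (Equivalence.from (computes y y⊨ρ) fy)))
         (λ fx → Equivalence.to (computes y y⊨ρ) (Equivalence.to (ok y y⊨ρ yM)
                   (Equivalence.from (computes x x⊨ρ) fx))))

-- Random restrictions and averaging

free : ∀ {V} → Restriction V → ℕ
free []            = 0
free (nothing ∷ ρ) = suc (free ρ)
free (just _  ∷ ρ) = free ρ

⊑-tail : ∀ {V a b} {ρ σ : Restriction V} → (a ∷ ρ) ⊑ (b ∷ σ) → ρ ⊑ σ
⊑-tail ρ⊑σ = mk⊑ λ v → fixes ρ⊑σ (suc v)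

free-⊑ : ∀ {V} {ρ σ : Restriction V} → ρ ⊑ σ → free σ ≤ free ρ
free-⊑ {ρ = []}          {[]}          _   = z≤n
free-⊑ {ρ = nothing ∷ ρ} {nothing ∷ σ} ρ⊑σ = s≤s (free-⊑ (⊑-tail ρ⊑σ))
free-⊑ {ρ = nothing ∷ ρ} {just _  ∷ σ} ρ⊑σ = m≤n⇒m≤1+n (free-⊑ (⊑-tail ρ⊑σ))
free-⊑ {ρ = just b  ∷ ρ} {just _  ∷ σ} ρ⊑σ = free-⊑ (⊑-tail ρ⊑σ)
free-⊑ {ρ = just b  ∷ ρ} {nothing ∷ σ} ρ⊑σ with () ← fixes ρ⊑σ zero b refl

-- A random restriction refining ρ: each free variable stays free with
-- probability 1 / (2K + 1) and is otherwise set by a fair coin.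
weight₁ : ℕ → Maybe Bool → Maybe Bool → ℕ
weight₁ K nothing  nothing  = 1
weight₁ K nothing  (just _) = K
weight₁ K (just b) a        = δ (just b) a

weight : ∀ {V} → ℕ → Restriction V → Restriction V → ℕ
weight K []      []      = 1
weight K (a ∷ ρ) (b ∷ σ) = weight₁ K a b * weight K ρ σ

weight-⊑ : ∀ {V} K (ρ σ : Restriction V) → 0 < weight K ρ σ → ρ ⊑ σ
weight-⊑ K ρ σ 0<w = mk⊑ (go ρ σ 0<w)
  where
  go : ∀ {V} (ρ σ : Restriction V) → 0 < weight K ρ σ →
       ∀ v b → lookup ρ v ≡ just b → lookup σ v ≡ just b
  go (just b ∷ ρ) (a ∷ σ) 0<w zero c eq with δ (just b) a in e
  ... | suc _ with refl ← δ-true (just b) a e = eq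
  go (a ∷ ρ) (b ∷ σ) 0<w (suc v) c eq with weight K ρ σ in e
  ... | zero  = contradiction (≤-trans 0<w (≤-reflexive (*-zeroʳ (weight₁ K a b)))) (λ ())
  ... | suc _ = go ρ σ (subst (0 <_) (sym e) z<s) v c eq

weight-growing : ∀ {V} K (ρ : Restriction V) → Growing K (weight K ρ)
weight-growing K (nothing ∷ ρ) (b ∷ σ) zero    c = ≤-reflexive (cong (K *_) (*-identityˡ _))
weight-growing K (just a  ∷ ρ) (b ∷ σ) zero    c = ≤-trans (≤-reflexive (*-zeroʳ K)) z≤n
weight-growing K (a ∷ ρ)       (b ∷ σ) (suc v) c = begin
  K * (u * weight K ρ (σ [ v ]≔ nothing)) ≡⟨ lemma K u _ ⟩
  u * (K * weight K ρ (σ [ v ]≔ nothing)) ≤⟨ *-monoʳ-≤ u (weight-growing K ρ σ v c) ⟩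
  u * weight K ρ (σ [ v ]≔ just c)        ∎
  where
  open ≤-Reasoning
  u = weight₁ K a b
  lemma : ∀ x y z → x * (y * z) ≡ y * (x * z)
  lemma = solve-∀

∑-weight : ∀ {V} K (ρ : Restriction V) → 0 < ∑ (weight K ρ)
∑-weight K []            = z<s
∑-weight {suc V} K (nothing ∷ ρ)    =
  ≤-trans (≤-trans (∑-weight K ρ) (≤-reflexive (trans (sym (*-identityˡ _)) (sym (∑-* 1 (weight K ρ)))))) (m≤m+n _ _)
∑-weight {suc V} K (just false ∷ ρ) =
  ≤-trans (≤-trans (∑-weight K ρ) (≤-reflexive (trans (sym (*-identityˡ _)) (sym (∑-* 1 (weight K ρ))))))
    (≤-trans (m≤m+n _ _) (m≤n+m _ (∑ {V} (λ σ → 0 * weight K ρ σ))))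
∑-weight {suc V} K (just true ∷ ρ)  =
  ≤-trans (≤-trans (∑-weight K ρ) (≤-reflexive (trans (sym (*-identityˡ _)) (sym (∑-* 1 (weight K ρ))))))
    (≤-trans (m≤n+m _ (∑ {V} (λ σ → 0 * weight K ρ σ))) (m≤n+m _ (∑ {V} (λ σ → 0 * weight K ρ σ))))

-- Linearity of expectation with the denominators cleared: a free variable survives with weight 1
-- out of `2 * K + 1`.
expected-free : ∀ {V} K (ρ : Restriction V) →
                (2 * K + 1) * ∑ (λ σ → weight K ρ σ * free σ) ≡ free ρ * ∑ (weight K ρ)
expected-free K [] = *-zeroʳ (2 * K + 1)
expected-free {suc V} K (nothing ∷ ρ) = begin
    (2 * K + 1) * (∑ (λ σ → 1 * weight K ρ σ * suc (free σ)) + (∑ (λ σ → K * weight K ρ σ * free σ) + ∑ (λ σ → K * weight K ρ σ * free σ)))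
      ≡⟨ cong ((2 * K + 1) *_) (cong₂ _+_
           (trans (∑-cong λ σ → lemma (weight K ρ σ) (free σ)) (∑-+ {V} _ _))
           (cong₂ _+_ scaled scaled)) ⟩
    (2 * K + 1) * (W + E + (K * E + K * E))           ≡⟨ lemma₁ K W E ⟩
    (2 * K + 1) * W + (2 * K + 1) * ((2 * K + 1) * E) ≡⟨ cong (λ z → (2 * K + 1) * W + (2 * K + 1) * z) (expected-free K ρ) ⟩
    (2 * K + 1) * W + (2 * K + 1) * (free ρ * W)      ≡⟨ lemma₂ K W (free ρ) ⟩
    suc (free ρ) * (1 * W + (K * W + K * W))
      ≡⟨ cong (suc (free ρ) *_) (cong₂ _+_ (∑-* {V} 1 _) (cong₂ _+_ (∑-* {V} K _) (∑-* {V} K _))) ⟨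
    suc (free ρ) * ∑ (weight K (nothing ∷ ρ)) ∎
  where
  open ≡-Reasoning
  W = ∑ (weight K ρ)
  E = ∑ (λ σ → weight K ρ σ * free σ)
  scaled : ∑ (λ σ → K * weight K ρ σ * free σ) ≡ K * E
  scaled = trans (∑-cong λ σ → *-assoc K (weight K ρ σ) (free σ)) (∑-* {V} K _)
  lemma : ∀ w f → 1 * w * suc f ≡ w + w * f
  lemma = solve-∀
  lemma₁ : ∀ k w e → (2 * k + 1) * (w + e + (k * e + k * e)) ≡ (2 * k + 1) * w + (2 * k + 1) * ((2 * k + 1) * e)
  lemma₁ = solve-∀
  lemma₂ : ∀ k w f → (2 * k + 1) * w + (2 * k + 1) * (f * w) ≡ suc f * (1 * w + (k * w + k * w))
  lemma₂ = solve-∀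
expected-free {suc V} K (just b ∷ ρ) = begin
  (2 * K + 1) * ∑ (λ σ → weight K (just b ∷ ρ) σ * free σ)
    ≡⟨ cong ((2 * K + 1) *_) (fixed b (λ { (a ∷ σ) → free (a ∷ σ) })) ⟩
  (2 * K + 1) * ∑ (λ σ → weight K ρ σ * free σ)
    ≡⟨ expected-free K ρ ⟩
  free ρ * ∑ (weight K ρ)
    ≡⟨ cong (free ρ *_) (trans (sym (∑-cong {V} λ σ → *-identityʳ (weight K ρ σ)))
         (trans (sym (fixed b (λ _ → 1))) (∑-cong {suc V} λ σ → *-identityʳ (weight K (just b ∷ ρ) σ)))) ⟩
  free ρ * ∑ (weight K (just b ∷ ρ)) ∎
  where
  open ≡-Reasoning
  lemma : ∀ x → x + 0 ≡ x
  lemma = solve-∀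
  drop₁ : ∀ (g : Restriction V → ℕ) → ∑ (λ σ → 1 * weight K ρ σ * g σ) ≡ ∑ (λ σ → weight K ρ σ * g σ)
  drop₁ g = ∑-cong λ σ → cong (_* g σ) (*-identityˡ (weight K ρ σ))
  fixed : ∀ b (g : Restriction (suc V) → ℕ) →
          ∑ (λ σ → weight K (just b ∷ ρ) σ * g σ) ≡ ∑ (λ σ → weight K ρ σ * g (just b ∷ σ))
  fixed true  g rewrite ∑-zero {V} {λ σ → 0} (λ _ → refl) = drop₁ (g ∘ (just true ∷_))
  fixed false g rewrite ∑-zero {V} {λ σ → 0} (λ _ → refl) = trans (lemma _) (drop₁ (g ∘ (just false ∷_)))

search : ∀ {V} {P : Restriction V → Set} → (∀ σ → Dec (P σ)) → ∃ P ⊎ (∀ σ → ¬ P σ)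
search {zero} P? with P? []
... | yes p = inj₁ ([] , p)
... | no ¬p = inj₂ λ { [] → ¬p }
search {suc V} {P} P? with search (P? ∘ (nothing ∷_)) | search (P? ∘ (just false ∷_)) | search (P? ∘ (just true ∷_))
... | inj₁ (σ , p) | _ | _ = inj₁ (_ , p)
... | inj₂ _ | inj₁ (σ , p) | _ = inj₁ (_ , p)
... | inj₂ _ | inj₂ _ | inj₁ (σ , p) = inj₁ (_ , p)
... | inj₂ ¬p | inj₂ ¬q | inj₂ ¬r = inj₂ none
  where
  none : ∀ σ → ¬ P σ
  none (nothing    ∷ σ) = ¬p σ
  none (just false ∷ σ) = ¬q σ
  none (just true  ∷ σ) = ¬r σ

-- Otherwise `g` exceeds `f` by at least 1 wherever the weight is positive, and the sums differ by
-- at least `∑ w`.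
averaging : ∀ {V} (w f g : Restriction V → ℕ) → 0 < ∑ w →
            ∑ (λ σ → w σ * g σ) ≤ ∑ (λ σ → w σ * f σ) → ∃ λ σ → 0 < w σ × g σ ≤ f σ
averaging {V} w f g 0<W g≤f with search (λ σ → (0 <? w σ) ×-dec (g σ ≤? f σ))
... | inj₁ found = found
... | inj₂ none  = contradiction g≤f (<⇒≱ (begin-strict
    ∑ (λ σ → w σ * f σ)            <⟨ m<m+n _ 0<W ⟩
    ∑ (λ σ → w σ * f σ) + ∑ w      ≡⟨ ∑-+ {V} (λ σ → w σ * f σ) w ⟨
    ∑ (λ σ → w σ * f σ + w σ)      ≤⟨ ∑-mono pointwise ⟩
    ∑ (λ σ → w σ * g σ)            ∎))
  where
  open ≤-Reasoning
  lemma : ∀ a b → a * b + a ≡ a * suc b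
  lemma = solve-∀
  pointwise : ∀ σ → w σ * f σ + w σ ≤ w σ * g σ
  pointwise σ with w σ in eq
  ... | zero  = z≤n
  ... | suc n = ≤-trans (≤-reflexive (lemma (suc n) (f σ)))
                  (*-monoʳ-≤ (suc n) (≰⇒> λ gf → none σ (subst (0 <_) (sym eq) z<s , gf)))

-- Twice the inverse of the survival probability: one half of the expected free variables is what
-- remains, the other half pays for bad restrictions.
rate : ℕ → ℕ
rate K = 2 * (2 * K + 1)

good-restriction : ∀ {V} K t m (ρ : Restriction V) (bad : Restriction V → ℕ) → 0 < free ρ →
  rate K * m ≤ 2 ^ t → 2 ^ t * ∑ (λ σ → weight K ρ σ * bad σ) ≤ m * ∑ (weight K ρ) →
  ∃ λ σ → ρ ⊑ σ × bad σ ≡ 0 × free ρ ≤ rate K * free σ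
good-restriction {V} K t m ρ bad 0<a rm≤ bound with averaging (weight K ρ) f g (∑-weight K ρ) g≤f
  where
  open ≤-Reasoning
  W a N : ℕ
  W = ∑ (weight K ρ)
  a = free ρ
  N = ∑ (λ σ → weight K ρ σ * bad σ)
  f g : Restriction V → ℕ
  -- Both goals are put into one comparison. Since `free σ ≤ a` and `0 < a`, one bad path lifts
  -- `g σ` above every possible `f σ`; so `g σ ≤ f σ` forces `bad σ ≡ 0` and leaves
  -- `a ≤ rate K * free σ`.
  f σ = rate K * free σ
  g σ = a + rate K * (a * bad σ)
  lemma₁ : ∀ w a r b → w * (a + r * (a * b)) ≡ a * w + r * a * (w * b)
  lemma₁ = solve-∀
  lemma₂ : ∀ p r a n → p * (r * a * n) ≡ r * a * (p * n)
  lemma₂ = solve-∀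
  lemma₃ : ∀ r a m w → r * a * (m * w) ≡ r * m * (a * w)
  lemma₃ = solve-∀
  lemma₄ : ∀ a w → a * w + a * w ≡ 2 * (a * w)
  lemma₄ = solve-∀
  lemma₅ : ∀ k w f → w * (2 * (2 * k + 1) * f) ≡ 2 * (2 * k + 1) * (w * f)
  lemma₅ = solve-∀
  few : rate K * a * N ≤ a * W
  few = *-cancelˡ-≤ (2 ^ t) {{m^n≢0 2 t}} (begin
    2 ^ t * (rate K * a * N)   ≡⟨ lemma₂ (2 ^ t) (rate K) a N ⟩
    rate K * a * (2 ^ t * N)   ≤⟨ *-monoʳ-≤ (rate K * a) bound ⟩
    rate K * a * (m * W)       ≡⟨ lemma₃ (rate K) a m W ⟩
    rate K * m * (a * W)       ≤⟨ *-monoˡ-≤ (a * W) rm≤ ⟩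
    2 ^ t * (a * W)            ∎)
  g≤f : ∑ (λ σ → weight K ρ σ * g σ) ≤ ∑ (λ σ → weight K ρ σ * f σ)
  g≤f = begin
    ∑ (λ σ → weight K ρ σ * g σ)
      ≡⟨ ∑-cong (λ σ → lemma₁ (weight K ρ σ) a (rate K) (bad σ)) ⟩
    ∑ (λ σ → a * weight K ρ σ + rate K * a * (weight K ρ σ * bad σ))
      ≡⟨ ∑-+ {V} _ _ ⟩
    ∑ (λ σ → a * weight K ρ σ) + ∑ (λ σ → rate K * a * (weight K ρ σ * bad σ))
      ≡⟨ cong₂ _+_ (∑-* {V} a _) (∑-* {V} (rate K * a) _) ⟩
    a * W + rate K * a * N
      ≤⟨ +-monoʳ-≤ (a * W) few ⟩
    a * W + a * W
      ≡⟨ lemma₄ a W ⟩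
    2 * (a * W)
      ≡⟨ cong (2 *_) (expected-free K ρ) ⟨
    2 * ((2 * K + 1) * ∑ (λ σ → weight K ρ σ * free σ))
      ≡⟨ *-assoc 2 (2 * K + 1) _ ⟨
    rate K * ∑ (λ σ → weight K ρ σ * free σ)
      ≡⟨ ∑-* {V} (rate K) _ ⟨
    ∑ (λ σ → rate K * (weight K ρ σ * free σ))
      ≡⟨ ∑-cong (λ σ → sym (lemma₅ K (weight K ρ σ) (free σ))) ⟩
    ∑ (λ σ → weight K ρ σ * f σ) ∎
... | σ , 0<w , le = σ , ρ⊑σ , none (bad σ) le , ≤-trans (m≤m+n (free ρ) _) le
  where
  ρ⊑σ = weight-⊑ K ρ σ 0<w
  none : ∀ b → free ρ + rate K * (free ρ * b) ≤ rate K * free σ → b ≡ 0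
  none zero    _ = refl
  none (suc b) l = contradiction
    (≤-trans (s≤s (≤-trans (*-monoʳ-≤ (rate K) (≤-trans (free-⊑ ρ⊑σ) (m≤m*n (free ρ) (suc b)))) ≤-refl))
       (+-monoˡ-≤ _ 0<a))
    (≤⇒≯ l)

-- DNFs from certificates, and switching of circuits layer by layer

_⊨?_ : ∀ {V} (x : Vec Bool V) ρ → Dec (x ⊨ ρ)
[] ⊨? [] = yes (mk⊨ λ ())
(b ∷ x) ⊨? (a ∷ ρ) with x ⊨? ρ | a
... | no ¬p | _       = no λ p → ¬p (mk⊨ (value p ∘ suc))
... | yes p | nothing = yes (mk⊨ λ { zero _ () ; (suc v) → value p v })
... | yes p | just c with b Bool.≟ c
...   | yes refl = yes (mk⊨ λ { zero _ → just-injective ; (suc v) → value p v })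
...   | no b≢c   = no λ p → b≢c (value p zero c refl)

assignments : ∀ V → List (Vec Bool V)
assignments zero    = [] ∷ []
assignments (suc V) = List.map (false ∷_) (assignments V) List.++ List.map (true ∷_) (assignments V)

∈-assignments : ∀ {V} (x : Vec Bool V) → x ∈ assignments V
∈-assignments []          = here refl
∈-assignments (false ∷ x) = ∈-++⁺ˡ (∈-map⁺ (false ∷_) (∈-assignments x))
∈-assignments (true ∷ x)  = ∈-++⁺ʳ (List.map (false ∷_) (assignments _)) (∈-map⁺ (true ∷_) (∈-assignments x))

module _ {V : ℕ} where

  Slim : ℕ → Cube V → Set
  Slim t C = Distinct C × length C ≤ t

  termAt : Vec Bool V → List (Fin V) → Cube V
  termAt x M = List.map (λ v → v , lookup x v) (List.deduplicate Fin._≟_ M)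

  termAt-slim : ∀ {t} x M → length M ≤ t → Slim t (termAt x M)
  termAt-slim {t} x M M≤t =
    subst Unique′ (sym (trans (sym (List.map-∘ D)) (List.map-id D))) (Unique.deduplicate-! Fin._≟_ M) ,
    ≤-trans (≤-reflexive (List.length-map _ D)) (≤-trans (List.length-deduplicate Fin._≟_ M) M≤t)
    where
    Unique′ = Unique {A = Fin V}
    D = List.deduplicate Fin._≟_ M

  termAt⇒agree : ∀ x M y → Satisfies y (termAt x M) → Agree M x y
  termAt⇒agree x M y sat =
    All.deduplicate⁻ Fin._≟_ (λ { refl p → p }) M (All.map⁻ sat)

  termAt-self : ∀ x M → Satisfies x (termAt x M)
  termAt-self x M = All.map⁺ (All.universal (λ _ → refl) (List.deduplicate Fin._≟_ M))

  -- The minterms of the certificates of 1-inputs form a DNF.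
  cert⇒dnf : ∀ {t ρ f} → Cert t ρ f → ∃ λ F → All (Slim t) F × Computes F ρ f
  cert⇒dnf {t} {ρ} {f} cert =
    let F , slim , sound , complete = go (assignments V)
    in F , slim , λ x x⊨ρ → mk⇔ (sound x x⊨ρ) (complete x (∈-assignments x) x⊨ρ)
    where
    go : ∀ xs → ∃ λ F → All (Slim t) F ×
         (∀ x → x ⊨ ρ → Any (Satisfies x) F → f x ≡ true) ×
         (∀ x → x ∈ xs → x ⊨ ρ → f x ≡ true → Any (Satisfies x) F)
    go [] = [] , [] , (λ _ _ ()) , λ _ ()
    go (x ∷ xs) with go xs | x ⊨? ρ | f x in eq
    ... | F , slim , sound , complete | no x⊭ρ | _ = F , slim , sound ,
      λ { y (here refl) y⊨ρ → contradiction y⊨ρ x⊭ρ ; y (there y∈) → complete y y∈ }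
    ... | F , slim , sound , complete | yes _ | false = F , slim , sound ,
      λ { y (here refl) y⊨ρ fy → contradiction (trans (sym eq) fy) (λ ()) ; y (there y∈) → complete y y∈ }
    ... | F , slim , sound , complete | yes x⊨ρ | true =
      let M , M≤t , ok = cert x x⊨ρ in
      termAt x M ∷ F , termAt-slim x M M≤t ∷ slim ,
      (λ { y y⊨ρ (here sat) → trans (ok y y⊨ρ (termAt⇒agree x M y sat)) eq
         ; y y⊨ρ (there any) → sound y y⊨ρ any }) ,
      (λ { y (here refl) _ _ → here (termAt-self x M)
         ; y (there y∈) y⊨ρ fy → there (complete y y∈ y⊨ρ fy) })

  -- The DNFs of the operands are concatenated, so the width does not depend on the fan-in. The
  -- clause on `F ≡ []` lets the union bound run over wires: a gate without inputs adds nothing to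
  -- the size, so it must not add to the bad events either.
  or-dnf : ∀ {t ρ m} (p : Subset m) (f : Fin m → Vec Bool V → Bool) → (∀ i → Cert t ρ (f i)) →
           ∃ λ F → All (Slim t) F × (F ≡ [] ⊎ 1 ≤ ∣ p ∣) ×
             Computes F ρ (λ x → evalGate (tabulate λ i → f i x) (⋁ p))
  or-dnf []          f cert = [] , [] , inj₁ refl , λ _ _ → mk⇔ (λ ()) (λ ())
  or-dnf (false ∷ p) f cert = or-dnf p (f ∘ suc) (cert ∘ suc)
  or-dnf (true ∷ p)  f cert =
    let F , slimF , computesF = cert⇒dnf (cert zero)
        G , slimG , _ , computesG = or-dnf p (f ∘ suc) (cert ∘ suc)
    in F List.++ G , All.++⁺ slimF slimG , inj₂ (s≤s z≤n) , λ x x⊨ρ → mk⇔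
         (λ any → join (f zero x) (split x F any
                    (Equivalence.to (computesF x x⊨ρ)) (Equivalence.to (computesG x x⊨ρ))))
         (λ eq → unsplit (f zero x) x F eq (Equivalence.from (computesF x x⊨ρ)) (Equivalence.from (computesG x x⊨ρ)))
    where
    join : ∀ a {b} → a ≡ true ⊎ b ≡ true → a ∨ b ≡ true
    join true  _           = refl
    join false (inj₂ refl) = refl
    split : ∀ x F {G} {A B : Set} → Any (Satisfies x) (F List.++ G) →
            (Any (Satisfies x) F → A) → (Any (Satisfies x) G → B) → A ⊎ B
    split x F any f g with Any.++⁻ F any
    ... | inj₁ p = inj₁ (f p)
    ... | inj₂ q = inj₂ (g q)
    unsplit : ∀ a {b} x F {G} → a ∨ b ≡ true → (a ≡ true → Any (Satisfies x) F) →
              (b ≡ true → Any (Satisfies x) G) → Any (Satisfies x) (F List.++ G)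
    unsplit true  x F _  f g = Any.++⁺ˡ (f refl)
    unsplit false x F eq f g = Any.++⁺ʳ F (g eq)

  cert-cong : ∀ {t ρ} {f g : Vec Bool V → Bool} → (∀ x → f x ≡ g x) → Cert t ρ f → Cert t ρ g
  cert-cong f≡g cert x x⊨ρ =
    let M , M≤t , ok = cert x x⊨ρ
    in M , M≤t , λ y y⊨ρ yM → trans (sym (f≡g y)) (trans (ok y y⊨ρ yM) (f≡g x))

  -- f is simplified by every refinement of ρ that avoids the long paths of a
  -- DNF; the DNF may be nonempty only if m is positive.
  Switchable : ℕ → Restriction V → ℕ → (Vec Bool V → Bool) → Set
  Switchable t ρ m f = ∃ λ F → All (Slim t) F × (F ≡ [] ⊎ 1 ≤ m) ×
                       (∀ σ → ρ ⊑ σ → paths F (suc t) σ ≡ 0 → Cert t σ f)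

  cert-not : ∀ {t ρ} {f : Vec Bool V → Bool} → Cert t ρ f → Cert t ρ (not ∘ f)
  cert-not cert x x⊨ρ =
    let M , M≤t , ok = cert x x⊨ρ
    in M , M≤t , λ y y⊨ρ yM → cong not (ok y y⊨ρ yM)

  ⋀-⋁ : ∀ {m} (p : Subset m) (v : Fin m → Bool) →
        not (evalGate (tabulate (not ∘ v)) (⋁ p)) ≡ evalGate (tabulate v) (⋀ p)
  ⋀-⋁ []          v = refl
  ⋀-⋁ (false ∷ p) v = ⋀-⋁ p (v ∘ suc)
  ⋀-⋁ (true ∷ p)  v = trans (not-∨ (v zero) _) (cong (v zero ∧_) (⋀-⋁ p (v ∘ suc)))
    where
    not-∨ : ∀ a b → not (not a ∨ b) ≡ a ∧ not b
    not-∨ true  b = refl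
    not-∨ false b = refl

  computes-⊑ : ∀ {F : DNF V} {ρ σ f} → ρ ⊑ σ → Computes F ρ f → Computes F σ f
  computes-⊑ ρ⊑σ computes x x⊨σ = computes x (⊨-⊑ ρ⊑σ x⊨σ)

  -- A conjunction is treated as a negated disjunction, because negation preserves certificates. For
  -- the same reason a negation gets the empty DNF.
  gate-switchable : ∀ {t ρ m} (val : Vec Bool V → Vec Bool m) → (∀ i → Cert t ρ (λ x → lookup (val x) i)) →
             (g : Gate m) → Switchable t ρ ∣ fanin g ∣ (λ x → evalGate (val x) g)
  gate-switchable {t} {ρ} val cert (⋁ p) =
    let F , slim , small , computes = or-dnf p (λ i x → lookup (val x) i) cert
    in F , slim , small , λ σ ρ⊑σ p≡0 →
      cert-cong (λ x → cong (λ v → evalGate v (⋁ p)) (tabulate∘lookup (val x)))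
        (paths-cert t (All.map proj₁ slim) (computes-⊑ {F} ρ⊑σ computes) p≡0)
  gate-switchable {t} {ρ} val cert (⋀ p) =
    let F , slim , small , computes = or-dnf p (λ i x → not (lookup (val x) i)) (λ i → cert-not (cert i))
    in F , slim , small , λ σ ρ⊑σ p≡0 →
      cert-cong (λ x → trans (⋀-⋁ p (lookup (val x)))
                         (cong (λ v → evalGate v (⋀ p)) (tabulate∘lookup (val x))))
        (cert-not (paths-cert t (All.map proj₁ slim) (computes-⊑ {F} ρ⊑σ computes) p≡0))
  gate-switchable val cert (~ h) = [] , [] , inj₁ refl , λ σ ρ⊑σ _ → cert-⊑ ρ⊑σ (cert-not (cert h))

  module _ (t : ℕ) where

    K : ℕ
    K = 8 * suc t

    dnf-bound : ∀ ρ F {m} → All (Slim (suc t)) F → F ≡ [] ⊎ 1 ≤ m →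
                2 ^ suc (suc t) * ∑ (λ σ → weight K ρ σ * paths F (suc (suc t)) σ) ≤ m * ∑ (weight K ρ)
    dnf-bound ρ .[] slim (inj₁ refl)
      rewrite ∑-zero {h = λ σ → weight K ρ σ * 0} (λ σ → *-zeroʳ (weight K ρ σ)) | *-zeroʳ (2 ^ suc (suc t)) = z≤n
    dnf-bound ρ F {m} slim (inj₂ 1≤m) = begin
      2 ^ suc (suc t) * ∑ (λ σ → weight K ρ σ * paths F (suc (suc t)) σ)
        ≤⟨ switching F (All.map (λ (d , l) → d , *-monoʳ-≤ 8 l) slim) (suc (suc t)) (weight K ρ) (weight-growing K ρ) ⟩
      ∑ (weight K ρ)     ≡⟨ *-identityˡ _ ⟨
      1 * ∑ (weight K ρ) ≤⟨ *-monoˡ-≤ (∑ (weight K ρ)) 1≤m ⟩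
      m * ∑ (weight K ρ) ∎
      where open ≤-Reasoning

    -- The union bound: `bad` adds the long paths of all gates, so a single restriction on which it
    -- vanishes serves the whole layer.
    layer-bad : ∀ {w} ρ (f : Fin w → Vec Bool V → Bool) (c : Vec ℕ w) →
      (∀ i → Switchable (suc t) ρ (lookup c i) (f i)) → ∃ λ (bad : Restriction V → ℕ) →
      2 ^ suc (suc t) * ∑ (λ σ → weight K ρ σ * bad σ) ≤ Vec.sum c * ∑ (weight K ρ) ×
      (∀ σ → ρ ⊑ σ → bad σ ≡ 0 → ∀ i → Cert (suc t) σ (f i))
    layer-bad ρ f [] switchable = (λ _ → 0) ,
      ≤-reflexive (trans (cong (2 ^ suc (suc t) *_) (∑-zero {V} λ σ → *-zeroʳ (weight K ρ σ))) (*-zeroʳ (2 ^ suc (suc t)))) ,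
      λ _ _ _ ()
    layer-bad ρ f (m ∷ c) switchable =
      let F , slim , small , ok = switchable zero
          bad , bound , oks = layer-bad ρ (f ∘ suc) c (switchable ∘ suc)
          P = λ σ → paths F (suc (suc t)) σ
      in (λ σ → P σ + bad σ) , (begin
        2 ^ suc (suc t) * ∑ (λ σ → weight K ρ σ * (P σ + bad σ))
          ≡⟨ cong (2 ^ suc (suc t) *_) (trans (∑-cong λ σ → *-distribˡ-+ (weight K ρ σ) (P σ) (bad σ)) (∑-+ {V} _ _)) ⟩
        2 ^ suc (suc t) * (∑ (λ σ → weight K ρ σ * P σ) + ∑ (λ σ → weight K ρ σ * bad σ))
          ≡⟨ *-distribˡ-+ (2 ^ suc (suc t)) _ _ ⟩
        2 ^ suc (suc t) * ∑ (λ σ → weight K ρ σ * P σ) + 2 ^ suc (suc t) * ∑ (λ σ → weight K ρ σ * bad σ)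
          ≤⟨ +-mono-≤ (dnf-bound ρ F slim small) bound ⟩
        m * ∑ (weight K ρ) + Vec.sum c * ∑ (weight K ρ)
          ≡⟨ *-distribʳ-+ (∑ (weight K ρ)) m _ ⟨
        (m + Vec.sum c) * ∑ (weight K ρ) ∎) ,
        λ { σ ρ⊑σ b≡0 zero    → ok σ ρ⊑σ (m+n≡0⇒m≡0 (P σ) b≡0)
          ; σ ρ⊑σ b≡0 (suc i) → oks σ ρ⊑σ (m+n≡0⇒n≡0 (P σ) b≡0) i }
      where open ≤-Reasoning

    layer-cert : ∀ {w} ρ (f : Fin w → Vec Bool V → Bool) (c : Vec ℕ w) →
      (∀ i → Switchable (suc t) ρ (lookup c i) (f i)) → 0 < free ρ →
      rate K * Vec.sum c ≤ 2 ^ suc (suc t) →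
      ∃ λ σ → ρ ⊑ σ × free ρ ≤ rate K * free σ × (∀ i → Cert (suc t) σ (f i))
    layer-cert ρ f c switchable 0<ρ small =
      let bad , bound , ok = layer-bad ρ f c switchable
          σ , ρ⊑σ , b≡0 , shrink = good-restriction K (suc (suc t)) (Vec.sum c) ρ bad 0<ρ small bound
      in σ , ρ⊑σ , shrink , ok σ ρ⊑σ b≡0

    free-pos : ∀ {a b} c → 0 < a → a ≤ c * b → 0 < b
    free-pos {b = suc _} c 0<a a≤ = z<s
    free-pos {b = zero}  c 0<a a≤ = contradiction (≤-trans 0<a (≤-trans a≤ (≤-reflexive (*-zeroʳ c)))) (λ ())

    -- Each layer refines the restriction of the one below and loses a factor `rate K`. Its gates
    -- come back to certificates of size `suc t`, and the earlier nodes keep theirs under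
    -- refinement, so a gate may read any earlier level.
    levels-cert : ∀ {i m d} ρ (C : Levels i m d) (inp : Vec Bool V → Vec Bool i) →
      (∀ j → Cert (suc t) ρ (λ x → lookup (inp x) j)) → 0 < free ρ →
      rate K * wires C ≤ 2 ^ suc (suc t) →
      ∃ λ σ → ρ ⊑ σ × free ρ ≤ rate K ^ d * free σ ×
        (∀ j → Cert (suc t) σ (λ x → lookup (evalLevels C (inp x)) j))
    levels-cert ρ inputs inp cert 0<ρ _ = ρ , ⊑-refl , ≤-reflexive (sym (*-identityˡ _)) , cert
    levels-cert {d = suc d} ρ (_▷_ {m = m} C gs) inp cert 0<ρ small =
      let W = Vec.sum (Vec.map (∣_∣ ∘ fanin) gs)
          σ , ρ⊑σ , shrink , certσ = levels-cert ρ C inp cert 0<ρ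
            (≤-trans (*-monoʳ-≤ (rate K) (m≤m+n (wires C) W)) small)
          τ , σ⊑τ , shrink′ , new = layer-cert σ (λ i x → evalGate (evalLevels C (inp x)) (lookup gs i))
            (Vec.map (∣_∣ ∘ fanin) gs)
            (λ i → subst (λ m → Switchable (suc t) σ m (λ x → evalGate (evalLevels C (inp x)) (lookup gs i)))
                     (sym (lookup-map i (∣_∣ ∘ fanin) gs))
                     (gate-switchable (λ x → evalLevels C (inp x)) certσ (lookup gs i)))
            (free-pos (rate K ^ d) 0<ρ shrink)
            (≤-trans (*-monoʳ-≤ (rate K) (m≤n+m W (wires C))) small)
      in τ , ⊑-trans ρ⊑σ σ⊑τ , (begin
           free ρ                            ≤⟨ shrink ⟩
           rate K ^ d * free σ               ≤⟨ *-monoʳ-≤ (rate K ^ d) shrink′ ⟩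
           rate K ^ d * (rate K * free τ)    ≡⟨ lemma (rate K) (rate K ^ d) (free τ) ⟩
           rate K * rate K ^ d * free τ      ∎) ,
         node τ σ⊑τ certσ new
      where
      open ≤-Reasoning
      lemma : ∀ r p f → p * (r * f) ≡ r * p * f
      lemma = solve-∀
      node : ∀ {σ} τ → σ ⊑ τ → (∀ j → Cert (suc t) σ (λ x → lookup (evalLevels C (inp x)) j)) →
             (∀ i → Cert (suc t) τ (λ x → evalGate (evalLevels C (inp x)) (lookup gs i))) →
             ∀ j → Cert (suc t) τ (λ x → lookup (evalLevels C (inp x) ++ Vec.map (evalGate (evalLevels C (inp x))) gs) j)
      node τ σ⊑τ old new j with splitAt m j in eq
      ... | inj₁ i with refl ← Fin.splitAt⁻¹-↑ˡ eq =
        cert-cong (λ x → sym (lookup-++ˡ (evalLevels C (inp x)) _ i)) (cert-⊑ σ⊑τ (old i))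
      ... | inj₂ i with refl ← Fin.splitAt⁻¹-↑ʳ {m} eq =
        cert-cong (λ x → sym (trans (lookup-++ʳ (evalLevels C (inp x)) _ i) (lookup-map i _ gs))) (new i)

-- Reading and writing memory

≡ᵇ-refl : ∀ n → (n ≡ᵇ n) ≡ true
≡ᵇ-refl zero    = refl
≡ᵇ-refl (suc n) = ≡ᵇ-refl n

≢⇒≡ᵇ : ∀ {m n} → m ≢ n → (m ≡ᵇ n) ≡ false
≢⇒≡ᵇ {zero}  {zero}  m≢n = contradiction refl m≢n
≢⇒≡ᵇ {zero}  {suc n} m≢n = refl
≢⇒≡ᵇ {suc m} {zero}  m≢n = refl
≢⇒≡ᵇ {suc m} {suc n} m≢n = ≢⇒≡ᵇ (m≢n ∘ cong suc)

module _ {A : Set} where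

  write-below : ∀ {n} (M : ℕ → A) a (xs : Vec A n) q → q < a → write M a xs q ≡ M q
  write-below M a []       q q<a = refl
  write-below M a (x ∷ xs) q q<a rewrite ≢⇒≡ᵇ (<⇒≢ q<a) = write-below M (suc a) xs q (m<n⇒m<1+n q<a)

  write-above : ∀ {n} (M : ℕ → A) a (xs : Vec A n) q → a + n ≤ q → write M a xs q ≡ M q
  write-above M a []       q a≤q = refl
  write-above {suc n} M a (x ∷ xs) q a+n≤q
    rewrite ≢⇒≡ᵇ (>⇒≢ (≤-trans (s≤s (m≤m+n a n)) (≤-trans (≤-reflexive (sym (+-suc a n))) a+n≤q))) =
    write-above M (suc a) xs q (≤-trans (≤-reflexive (sym (+-suc a n))) a+n≤q)

  write-at : ∀ {n} (M : ℕ → A) a (xs : Vec A n) i → write M a xs (a + toℕ i) ≡ lookup xs i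
  write-at M a (x ∷ xs) zero    rewrite +-identityʳ a | ≡ᵇ-refl a = refl
  write-at M a (x ∷ xs) (suc i)
    rewrite +-suc a (toℕ i) | ≢⇒≡ᵇ (>⇒≢ (s≤s (m≤m+n a (toℕ i)))) = write-at M (suc a) xs i

  -- The alternative is chosen before M and xs, so it is common to all the inputs
  -- of a simulated run.
  write-source : ∀ a n q → (∀ (M : ℕ → A) (xs : Vec A n) → write M a xs q ≡ M q) ⊎
                 (∃ λ i → q ≡ a + toℕ i × (∀ (M : ℕ → A) (xs : Vec A n) → write M a xs q ≡ lookup xs i))
  write-source a n q with q <? a
  ... | yes q<a = inj₁ λ M xs → write-below M a xs q q<a
  ... | no q≮a with q ∸ a <? n
  ...   | no q≮n  = inj₁ λ M xs → write-above M a xs q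
                      (≤-trans (+-monoʳ-≤ a (≮⇒≥ q≮n)) (≤-reflexive (m+[n∸m]≡n (≮⇒≥ q≮a))))
  ...   | yes q<n = inj₂ (i , eq , λ M xs → trans (cong (write M a xs) eq) (write-at M a xs i))
    where
    i  = fromℕ< q<n
    eq : q ≡ a + toℕ i
    eq = sym (trans (cong (a +_) (Fin.toℕ-fromℕ< q<n)) (m+[n∸m]≡n (≮⇒≥ q≮a)))

  lookup-group : ∀ n k (xs : Vec A (n * k)) i j →
                 lookup (lookup (proj₁ (group n k xs)) i) j ≡ lookup xs (combine i j)
  lookup-group n k xs i j with group n k xs
  ... | xss , refl = sym (lookup-concat xss i j)

  lookup-ext : ∀ {n} {xs ys : Vec A n} → (∀ i → lookup xs i ≡ lookup ys i) → xs ≡ ys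
  lookup-ext {xs = xs} {ys} eq =
    trans (sym (tabulate∘lookup xs)) (trans (tabulate-cong eq) (tabulate∘lookup ys))

  update-cong : ∀ {f g : ℕ → A} a {w w′} → (∀ r → f r ≡ g r) → w ≡ w′ → ∀ r → (f [ a ≔ w ]) r ≡ (g [ a ≔ w′ ]) r
  update-cong a f≡g w≡w′ r with r ≡ᵇ a
  ... | true  = w≡w′
  ... | false = f≡g r

-- Runs from states with pointwise equal registers

infix 4 _≈_

-- The initial registers for two inputs agree at every index, but without function extensionality
-- they are not equal as functions.
record _≈_ {B} (σ τ : State B) : Set where
  constructor mk≈
  field
    pc-≡  : pc σ ≡ pc τ
    reg-≡ : ∀ r → reg σ r ≡ reg τ r
    mem-≡ : mem σ ≡ mem τ

open _≈_

module _ {B : ℕ} {σ τ : State B} (σ≈τ : σ ≈ τ) where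

  nat-≈ : ∀ r → nat σ r ≡ nat τ r
  nat-≈ r = cong ℤ.∣_∣ (reg-≡ σ≈τ r)

  setReg-≈ : ∀ d {y z} → y ≡ z → setReg σ d y ≈ setReg τ d z
  setReg-≈ d y≡z = mk≈ (cong suc (pc-≡ σ≈τ)) (update-cong d (reg-≡ σ≈τ) y≡z) (mem-≡ σ≈τ)

  setMem-≈ : ∀ {M N} → M ≡ N → setMem σ M ≈ setMem τ N
  setMem-≈ M≡N = mk≈ (cong suc (pc-≡ σ≈τ)) (reg-≡ σ≈τ) M≡N

  exec-≈ : ∀ {ops} s (c : Instr ops) → exec s c σ ≈ exec s c τ
  exec-≈ s (const d z) = setReg-≈ d refl
  exec-≈ s (scalar f d a b) = setReg-≈ d (cong₂ (alu B f) (reg-≡ σ≈τ a) (reg-≡ σ≈τ b))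
  exec-≈ s (load d a) = setReg-≈ d (cong ⟦_⟧ (cong₂ (λ M → M) (mem-≡ σ≈τ) (nat-≈ a)))
  exec-≈ s (store a b) rewrite nat-≈ a | reg-≡ σ≈τ b | mem-≡ σ≈τ = setMem-≈ refl
  exec-≈ s (jump a target) =
    mk≈ (cong₂ (λ z i → if does (z ℤ.≟ 0ℤ) then suc i else target) (reg-≡ σ≈τ a) (pc-≡ σ≈τ))
        (reg-≡ σ≈τ) (mem-≡ σ≈τ)
  exec-≈ s (vand d a b n) rewrite nat-≈ d | nat-≈ a | nat-≈ b | nat-≈ n | mem-≡ σ≈τ = setMem-≈ refl
  exec-≈ s (vor d a b n) rewrite nat-≈ d | nat-≈ a | nat-≈ b | nat-≈ n | mem-≡ σ≈τ = setMem-≈ refl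
  exec-≈ s (vnot d a n) rewrite nat-≈ d | nat-≈ a | nat-≈ n | mem-≡ σ≈τ = setMem-≈ refl
  exec-≈ {ops} s (vector f d as n) rewrite nat-≈ d | nat-≈ n | mem-≡ σ≈τ
    = setMem-≈ (cong (λ v → write (mem τ) (nat τ d) (VectorOp.apply (List.lookup ops f) s (nat τ n) v))
        (Vec.map-cong (λ a → cong (λ q → read (mem τ) q (nat τ n)) (nat-≈ a)) as))
  exec-≈ s (matmul d a b n) rewrite nat-≈ d | nat-≈ a | nat-≈ b | nat-≈ n | mem-≡ σ≈τ = setMem-≈ refl

  cost-≈ : ∀ {ops} κ s (c : Instr ops) → cost κ s c σ ≡ cost κ s c τ
  cost-≈ κ s (const _ _)      = refl
  cost-≈ κ s (scalar _ _ _ _) = refl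
  cost-≈ κ s (load _ _)       = refl
  cost-≈ κ s (store _ _)      = refl
  cost-≈ κ s (jump _ _)       = refl
  cost-≈ κ s (vand _ _ _ n)   rewrite nat-≈ n = refl
  cost-≈ κ s (vor _ _ _ n)    rewrite nat-≈ n = refl
  cost-≈ κ s (vnot _ _ n)     rewrite nat-≈ n = refl
  cost-≈ κ s (vector f _ _ n) rewrite nat-≈ n = refl
  cost-≈ κ s (matmul _ _ _ n) rewrite nat-≈ n = refl

run-≈ : ∀ {ops B κ s} {p : List (Instr ops)} {σ τ : State B} {t w σ′} → σ ≈ τ →
        Run κ s p σ t w σ′ → ∃ λ τ′ → Run κ s p τ t w τ′ × σ′ ≈ τ′
run-≈ {B = B} {κ} {s} {p} σ≈τ (halt eq) = _ , halt (trans (cong (fetch {B = B} κ s p) (sym (pc-≡ σ≈τ))) eq) , σ≈τ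
run-≈ {B = B} {κ = κ} {s} {p} {τ = τ} σ≈τ (step {c} {t} {w} eq run) with run-≈ (exec-≈ σ≈τ s c) run
... | τ′ , run′ , σ′≈τ′ =
  τ′ , subst (λ k → Run κ s p τ (suc t) (k + w) τ′) (sym (cost-≈ σ≈τ κ s c))
         (step (trans (cong (fetch {B = B} κ s p) (sym (pc-≡ σ≈τ))) eq) run′) , σ′≈τ′

-- Certificates for memory words

module _ {V : ℕ} where

  assign : Restriction V → Vec Bool V → List (Fin V) → Restriction V
  assign ρ x = List.foldr (λ v σ → σ [ v ]≔ just (lookup x v)) ρ

  free-≔ : ∀ {V} (ρ : Restriction V) v b → free ρ ≤ suc (free (ρ [ v ]≔ just b))
  free-≔ (nothing ∷ ρ) zero    b = ≤-refl
  free-≔ (just _  ∷ ρ) zero    b = n≤1+n _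
  free-≔ (nothing ∷ ρ) (suc v) b = s≤s (free-≔ ρ v b)
  free-≔ (just _  ∷ ρ) (suc v) b = free-≔ ρ v b

  free-assign : ∀ ρ x M → free ρ ≤ free (assign ρ x M) + length M
  free-assign ρ x []      = ≤-reflexive (sym (+-identityʳ _))
  free-assign ρ x (v ∷ M) = begin
    free ρ                                       ≤⟨ free-assign ρ x M ⟩
    free (assign ρ x M) + length M               ≤⟨ +-monoˡ-≤ (length M) (free-≔ (assign ρ x M) v (lookup x v)) ⟩
    suc (free (assign ρ x (v ∷ M))) + length M   ≡⟨ +-suc _ _ ⟨
    free (assign ρ x (v ∷ M)) + suc (length M)   ∎
    where open ≤-Reasoning

  ⊑-≔ : ∀ {ρ σ : Restriction V} {x} v → x ⊨ ρ → ρ ⊑ σ → ρ ⊑ σ [ v ]≔ just (lookup x v)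
  ⊑-≔ {ρ} {σ} {x} v x⊨ρ ρ⊑σ = mk⊑ go
    where
    go : ∀ u b → lookup ρ u ≡ just b → lookup (σ [ v ]≔ just (lookup x v)) u ≡ just b
    go u b eq with u Fin.≟ v
    ... | yes refl = trans (lookup∘update v σ (just (lookup x v))) (cong just (value x⊨ρ v b eq))
    ... | no u≢v   = trans (lookup∘update′ u≢v σ (just (lookup x v))) (fixes ρ⊑σ u b eq)

  ⊑-assign : ∀ {ρ} {x} M → x ⊨ ρ → ρ ⊑ assign ρ x M
  ⊑-assign []      x⊨ρ = ⊑-refl
  ⊑-assign (v ∷ M) x⊨ρ = ⊑-≔ v x⊨ρ (⊑-assign M x⊨ρ)

  assign-fixes : ∀ (ρ : Restriction V) x M → All (λ v → lookup (assign ρ x M) v ≡ just (lookup x v)) M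
  assign-fixes ρ x []      = []
  assign-fixes ρ x (v ∷ M) =
    lookup∘update v (assign ρ x M) (just (lookup x v)) ∷ All.map keep (assign-fixes ρ x M)
    where
    keep : ∀ {u} → lookup (assign ρ x M) u ≡ just (lookup x u) →
           lookup (assign ρ x (v ∷ M)) u ≡ just (lookup x u)
    keep {u} eq with u Fin.≟ v
    ... | yes refl = lookup∘update v (assign ρ x M) (just (lookup x v))
    ... | no u≢v   = trans (lookup∘update′ u≢v (assign ρ x M) (just (lookup x v))) eq

  assign-agree : ∀ ρ x M {y} → y ⊨ assign ρ x M → Agree M x y
  assign-agree ρ x M y⊨ = All.map (λ {v} → value y⊨ v _) (assign-fixes ρ x M)

  fill : Restriction V → Vec Bool V
  fill = Vec.map (fromMaybe false)

  fill-⊨ : ∀ ρ → fill ρ ⊨ ρ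
  fill-⊨ ρ = mk⊨ λ v b eq → trans (lookup-map v (fromMaybe false) ρ) (cong (fromMaybe false) eq)

  WordCert : ∀ {B} → ℕ → Restriction V → (Vec Bool V → Word B) → Set
  WordCert t ρ W = ∀ b → Cert t ρ (λ x → lookup (W x) b)

  cert-const : ∀ {t} {ρ : Restriction V} b → Cert t ρ (λ _ → b)
  cert-const b x _ = [] , z≤n , λ _ _ _ → refl

  wordCert-cong : ∀ {B t ρ} {W W′ : Vec Bool V → Word B} → (∀ x → W x ≡ W′ x) → WordCert t ρ W → WordCert t ρ W′
  wordCert-cong W≡W′ cert b = cert-cong (λ x → cong (λ w → lookup w b) (W≡W′ x)) (cert b)

  write-cert : ∀ {B t ρ n} (M : Vec Bool V → Memory B) a (out : Vec Bool V → Vec (Word B) n) →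
    (∀ q → WordCert t ρ (λ x → M x q)) → (∀ i → WordCert t ρ (λ x → lookup (out x) i)) →
    ∀ q → WordCert t ρ (λ x → write (M x) a (out x) q)
  write-cert {n = n} M a out certM cert q with write-source a n q
  ... | inj₁ old           = wordCert-cong (λ x → sym (old (M x) (out x))) (certM q)
  ... | inj₂ (i , _ , new) = wordCert-cong (λ x → sym (new (M x) (out x))) (cert i)

  gather : ∀ {k} → (Fin k → List (Fin V)) → List (Fin V)
  gather {zero}  f = []
  gather {suc k} f = f zero List.++ gather (f ∘ suc)
  gather-length : ∀ {k t} f → (∀ i → length (f i) ≤ t) → length (gather {k} f) ≤ k * t
  gather-length {zero}  f f≤t = z≤n
  gather-length {suc k} f f≤t = ≤-trans (≤-reflexive (List.length-++ (f zero)))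
    (+-mono-≤ (f≤t zero) (gather-length (f ∘ suc) (f≤t ∘ suc)))
  gather-part : ∀ {k} {P : Fin V → Set} f → All P (gather {k} f) → ∀ i → All P (f i)
  gather-part f all zero    = All.++⁻ˡ (f zero) all
  gather-part f all (suc i) = gather-part (f ∘ suc) (All.++⁻ʳ (f zero) all) i

  -- Fixing the certificates of its bits makes a word constant.
  freeze : ∀ {B t ρ} (W : Vec Bool V → Word B) → WordCert t ρ W →
           ∃ λ σ → ρ ⊑ σ × free ρ ≤ free σ + B * t × ∃ λ w → ∀ y → y ⊨ σ → W y ≡ w
  freeze {B} {t} {ρ} W cert =
    assign ρ x M , ⊑-assign M x⊨ρ ,
    ≤-trans (free-assign ρ x M) (+-monoʳ-≤ (free (assign ρ x M)) M≤) ,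
    W x , λ y y⊨ → lookup-ext λ b →
      proj₂ (proj₂ (cert b x x⊨ρ)) y (⊨-⊑ (⊑-assign M x⊨ρ) y⊨) (part b {y} (assign-agree ρ x M y⊨))
    where
    x = fill ρ
    x⊨ρ = fill-⊨ ρ
    certs : Fin B → List (Fin V)
    certs b = proj₁ (cert b x x⊨ρ)
    M = gather certs
    M≤ : length M ≤ B * t
    M≤ = gather-length certs (λ b → proj₁ (proj₂ (cert b x x⊨ρ)))
    part : ∀ b {y} → Agree M x y → Agree (certs b) x y
    part b agree = gather-part certs agree b

  apply-bit : ∀ {B} (f : VectorOp) s n (xs : Vec (Vec (Word B) n) (VectorOp.arity f)) i b →
    let C = VectorOp.circuit f n B s in
    lookup (lookup (VectorOp.apply f s n xs) i) b ≡
    lookup (evalLevels (Circuit.levels C) (concat (Vec.map concat xs))) (lookup (Circuit.outputs C) (combine i b))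
  apply-bit {B} f s n xs i b = trans
    (lookup-group n B _ i b) (lookup-map (combine i b) (lookup (evalLevels (Circuit.levels (VectorOp.circuit f n B s)) (concat (Vec.map concat xs)))) (Circuit.outputs (VectorOp.circuit f n B s)))

  concat-cert : ∀ {B t ρ m n} (as : Vec ℕ m) {M : Vec Bool V → Memory B} →
    (∀ q → WordCert t ρ (λ x → M x q)) → ∀ j →
    Cert t ρ (λ x → lookup (concat (Vec.map concat (Vec.map (λ a → read (M x) a n) as))) j)
  concat-cert {B} {t} {ρ} {m} {n} as {M} cert j
    with i , k ← remQuot {m} (n * B) j in eq
    with q , b ← remQuot {n} B k in eq′ = cert-cong (λ x → sym (bit x)) (cert (lookup as i + toℕ q) b)
    where
    open ≡-Reasoning
    j≡ : j ≡ combine i (combine q b)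
    j≡ = trans (sym (Fin.combine-remQuot {m} (n * B) j))
      (trans (cong (λ p → combine (proj₁ p) (proj₂ p)) eq)
        (cong (combine i) (trans (sym (Fin.combine-remQuot {n} B k)) (cong (λ p → combine (proj₁ p) (proj₂ p)) eq′))))
    bit : ∀ x → lookup (concat (Vec.map concat (Vec.map (λ a → read (M x) a n) as))) j ≡
                lookup (M x (lookup as i + toℕ q)) b
    bit x = begin
      lookup (concat (Vec.map concat R)) j
        ≡⟨ cong (lookup (concat (Vec.map concat R))) j≡ ⟩
      lookup (concat (Vec.map concat R)) (combine i (combine q b))
        ≡⟨ lookup-concat (Vec.map concat R) i (combine q b) ⟩
      lookup (lookup (Vec.map concat R) i) (combine q b)
        ≡⟨ cong (λ v → lookup v (combine q b)) (lookup-map i concat R) ⟩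
      lookup (concat (lookup R i)) (combine q b)
        ≡⟨ lookup-concat (lookup R i) q b ⟩
      lookup (lookup (lookup R i) q) b
        ≡⟨ cong (λ v → lookup (lookup v q) b) (lookup-map i _ as) ⟩
      lookup (lookup (read (M x) (lookup as i) n) q) b
        ≡⟨ cong (λ w → lookup w b) (lookup∘tabulate _ q) ⟩
      lookup (M x (lookup as i + toℕ q)) b ∎
      where R = Vec.map (λ a → read (M x) a n) as

  read-cert : ∀ {B t ρ} n a {M : Vec Bool V → Memory B} → (∀ q → WordCert t ρ (λ x → M x q)) →
              ∀ (i : Fin n) → WordCert t ρ (λ x → lookup (read (M x) a n) i)
  read-cert n a {M} cert i = wordCert-cong (λ x → sym (lookup∘tabulate _ i)) (cert (a + toℕ i))

  memory-⊑ : ∀ {B t ρ σ} (M : Vec Bool V → Memory B) → ρ ⊑ σ →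
             (∀ q → WordCert t ρ (λ x → M x q)) → ∀ q → WordCert t σ (λ x → M x q)
  memory-⊑ M ρ⊑σ cert q b = cert-⊑ ρ⊑σ (cert q b)

  binary-switchable : ∀ {t ρ} {f g : Vec Bool V → Bool} (c : Bool) → Cert t ρ f → Cert t ρ g →
    Switchable t ρ 1 (λ x → if c then f x ∧ g x else f x ∨ g x)
  binary-switchable {t} {ρ} {f} {g} c certf certg =
    let F , slim , _ , ok = gate-switchable (λ x → f x ∷ g x ∷ [])
                              (λ { zero → certf ; (suc zero) → certg })
                              (if c then ⋀ (true ∷ true ∷ []) else ⋁ (true ∷ true ∷ []))
    in F , slim , inj₂ ≤-refl , λ σ ρ⊑σ p≡0 → cert-cong (λ x → simplify c (f x) (g x)) (ok σ ρ⊑σ p≡0)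
    where
    simplify : ∀ c a b → evalGate (a ∷ b ∷ []) (if c then ⋀ (true ∷ true ∷ []) else ⋁ (true ∷ true ∷ [])) ≡
                         (if c then a ∧ b else a ∨ b)
    simplify true  a b = cong (a ∧_) (Bool.∧-identityʳ b)
    simplify false a b = cong (a ∨_) (Bool.∨-identityʳ b)

-- Simulation of a program on a subcube of inputs

sum-replicate : ∀ n m → Vec.sum (Vec.replicate n m) ≡ n * m
sum-replicate zero    m = refl
sum-replicate (suc n) m = cong (m +_) (sum-replicate n m)

module Simulation {V : ℕ} (t D : ℕ) {ops : List VectorOp} {B : ℕ} (κ : ℕ → ℕ → ℕ) (s : ℕ)
  (depth≤D : ∀ f n → Circuit.depth (VectorOp.circuit (List.lookup ops f) n B s) ≤ D)
  (S : ℕ) (small : rate (K {V} t) * S ≤ 2 ^ suc (suc t)) where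

  τ A : ℕ
  τ = suc t
  -- `suc D`, because `vand` and `vor` cost one layer even if every circuit has depth 0.
  A = rate (K {V} t) ^ suc D

  rate^≤A : ∀ {d} → d ≤ suc D → rate (K {V} t) ^ d ≤ A
  rate^≤A d≤ = ^-monoʳ-≤ (rate (K {V} t)) d≤

  1≤A : 1 ≤ A
  1≤A = rate^≤A z≤n

  Memories : Set
  Memories = Vec Bool V → Memory B

  CertMem : Restriction V → Memories → Set
  CertMem ρ M = ∀ q → WordCert τ ρ (λ x → M x q)

  -- One shape of loss for all instructions: a vector instruction divides the free bits by at most
  -- `A`, a `load` takes away at most `B * τ` of them. After the step only the memory depends on the
  -- input.
  Next : Restriction V → Instr ops → ℕ → (Reg → ℤ) → Memories → Set
  Next ρ c i R M = ∃ λ σ → ρ ⊑ σ × free ρ ≤ A * (free σ + B * τ) × ∃₂ λ i′ R′ → ∃ λ M′ → CertMem σ M′ ×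
    (∀ x → x ⊨ σ → exec s c (state i R (M x)) ≡ state i′ R′ (M′ x))

  stay : ∀ (ρ : Restriction V) → free ρ ≤ A * (free ρ + B * τ)
  stay ρ = ≤-trans (m≤m+n (free ρ) (B * τ)) (≤-trans (≤-reflexive (sym (*-identityˡ _))) (*-monoˡ-≤ _ 1≤A))

  shrunk : ∀ (ρ σ : Restriction V) {d} → d ≤ suc D → free ρ ≤ rate (K {V} t) ^ d * free σ → free ρ ≤ A * (free σ + B * τ)
  shrunk ρ σ d≤ le = ≤-trans le (*-mono-≤ (rate^≤A d≤) (m≤m+n (free σ) (B * τ)))

  binary : ∀ (c : Bool) {ρ} {M : Memories} → 0 < free ρ → CertMem ρ M → ∀ n a b → 3 * (n * B) ≤ S →
    ∃ λ σ → ρ ⊑ σ × free ρ ≤ rate (K {V} t) ^ 1 * free σ × (∀ i → WordCert τ σ (λ x →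
      lookup (zipWith (zipWith (λ u v → if c then u ∧ v else u ∨ v)) (read (M x) a n) (read (M x) b n)) i))
  binary c {ρ} {M} 0<ρ cert n a b cheap =
    let σ , ρ⊑σ , shrink , ok = layer-cert t ρ f (Vec.replicate (n * B) 1)
          (λ j → subst (λ m → Switchable τ ρ m (f j)) (sym (lookup-replicate j 1))
            (binary-switchable {f = λ x → lookup (M x (a + toℕ (word j))) (bit j)} {λ x → lookup (M x (b + toℕ (word j))) (bit j)} c (cert (a + toℕ (word j)) (bit j)) (cert (b + toℕ (word j)) (bit j))))
          0<ρ (≤-trans (*-monoʳ-≤ (rate (K {V} t)) (≤-trans (≤-reflexive (trans (sum-replicate (n * B) 1) (*-identityʳ _)))
                (≤-trans (m≤n*m (n * B) 3) cheap))) small)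
    in σ , ρ⊑σ , ≤-trans shrink (≤-reflexive (cong (_* free σ) (sym (*-identityʳ (rate (K {V} t)))))) , λ i k → cert-cong (eq i k) (ok (combine i k))
    where
    word : Fin (n * B) → Fin n
    word j = proj₁ (remQuot {n} B j)
    bit : Fin (n * B) → Fin B
    bit j = proj₂ (remQuot {n} B j)
    o : Bool → Bool → Bool
    o u v = if c then u ∧ v else u ∨ v
    g : Fin n × Fin B → Vec Bool V → Bool
    g (i , k) x = o (lookup (M x (a + toℕ i)) k) (lookup (M x (b + toℕ i)) k)
    f : Fin (n * B) → Vec Bool V → Bool
    f j = g (remQuot {n} B j)
    eq : ∀ i k x → f (combine i k) x ≡ lookup (lookup (zipWith (zipWith o) (read (M x) a n) (read (M x) b n)) i) k
    eq i k x = trans (cong (λ p → g p x) (Fin.remQuot-combine {n} {B} i k)) (sym (begin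
      lookup (lookup (zipWith (zipWith o) (read (M x) a n) (read (M x) b n)) i) k
        ≡⟨ cong (λ w → lookup w k) (lookup-zipWith (zipWith o) i (read (M x) a n) (read (M x) b n)) ⟩
      lookup (zipWith o (lookup (read (M x) a n) i) (lookup (read (M x) b n) i)) k
        ≡⟨ lookup-zipWith o k (lookup (read (M x) a n) i) (lookup (read (M x) b n) i) ⟩
      o (lookup (lookup (read (M x) a n) i) k) (lookup (lookup (read (M x) b n) i) k)
        ≡⟨ cong₂ (λ u v → o (lookup u k) (lookup v k)) (lookup∘tabulate _ i) (lookup∘tabulate _ i) ⟩
      o (lookup (M x (a + toℕ i)) k) (lookup (M x (b + toℕ i)) k) ∎))
      where open ≡-Reasoning

  -- Addresses, lengths and jump conditions come from the common registers, so all inputs of the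
  -- subcube access the same cells, and the cost seen at the one input `fill ρ` bounds the wires for
  -- all of them. `load` is the only instruction that carries data from the memory to a register, so
  -- it alone has to fix bits.
  next : ∀ {ρ} (c : Instr ops) i R M → unit c ≢ MMU → 0 < free ρ → CertMem ρ M →
         (∀ x → x ⊨ ρ → cost κ s c (state i R (M x)) ≤ S) → Next ρ c i R M
  next {ρ} (const d z) i R M _ _ cert _ = ρ , ⊑-refl , stay ρ , _ , _ , M , cert , λ _ _ → refl
  next {ρ} (scalar f d a b) i R M _ _ cert _ = ρ , ⊑-refl , stay ρ , _ , _ , M , cert , λ _ _ → refl
  next {ρ} (load d a) i R M _ _ cert _ =
    let σ , ρ⊑σ , shrink , w , ok = freeze (λ x → M x ℤ.∣ R a ∣) (cert ℤ.∣ R a ∣)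
    in σ , ρ⊑σ , ≤-trans shrink (≤-trans (≤-reflexive (sym (*-identityˡ _))) (*-monoˡ-≤ _ 1≤A)) ,
       suc i , R [ d ≔ ⟦ w ⟧ ] , M , memory-⊑ M ρ⊑σ cert ,
       λ x x⊨σ → cong (λ u → state (suc i) (R [ d ≔ ⟦ u ⟧ ]) (M x)) (ok x x⊨σ)
  next {ρ} (store a b) i R M _ _ cert _ =
    ρ , ⊑-refl , stay ρ , suc i , R , (λ x → write (M x) ℤ.∣ R a ∣ (fromℤ B (R b) ∷ [])) ,
    write-cert M ℤ.∣ R a ∣ (λ _ → fromℤ B (R b) ∷ []) cert (λ { zero b → cert-const _ }) , λ _ _ → refl
  next {ρ} (jump a target) i R M _ _ cert _ = ρ , ⊑-refl , stay ρ , _ , _ , M , cert , λ _ _ → refl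
  next {ρ} (vand d a b n) i R M _ 0<ρ cert cheap =
    let σ , ρ⊑σ , shrink , ok = binary true {M = M} 0<ρ cert ℤ.∣ R n ∣ ℤ.∣ R a ∣ ℤ.∣ R b ∣ (cheap (fill ρ) (fill-⊨ ρ))
    in σ , ρ⊑σ , shrunk ρ σ (s≤s z≤n) shrink , suc i , R , _ ,
       write-cert M ℤ.∣ R d ∣ (λ x → zipWith (zipWith _∧_) (read (M x) ℤ.∣ R a ∣ ℤ.∣ R n ∣) (read (M x) ℤ.∣ R b ∣ ℤ.∣ R n ∣)) (memory-⊑ M ρ⊑σ cert) ok , λ _ _ → refl
  next {ρ} (vor d a b n) i R M _ 0<ρ cert cheap =
    let σ , ρ⊑σ , shrink , ok = binary false {M = M} 0<ρ cert ℤ.∣ R n ∣ ℤ.∣ R a ∣ ℤ.∣ R b ∣ (cheap (fill ρ) (fill-⊨ ρ))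
    in σ , ρ⊑σ , shrunk ρ σ (s≤s z≤n) shrink , suc i , R , _ ,
       write-cert M ℤ.∣ R d ∣ (λ x → zipWith (zipWith _∨_) (read (M x) ℤ.∣ R a ∣ ℤ.∣ R n ∣) (read (M x) ℤ.∣ R b ∣ ℤ.∣ R n ∣)) (memory-⊑ M ρ⊑σ cert) ok , λ _ _ → refl
  next {ρ} (vnot d a n) i R M _ 0<ρ cert _ =
    ρ , ⊑-refl , stay ρ , suc i , R , _ , write-cert M ℤ.∣ R d ∣ (λ x → Vec.map (Vec.map not) (read (M x) ℤ.∣ R a ∣ ℤ.∣ R n ∣)) cert negated , λ _ _ → refl
    where
    negated : ∀ j → WordCert τ ρ (λ x → lookup (Vec.map (Vec.map not) (read (M x) ℤ.∣ R a ∣ ℤ.∣ R n ∣)) j)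
    negated j b = cert-cong
      (λ x → sym (trans (cong (λ w → lookup w b) (lookup-map j (Vec.map not) (read (M x) ℤ.∣ R a ∣ ℤ.∣ R n ∣)))
                    (lookup-map b not (lookup (read (M x) ℤ.∣ R a ∣ ℤ.∣ R n ∣) j))))
      (cert-not (read-cert ℤ.∣ R n ∣ ℤ.∣ R a ∣ {M} cert j b))
  next {ρ} (vector f d as n) i R M _ 0<ρ cert cheap =
    let σ , ρ⊑σ , shrink , ok = levels-cert t ρ (Circuit.levels C)
          (λ x → concat (Vec.map concat (xs x)))
          (λ j → cert-cong (λ x → cong (λ v → lookup (concat (Vec.map concat v)) j) (sym (xs≡ x)))
                   (concat-cert (Vec.map (λ a → ℤ.∣ R a ∣) as) {M} cert j))
          0<ρ (≤-trans (*-monoʳ-≤ (rate (K {V} t)) (≤-trans (m≤m+n _ (m * B)) (cheap (fill ρ) (fill-⊨ ρ)))) small)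
    in σ , ρ⊑σ , shrunk ρ σ (m≤n⇒m≤1+n (depth≤D f m)) shrink , suc i , R , _ ,
       write-cert M ℤ.∣ R d ∣ (λ x → VectorOp.apply F s m (xs x)) (memory-⊑ M ρ⊑σ cert)
         (λ j b → cert-cong (λ x → sym (apply-bit {B} F s m (xs x) j b)) (ok (lookup (Circuit.outputs C) (combine j b)))) ,
       λ _ _ → refl
    where
    F = List.lookup ops f
    m = ℤ.∣ R n ∣
    C = VectorOp.circuit F m B s
    xs : Vec Bool V → Vec (Vec (Word B) m) (VectorOp.arity F)
    xs x = Vec.map (λ a → read (M x) ℤ.∣ R a ∣ m) as
    xs≡ : ∀ x → xs x ≡ Vec.map (λ a → read (M x) a m) (Vec.map (λ a → ℤ.∣ R a ∣) as)
    xs≡ x = Vec.map-∘ (λ a → read (M x) a m) (λ a → ℤ.∣ R a ∣) as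
  next (matmul d a b n) i R M c≢MMU _ _ _ = contradiction refl c≢MMU

  module _ (p : List (Instr ops)) (avoids : All (λ c → unit c ≢ MMU) p)
    (Good : Vec Bool V → Memory B → Set) (S₀ : ℕ)
    (final : ∀ ρ M → CertMem ρ M → (∀ x → x ⊨ ρ → Good x (M x)) → free ρ ≤ S₀) where

    bound : ℕ → ℕ
    bound zero    = S₀
    bound (suc T) = A * (bound T + B * τ)

    S₀≤bound : ∀ T → S₀ ≤ bound T
    S₀≤bound zero    = ≤-refl
    S₀≤bound (suc T) = ≤-trans (S₀≤bound T) (≤-trans (m≤m+n (bound T) (B * τ))
      (≤-trans (≤-reflexive (sym (*-identityˡ _))) (*-monoˡ-≤ _ 1≤A)))

    fetch-unit : ∀ i {c} → fetch {ops} {B} κ s p i ≡ just c → unit c ≢ MMU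
    fetch-unit i eq = go (List.drop i p) (All.drop⁺ i avoids) eq
      where
      go : ∀ q {c} → All (λ c → unit c ≢ MMU) q → List.head q ≡ just c → unit c ≢ MMU
      go (_ ∷ _) (c≢ ∷ _) refl = c≢

    simulate : ∀ T ρ i R M → CertMem ρ M →
      (∀ x → x ⊨ ρ → ∃₂ λ u w → u ≤ T × w ≤ S × ∃ λ σ → Run κ s p (state i R (M x)) u w σ × Good x (mem σ)) →
      free ρ ≤ bound T
    simulate T ρ i R M cert runs with fetch {ops} {B} κ s p i in eq
    simulate T ρ i R M cert runs | nothing = ≤-trans (final ρ M cert λ x x⊨ρ → halted x (runs x x⊨ρ)) (S₀≤bound T)
      where
      halted : ∀ x → (∃₂ λ u w → u ≤ T × w ≤ S × ∃ λ σ → Run κ s p (state i R (M x)) u w σ × Good x (mem σ)) → Good x (M x)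
      halted x (_ , _ , _ , _ , _ , halt _ , good)   = good
      halted x (_ , _ , _ , _ , _ , step eq′ _ , _) with () ← trans (sym eq) eq′
    simulate zero ρ i R M cert runs | just c = final ρ M cert λ x x⊨ρ → halted x (runs x x⊨ρ)
      where
      halted : ∀ x → (∃₂ λ u w → u ≤ 0 × w ≤ S × ∃ λ σ → Run κ s p (state i R (M x)) u w σ × Good x (mem σ)) → Good x (M x)
      halted x (_ , _ , _ , _ , _ , halt _ , good) = good
    simulate (suc T) ρ i R M cert runs | just c with free ρ in free≡
    -- Switching starts from a subcube with a free bit; without one the bound is trivial.
    ... | zero  = z≤n
    ... | suc _ =
      let σ , ρ⊑σ , shrink , i′ , R′ , M′ , cert′ , exec≡ =
            next c i R M (fetch-unit i eq) (subst (0 <_) (sym free≡) z<s) cert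
              (λ x x⊨ρ → proj₁ (stepped x (runs x x⊨ρ)))
      in subst (_≤ bound (suc T)) free≡ (≤-trans shrink (*-monoʳ-≤ A (+-monoˡ-≤ (B * τ)
           (simulate T σ i′ R′ M′ cert′ λ x x⊨σ →
             let u , w , u≤T , w≤S , σ′ , run , good = proj₂ (stepped x (runs x (⊨-⊑ ρ⊑σ x⊨σ)))
             in u , w , u≤T , w≤S , σ′ , subst (λ z → Run κ s p z u w σ′) (exec≡ x x⊨σ) run , good))))
      where
      stepped : ∀ x → (∃₂ λ u w → u ≤ suc T × w ≤ S × ∃ λ σ → Run κ s p (state i R (M x)) u w σ × Good x (mem σ)) →
        cost κ s c (state i R (M x)) ≤ S ×
        (∃₂ λ u w → u ≤ T × w ≤ S × ∃ λ σ → Run κ s p (exec s c (state i R (M x))) u w σ × Good x (mem σ))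
      stepped x (_ , _ , _ , _ , _ , halt eq′ , _) with () ← trans (sym eq) eq′
      stepped x (_ , _ , s≤s u≤T , w≤S , σ , step eq′ run , good) with refl ← trans (sym eq) eq′ =
        ≤-trans (m≤m+n _ _) w≤S , _ , _ , u≤T , ≤-trans (m≤n+m _ _) w≤S , σ , run , good

    -- The loss of a `load` is at most `S₀`, hence at most the bound reached so far, which therefore
    -- at worst doubles: this is the 2 in `2 * A`.
    bound-^ : B * τ ≤ S₀ → ∀ T → bound T ≤ S₀ * (2 * A) ^ T
    bound-^ Bτ≤S₀ zero    = ≤-reflexive (sym (*-identityʳ S₀))
    bound-^ Bτ≤S₀ (suc T) = begin
      A * (bound T + B * τ)             ≤⟨ *-monoʳ-≤ A (+-mono-≤ (bound-^ Bτ≤S₀ T) (≤-trans Bτ≤S₀ (m≤m*n S₀ _ {{m^n≢0 (2 * A) T {{>-nonZero (≤-trans 1≤A (m≤n*m A 2))}}}}))) ⟩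
      A * (S₀ * P + S₀ * P)             ≡⟨ lemma A S₀ P ⟩
      S₀ * (2 * A * P)                  ∎
      where
      open ≤-Reasoning
      P = (2 * A) ^ T
      lemma : ∀ a s p → a * (s * p + s * p) ≡ s * (2 * a * p)
      lemma = solve-∀

-- Two's complement and arithmetic modulo powers of two

bit : Bool → ℤ
bit b = if b then 1ℤ else 0ℤ

double≢odd : ∀ q r → 0ℤ ℤ.+ (ℤ.+ 2) ℤ.* q ≢ 1ℤ ℤ.+ (ℤ.+ 2) ℤ.* r
double≢odd q r eq = 1≢2n (ℤ.∣ q ℤ.- r ∣) (trans (cong ℤ.∣_∣ (1≡ q r eq)) (ℤ.abs-* (ℤ.+ 2) (q ℤ.- r)))
  where
  1≢2n : ∀ n → 1 ≢ 2 * n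
  1≢2n n eq with () ← ℕ.∣1⇒≡1 (ℕ.divides n (trans eq (*-comm 2 n)))
  lemma : ∀ r → 1ℤ ≡ (1ℤ ℤ.+ (ℤ.+ 2) ℤ.* r) ℤ.- (ℤ.+ 2) ℤ.* r
  lemma = ℤ.solve-∀
  lemma′ : ∀ q r → (0ℤ ℤ.+ (ℤ.+ 2) ℤ.* q) ℤ.- (ℤ.+ 2) ℤ.* r ≡ (ℤ.+ 2) ℤ.* (q ℤ.- r)
  lemma′ = ℤ.solve-∀
  1≡ : ∀ q r → 0ℤ ℤ.+ (ℤ.+ 2) ℤ.* q ≡ 1ℤ ℤ.+ (ℤ.+ 2) ℤ.* r → 1ℤ ≡ (ℤ.+ 2) ℤ.* (q ℤ.- r)
  1≡ q r eq = trans (lemma r) (trans (cong (ℤ._- (ℤ.+ 2) ℤ.* r) (sym eq)) (lemma′ q r))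

bit-unique : ∀ b c q r → bit b ℤ.+ (ℤ.+ 2) ℤ.* q ≡ bit c ℤ.+ (ℤ.+ 2) ℤ.* r → b ≡ c × q ≡ r
bit-unique false true  q r eq = contradiction eq (double≢odd q r)
bit-unique true  false q r eq = contradiction (sym eq) (double≢odd r q)
bit-unique false false q r eq = refl , ℤ.*-cancelˡ-≡ (ℤ.+ 2) q r (ℤ+.∙-cancelˡ 0ℤ _ _ eq)
bit-unique true  true  q r eq = refl , ℤ.*-cancelˡ-≡ (ℤ.+ 2) q r (ℤ+.∙-cancelˡ 1ℤ _ _ eq)

halve : ∀ z → z ≡ bit (z ℤ.%ℕ 2 ≡ᵇ 1) ℤ.+ (ℤ.+ 2) ℤ.* (z ℤ./ℕ 2)
halve z = trans (ℤ.a≡a%ℕn+[a/ℕn]*n z 2)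
  (cong₂ ℤ._+_ (digit (z ℤ.%ℕ 2) (ℤ.n%ℕd<d z 2)) (ℤ.*-comm (z ℤ./ℕ 2) (ℤ.+ 2)))
  where
  digit : ∀ r → r < 2 → ℤ.+ r ≡ bit (r ≡ᵇ 1)
  digit 0 _ = refl
  digit 1 _ = refl
  digit (suc (suc r)) (s≤s (s≤s ()))

fromℤ-step : ∀ B b q → fromℤ (suc B) (bit b ℤ.+ (ℤ.+ 2) ℤ.* q) ≡ b ∷ fromℤ B q
fromℤ-step B b q with bit-unique _ b _ q (sym (halve (bit b ℤ.+ (ℤ.+ 2) ℤ.* q)))
... | b≡ , q≡ = cong₂ (λ c r → c ∷ fromℤ B r) b≡ q≡

-- The top bit has weight -1 = 1 + 2 * -1, like a bit followed by ones.
⟦⟧-step : ∀ {B} b (w : Word B) → ∃ λ q → ⟦ b ∷ w ⟧ ≡ bit b ℤ.+ (ℤ.+ 2) ℤ.* q × fromℤ B q ≡ w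
fromℤ-⟦⟧ : ∀ {B} (w : Word B) → fromℤ B ⟦ w ⟧ ≡ w

⟦⟧-step false []        = 0ℤ , refl , refl
⟦⟧-step true  []        = -1ℤ , refl , refl
⟦⟧-step b     w@(_ ∷ _) = ⟦ w ⟧ , refl , fromℤ-⟦⟧ w

fromℤ-⟦⟧ []            = refl
fromℤ-⟦⟧ {suc B} (b ∷ w) with ⟦⟧-step b w
... | q , eq , ih = trans (cong (fromℤ (suc B)) eq) (trans (fromℤ-step B b q) (cong (b ∷_) ih))

2^ : ℕ → ℤ
2^ B = (ℤ.+ 2) ℤ.^ B

infix 4 _≡_[2^_]

record _≡_[2^_] (x y : ℤ) (B : ℕ) : Set where
  constructor mk≡
  field
    quotient : ℤ
    equation : x ≡ y ℤ.+ 2^ B ℤ.* quotient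

fromℤ-cong : ∀ B {x y} → x ≡ y [2^ B ] → fromℤ B x ≡ fromℤ B y
fromℤ-cong zero    _           = refl
fromℤ-cong (suc B) {x} {y} (mk≡ q eq) = begin
  fromℤ (suc B) x                                       ≡⟨ cong (fromℤ (suc B)) eq′ ⟩
  fromℤ (suc B) (bit b ℤ.+ (ℤ.+ 2) ℤ.* (r ℤ.+ 2^ B ℤ.* q)) ≡⟨ fromℤ-step B b _ ⟩
  b ∷ fromℤ B (r ℤ.+ 2^ B ℤ.* q)                        ≡⟨ cong (b ∷_) (fromℤ-cong B (mk≡ q refl)) ⟩
  b ∷ fromℤ B r                                         ∎
  where
  open ≡-Reasoning
  b = y ℤ.%ℕ 2 ≡ᵇ 1
  r = y ℤ./ℕ 2
  lemma : ∀ c r p q → (c ℤ.+ (ℤ.+ 2) ℤ.* r) ℤ.+ ((ℤ.+ 2) ℤ.* p) ℤ.* q ≡ c ℤ.+ (ℤ.+ 2) ℤ.* (r ℤ.+ p ℤ.* q)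
  lemma = ℤ.solve-∀
  eq′ : x ≡ bit b ℤ.+ (ℤ.+ 2) ℤ.* (r ℤ.+ 2^ B ℤ.* q)
  eq′ = trans eq (trans (cong (ℤ._+ 2^ (suc B) ℤ.* q) (halve y)) (lemma (bit b) r (2^ B) q))

fromℤ-injective : ∀ B {x y} → fromℤ B x ≡ fromℤ B y → x ≡ y [2^ B ]
fromℤ-injective zero {x} {y} _ = mk≡ (x ℤ.- y) (lemma x y)
  where
  lemma : ∀ x y → x ≡ y ℤ.+ 1ℤ ℤ.* (x ℤ.- y)
  lemma = ℤ.solve-∀
fromℤ-injective (suc B) {x} {y} eq with ∷-injective eq
... | b≡ , eq′ with fromℤ-injective B eq′
... | mk≡ q q≡ = mk≡ q (begin
  x                                                          ≡⟨ halve x ⟩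
  bit (x ℤ.%ℕ 2 ≡ᵇ 1) ℤ.+ (ℤ.+ 2) ℤ.* (x ℤ./ℕ 2)               ≡⟨ cong₂ (λ b r → bit b ℤ.+ (ℤ.+ 2) ℤ.* r) b≡ q≡ ⟩
  bit (y ℤ.%ℕ 2 ≡ᵇ 1) ℤ.+ (ℤ.+ 2) ℤ.* (y ℤ./ℕ 2 ℤ.+ 2^ B ℤ.* q) ≡⟨ lemma (bit (y ℤ.%ℕ 2 ≡ᵇ 1)) (y ℤ./ℕ 2) (2^ B) q ⟩
  (bit (y ℤ.%ℕ 2 ≡ᵇ 1) ℤ.+ (ℤ.+ 2) ℤ.* (y ℤ./ℕ 2)) ℤ.+ 2^ (suc B) ℤ.* q
    ≡⟨ cong (ℤ._+ 2^ (suc B) ℤ.* q) (halve y) ⟨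
  y ℤ.+ 2^ (suc B) ℤ.* q ∎)
  where
  open ≡-Reasoning
  lemma : ∀ c r p q → c ℤ.+ (ℤ.+ 2) ℤ.* (r ℤ.+ p ℤ.* q) ≡ (c ℤ.+ (ℤ.+ 2) ℤ.* r) ℤ.+ ((ℤ.+ 2) ℤ.* p) ℤ.* q
  lemma = ℤ.solve-∀

module _ {B : ℕ} where

  mod-refl : ∀ {x} → x ≡ x [2^ B ]
  mod-refl {x} = mk≡ 0ℤ (sym (trans (cong (λ y → x ℤ.+ y) (ℤ.*-zeroʳ (2^ B))) (ℤ.+-identityʳ x)))

  mod-+ : ∀ {x x′ y y′} → x ≡ x′ [2^ B ] → y ≡ y′ [2^ B ] → x ℤ.+ y ≡ x′ ℤ.+ y′ [2^ B ]
  mod-+ {x′ = x′} {y′ = y′} (mk≡ p refl) (mk≡ q refl) = mk≡ (p ℤ.+ q) (lemma x′ y′ (2^ B) p q)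
    where
    lemma : ∀ x y b p q → (x ℤ.+ b ℤ.* p) ℤ.+ (y ℤ.+ b ℤ.* q) ≡ (x ℤ.+ y) ℤ.+ b ℤ.* (p ℤ.+ q)
    lemma = ℤ.solve-∀

  mod-sum : ∀ {n} {f g : Fin n → ℤ} → (∀ i → f i ≡ g i [2^ B ]) → sum f ≡ sum g [2^ B ]
  mod-sum {zero}  f≡g = mod-refl
  mod-sum {suc n} f≡g = mod-+ (f≡g zero) (mod-sum (f≡g ∘ suc))

  ⟦fromℤ⟧ : ∀ z → ⟦ fromℤ B z ⟧ ≡ z [2^ B ]
  ⟦fromℤ⟧ z = fromℤ-injective B (fromℤ-⟦⟧ (fromℤ B z))

-- Sensitivity of a bit to the addition of an odd multiple of its weight

odd : ℤ → ℤ
odd e = 1ℤ ℤ.+ (ℤ.+ 2) ℤ.* e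

-- Carries move upwards only: below `b` nothing changes, and at `b` an odd number is added to the
-- remaining quotient, which changes its parity.
fromℤ-flip : ∀ {B} (b : Fin B) z e →
             lookup (fromℤ B (z ℤ.+ 2^ (toℕ b) ℤ.* odd e)) b ≢ lookup (fromℤ B z) b
fromℤ-flip {suc B} zero z e eq = flip (z ℤ.%ℕ 2 ≡ᵇ 1) (trans (cong (λ w → lookup w zero) (sym flipped)) eq)
  where
  r = z ℤ./ℕ 2
  lemma₀ : ∀ r e → (0ℤ ℤ.+ (ℤ.+ 2) ℤ.* r) ℤ.+ 1ℤ ℤ.* (1ℤ ℤ.+ (ℤ.+ 2) ℤ.* e) ≡ 1ℤ ℤ.+ (ℤ.+ 2) ℤ.* (r ℤ.+ e)
  lemma₀ = ℤ.solve-∀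
  lemma₁ : ∀ r e → (1ℤ ℤ.+ (ℤ.+ 2) ℤ.* r) ℤ.+ 1ℤ ℤ.* (1ℤ ℤ.+ (ℤ.+ 2) ℤ.* e) ≡ 0ℤ ℤ.+ (ℤ.+ 2) ℤ.* (r ℤ.+ e ℤ.+ 1ℤ)
  lemma₁ = ℤ.solve-∀
  flip : ∀ b → not b ≢ b
  flip false ()
  flip true  ()
  rest : Bool → ℤ
  rest b = if b then r ℤ.+ e ℤ.+ 1ℤ else r ℤ.+ e
  carry : ∀ b → (bit b ℤ.+ (ℤ.+ 2) ℤ.* r) ℤ.+ 1ℤ ℤ.* odd e ≡ bit (not b) ℤ.+ (ℤ.+ 2) ℤ.* rest b
  carry false = lemma₀ r e
  carry true  = lemma₁ r e
  flipped : fromℤ (suc B) (z ℤ.+ 1ℤ ℤ.* odd e) ≡ not (z ℤ.%ℕ 2 ≡ᵇ 1) ∷ fromℤ B (rest (z ℤ.%ℕ 2 ≡ᵇ 1))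
  flipped = trans (cong (fromℤ (suc B)) (trans (cong (ℤ._+ 1ℤ ℤ.* odd e) (halve z)) (carry (z ℤ.%ℕ 2 ≡ᵇ 1))))
                  (fromℤ-step B (not (z ℤ.%ℕ 2 ≡ᵇ 1)) _)
fromℤ-flip {suc B} (suc b) z e eq =
  fromℤ-flip b r e (trans (cong (λ w → lookup w (suc b)) (sym shifted)) eq)
  where
  c = z ℤ.%ℕ 2 ≡ᵇ 1
  r = z ℤ./ℕ 2
  p = 2^ (toℕ b)
  lemma : ∀ c r p o → (c ℤ.+ (ℤ.+ 2) ℤ.* r) ℤ.+ ((ℤ.+ 2) ℤ.* p) ℤ.* o ≡ c ℤ.+ (ℤ.+ 2) ℤ.* (r ℤ.+ p ℤ.* o)
  lemma = ℤ.solve-∀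
  shifted : fromℤ (suc B) (z ℤ.+ ((ℤ.+ 2) ℤ.* p) ℤ.* odd e) ≡ c ∷ fromℤ B (r ℤ.+ p ℤ.* odd e)
  shifted = trans (cong (fromℤ (suc B)) (trans (cong (ℤ._+ ((ℤ.+ 2) ℤ.* p) ℤ.* odd e) (halve z)) (lemma (bit c) r p (odd e))))
                  (fromℤ-step B c _)

-- The sign of the change depends on the old bit and is reversed at the top bit. Odd multiples cover
-- both signs, and they are closed under the multiplication by -1 that follows.
⟦⟧-flip : ∀ {B} (w : Word B) (b : Fin B) →
          ∃ λ e → ⟦ w [ b ]≔ not (lookup w b) ⟧ ≡ ⟦ w ⟧ ℤ.+ 2^ (toℕ b) ℤ.* odd e
⟦⟧-flip (false ∷ [])      zero = -1ℤ , refl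
⟦⟧-flip (true ∷ [])       zero = 0ℤ , refl
⟦⟧-flip (false ∷ w@(_ ∷ _)) zero = 0ℤ , lemma ⟦ w ⟧
  where
  lemma : ∀ x → 1ℤ ℤ.+ (ℤ.+ 2) ℤ.* x ≡ (0ℤ ℤ.+ (ℤ.+ 2) ℤ.* x) ℤ.+ 1ℤ ℤ.* (1ℤ ℤ.+ (ℤ.+ 2) ℤ.* 0ℤ)
  lemma = ℤ.solve-∀
⟦⟧-flip (true ∷ w@(_ ∷ _)) zero = -1ℤ , lemma ⟦ w ⟧
  where
  lemma : ∀ x → 0ℤ ℤ.+ (ℤ.+ 2) ℤ.* x ≡ (1ℤ ℤ.+ (ℤ.+ 2) ℤ.* x) ℤ.+ 1ℤ ℤ.* (1ℤ ℤ.+ (ℤ.+ 2) ℤ.* -1ℤ)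
  lemma = ℤ.solve-∀
⟦⟧-flip (c ∷ w@(_ ∷ _)) (suc b) with ⟦⟧-flip w b
... | e , eq = e , trans (head c w b) (trans (cong (λ x → bit c ℤ.+ (ℤ.+ 2) ℤ.* x) eq) (lemma (bit c) ⟦ w ⟧ (2^ (toℕ b)) (odd e)))
  where
  head : ∀ {B} c (w : Word (suc B)) b → ⟦ c ∷ (w [ b ]≔ not (lookup w b)) ⟧ ≡ bit c ℤ.+ (ℤ.+ 2) ℤ.* ⟦ w [ b ]≔ not (lookup w b) ⟧
  head c (_ ∷ _) zero    = refl
  head c (_ ∷ _) (suc b) = refl
  lemma : ∀ c x p o → c ℤ.+ (ℤ.+ 2) ℤ.* (x ℤ.+ p ℤ.* o) ≡ (c ℤ.+ (ℤ.+ 2) ℤ.* x) ℤ.+ ((ℤ.+ 2) ℤ.* p) ℤ.* o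
  lemma = ℤ.solve-∀

⟦ones⟧ : ∀ B → ⟦ Vec.replicate (suc B) true ⟧ ≡ -1ℤ
⟦ones⟧ zero    = refl
⟦ones⟧ (suc B) = cong (λ x → 1ℤ ℤ.+ (ℤ.+ 2) ℤ.* x) (⟦ones⟧ B)

sum-update : ∀ {n} (f g : Fin n → ℤ) i d → (∀ k → k ≢ i → g k ≡ f k) → g i ≡ f i ℤ.+ d →
             sum g ≡ sum f ℤ.+ d
sum-update {suc n} f g zero d same change =
  trans (cong₂ ℤ._+_ change (sum-cong-≗ (λ k → same (suc k) (λ ())))) (lemma (f zero) d (sum (f ∘ suc)))
  where
  lemma : ∀ a d s → (a ℤ.+ d) ℤ.+ s ≡ (a ℤ.+ s) ℤ.+ d
  lemma = ℤ.solve-∀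
sum-update {suc n} f g (suc i) d same change =
  trans (cong₂ ℤ._+_ (same zero (λ ())) (sum-update (f ∘ suc) (g ∘ suc) i d (λ k k≢i → same (suc k) (k≢i ∘ Fin.suc-injective)) change))
        (sym (ℤ.+-assoc (f zero) _ d))

-- The hard instances of matrix multiplication

free-none : ∀ {V} (ρ : Restriction V) → (∀ v → lookup ρ v ≢ nothing) → free ρ ≡ 0
free-none []            fixed = refl
free-none (nothing ∷ ρ) fixed = contradiction refl (fixed zero)
free-none (just _ ∷ ρ)  fixed = free-none ρ (fixed ∘ suc)

free-all : ∀ V → free (replicate V nothing) ≡ V
free-all zero    = refl
free-all (suc V) = cong suc (free-all V)

-- Assigning the variables of `L` leaves none free, and each assignment removes at most one.
free≤length : ∀ {V} (ρ : Restriction V) L → (∀ v → lookup ρ v ≡ nothing → v ∈ L) → free ρ ≤ length L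
free≤length {V} ρ L covered = ≤-trans (free-assign ρ x L) (≤-reflexive (cong (_+ length L) (free-none (assign ρ x L) fixed)))
  where
  x = fill ρ
  fixed : ∀ v → lookup (assign ρ x L) v ≢ nothing
  fixed v eq with lookup ρ v in eq′
  ... | nothing with () ← trans (sym eq) (All.lookup (assign-fixes ρ x L) (covered v eq′))
  ... | just b  with () ← trans (sym eq) (fixes (⊑-assign L (fill-⊨ ρ)) v b eq′)

gather-∈ : ∀ {V k} (f : Fin k → List (Fin V)) i {v} → v ∈ f i → v ∈ gather f
gather-∈ f zero    v∈ = ∈-++⁺ˡ v∈
gather-∈ f (suc i) v∈ = ∈-++⁺ʳ (f zero) (gather-∈ (f ∘ suc) i v∈)

lookup-readMatrix : ∀ {A : Set} (M : ℕ → A) a m n i j → entry (readMatrix M a m n) i j ≡ M (a + toℕ (combine i j))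
lookup-readMatrix M a m n i j = trans (lookup-group m n _ i j) (lookup∘tabulate _ (combine i j))

entry-⊗ : ∀ {B m n l} (X : Matrix (Word B) m n) (Y : Matrix (Word B) n l) i j →
          entry (X ⊗ Y) i j ≡ fromℤ B (sum λ k → ⟦ entry X i k ⟧ ℤ.* ⟦ entry Y k j ⟧)
entry-⊗ X Y i j = trans (cong (λ r → lookup r j) (lookup∘tabulate _ i)) (lookup∘tabulate _ j)

module LowerBound (s n B : ℕ) where

  V : ℕ
  V = s * (s * B)

  idx : Fin s → Fin s → Fin B → Fin V
  idx i j b = combine i (combine j b)

  right-factor : Vec Bool V → Matrix (Word (B)) s s
  right-factor x = tabulate λ i → tabulate λ j → tabulate λ b → lookup x (idx i j b)

  -- All entries are -1, for every B ≥ 1: a product is a negated column sum.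
  left-factor : Matrix (Word B) n s
  left-factor = replicate n (replicate s (replicate B true))

  bit-right-factor : ∀ x i j b → lookup (entry (right-factor x) i j) b ≡ lookup x (idx i j b)
  bit-right-factor x i j b =
    trans (cong (λ r → lookup (lookup r j) b) (lookup∘tabulate _ i))
      (trans (cong (λ w → lookup w b) (lookup∘tabulate _ j)) (lookup∘tabulate _ b))

  toggle : Fin V → Vec Bool V → Vec Bool V
  toggle v x = x [ v ]≔ not (lookup x v)

  right-factor-toggle : ∀ x i j b → entry (right-factor (toggle (idx i j b) x)) i j ≡
    entry (right-factor x) i j [ b ]≔ not (lookup (entry (right-factor x) i j) b)
  right-factor-toggle x i j b = lookup-ext go
    where
    open ≡-Reasoning
    w = entry (right-factor x) i j
    go : ∀ c → lookup (entry (right-factor (toggle (idx i j b) x)) i j) c ≡ lookup (w [ b ]≔ not (lookup w b)) c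
    go c with c Fin.≟ b
    ... | yes refl = begin
      lookup (entry (right-factor (toggle (idx i j b) x)) i j) b ≡⟨ bit-right-factor (toggle (idx i j b) x) i j b ⟩
      lookup (toggle (idx i j b) x) (idx i j b)                  ≡⟨ lookup∘update (idx i j b) x _ ⟩
      not (lookup x (idx i j b))                                 ≡⟨ cong not (bit-right-factor x i j b) ⟨
      not (lookup w b)                                           ≡⟨ lookup∘update b w _ ⟨
      lookup (w [ b ]≔ not (lookup w b)) b                       ∎
    ... | no c≢b = begin
      lookup (entry (right-factor (toggle (idx i j b) x)) i j) c ≡⟨ bit-right-factor (toggle (idx i j b) x) i j c ⟩
      lookup (toggle (idx i j b) x) (idx i j c)                  ≡⟨ lookup∘update′ (c≢b ∘ bits) x _ ⟩
      lookup x (idx i j c)                                       ≡⟨ bit-right-factor x i j c ⟨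
      lookup w c                                                 ≡⟨ lookup∘update′ c≢b w _ ⟨
      lookup (w [ b ]≔ not (lookup w b)) c                       ∎
      where
      bits : idx i j c ≡ idx i j b → c ≡ b
      bits eq = proj₂ (Fin.combine-injective j c j b (proj₂ (Fin.combine-injective i (combine j c) i (combine j b) eq)))

  right-factor-toggle′ : ∀ x i j b k → k ≢ i →
    entry (right-factor (toggle (idx i j b) x)) k j ≡ entry (right-factor x) k j
  right-factor-toggle′ x i j b k k≢i = lookup-ext λ c →
    trans (bit-right-factor (toggle (idx i j b) x) k j c)
      (trans (lookup∘update′ (λ eq → k≢i (proj₁ (Fin.combine-injective k (combine j c) i (combine j b) eq))) x _)
        (sym (bit-right-factor x k j c)))

  -- Adding ± 2^b to an entry of a column flips bit b of the sum of the column.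
  product-toggle : ∀ x (r : Fin n) i j b →
    lookup (entry (left-factor ⊗ right-factor (toggle (idx i j b) x)) r j) b ≢
    lookup (entry (left-factor ⊗ right-factor x) r j) b
  product-toggle x r i j b eq with ⟦⟧-flip (entry (right-factor x) i j) b
  ... | e , flip = fromℤ-flip b (sum (f x)) (-1ℤ ℤ.- e) (begin
    lookup (fromℤ B (sum (f x) ℤ.+ p ℤ.* odd (-1ℤ ℤ.- e))) b     ≡⟨ cong (λ z → lookup (fromℤ B z) b) (sum-update (f x) (f x′) i _ same changed) ⟨
    lookup (fromℤ B (sum (f x′))) b                              ≡⟨ cong (λ w → lookup w b) (entry-⊗ left-factor (right-factor x′) r j) ⟨
    lookup (entry (left-factor ⊗ right-factor x′) r j) b         ≡⟨ eq ⟩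
    lookup (entry (left-factor ⊗ right-factor x) r j) b          ≡⟨ cong (λ w → lookup w b) (entry-⊗ left-factor (right-factor x) r j) ⟩
    lookup (fromℤ B (sum (f x))) b                               ∎)
    where
    open ≡-Reasoning
    x′ = toggle (idx i j b) x
    p = 2^ (toℕ b)
    f : Vec Bool V → Fin s → ℤ
    f x k = ⟦ entry left-factor r k ⟧ ℤ.* ⟦ entry (right-factor x) k j ⟧
    one : ∀ {B} → Fin B → ⟦ Vec.replicate B true ⟧ ≡ -1ℤ
    one {suc B} _ = ⟦ones⟧ B
    minus : ⟦ entry left-factor r i ⟧ ≡ -1ℤ
    minus = trans (cong (λ row → ⟦ lookup row i ⟧) (lookup-replicate r _))
              (trans (cong ⟦_⟧ (lookup-replicate i _)) (one b))
    same : ∀ k → k ≢ i → f x′ k ≡ f x k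
    same k k≢i = cong (λ w → ⟦ entry left-factor r k ⟧ ℤ.* ⟦ w ⟧) (right-factor-toggle′ x i j b k k≢i)
    lemma : ∀ u p e → -1ℤ ℤ.* (u ℤ.+ p ℤ.* (1ℤ ℤ.+ (ℤ.+ 2) ℤ.* e)) ≡ -1ℤ ℤ.* u ℤ.+ p ℤ.* (1ℤ ℤ.+ (ℤ.+ 2) ℤ.* (-1ℤ ℤ.- e))
    lemma = ℤ.solve-∀
    changed : f x′ i ≡ f x i ℤ.+ p ℤ.* odd (-1ℤ ℤ.- e)
    changed = begin
      ⟦ entry left-factor r i ⟧ ℤ.* ⟦ entry (right-factor x′) i j ⟧
        ≡⟨ cong₂ ℤ._*_ minus (trans (cong ⟦_⟧ (right-factor-toggle x i j b)) flip) ⟩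
      -1ℤ ℤ.* (⟦ entry (right-factor x) i j ⟧ ℤ.+ p ℤ.* odd e)
        ≡⟨ lemma ⟦ entry (right-factor x) i j ⟧ p e ⟩
      -1ℤ ℤ.* ⟦ entry (right-factor x) i j ⟧ ℤ.+ p ℤ.* odd (-1ℤ ℤ.- e)
        ≡⟨ cong (λ z → z ℤ.* ⟦ entry (right-factor x) i j ⟧ ℤ.+ p ℤ.* odd (-1ℤ ℤ.- e)) minus ⟨
      f x i ℤ.+ p ℤ.* odd (-1ℤ ℤ.- e) ∎

  input : Vec Bool V → Vec (Word B) (n * s + s * s)
  input x = concat left-factor ++ concat (right-factor x)

  input-cert : ∀ {t ρ} i → WordCert (suc t) ρ (λ x → lookup (input x) i)
  input-cert i b with splitAt (n * s) i in eq
  ... | inj₁ k with refl ← Fin.splitAt⁻¹-↑ˡ eq =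
    cert-cong (λ x → cong (λ w → lookup w b) (sym (lookup-++ˡ (concat left-factor) (concat (right-factor x)) k)))
      (cert-const _)
  ... | inj₂ k with refl ← Fin.splitAt⁻¹-↑ʳ {n * s} eq with p , q ← remQuot {s} s k in eq′ =
    cert-cong (λ x → sym (bits x)) λ x x⊨ρ → idx p q b ∷ [] , s≤s z≤n , λ { y y⊨ρ (yv ∷ []) → yv }
    where
    open ≡-Reasoning
    k≡ : k ≡ combine p q
    k≡ = trans (sym (Fin.combine-remQuot {s} s k)) (cong (λ z → combine (proj₁ z) (proj₂ z)) eq′)
    bits : ∀ x → lookup (lookup (input x) ((n * s) ↑ʳ k)) b ≡ lookup x (idx p q b)
    bits x = begin
      lookup (lookup (input x) ((n * s) ↑ʳ k)) b ≡⟨ cong (λ w → lookup w b) (lookup-++ʳ (concat left-factor) (concat (right-factor x)) k) ⟩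
      lookup (lookup (concat (right-factor x)) k) b            ≡⟨ cong (λ z → lookup (lookup (concat (right-factor x)) z) b) k≡ ⟩
      lookup (lookup (concat (right-factor x)) (combine p q)) b ≡⟨ cong (λ w → lookup w b) (lookup-concat (right-factor x) p q) ⟩
      lookup (entry (right-factor x) p q) b                    ≡⟨ bit-right-factor x p q b ⟩
      lookup x (idx p q b)                                     ∎

  memory : Vec Bool V → Memory B
  memory x = mem (start n s (0 ∷ n * s ∷ []) (input x))

  Correct : Vec Bool V → Memory B → Set
  Correct x M = readMatrix M (n * s + s * s) n s ≡ left-factor ⊗ right-factor x

  few-free : ∀ {τ ρ} (r : Fin n) (M : Vec Bool V → Memory B) → (∀ q → WordCert τ ρ (λ x → M x q)) →
             (∀ x → x ⊨ ρ → Correct x (M x)) → free ρ ≤ s * B * τ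
  few-free {τ} {ρ} r M cert correct = ≤-trans (free≤length ρ (gather certs) covered)
    (gather-length certs λ z → proj₁ (proj₂ (certificate (proj₁ (remQuot {s} B z)) (proj₂ (remQuot {s} B z)))))
    where
    open ≡-Reasoning
    x = fill ρ
    x⊨ρ = fill-⊨ ρ
    cell : Fin s → ℕ
    cell j = n * s + s * s + toℕ (combine r j)
    certificate : ∀ j b → ∃ λ L → length L ≤ τ × (∀ y → y ⊨ ρ → Agree L x y → lookup (M y (cell j)) b ≡ lookup (M x (cell j)) b)
    certificate j b = cert (cell j) b x x⊨ρ
    certs : Fin (s * B) → List (Fin V)
    certs z = proj₁ (certificate (proj₁ (remQuot {s} B z)) (proj₂ (remQuot {s} B z)))
    cell≡ : ∀ y → y ⊨ ρ → ∀ j → M y (cell j) ≡ entry (left-factor ⊗ right-factor y) r j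
    cell≡ y y⊨ρ j = trans (sym (lookup-readMatrix (M y) (n * s + s * s) n s r j)) (cong (λ Z → entry Z r j) (correct y y⊨ρ))
    toggle-⊨ : ∀ v → lookup ρ v ≡ nothing → toggle v x ⊨ ρ
    toggle-⊨ v ρv = mk⊨ λ u b ρu → trans (lookup∘update′ (λ { refl → contradiction (trans (sym ρv) ρu) (λ ()) }) x _) (value x⊨ρ u b ρu)
    toggle-agree : ∀ v L → v ∉ L → Agree L x (toggle v x)
    toggle-agree v L v∉L = All.tabulate λ {u} u∈L → lookup∘update′ (λ { refl → v∉L u∈L }) x _
    -- A free bit outside the certificate could be toggled without leaving the subcube or touching
    -- the certificate, yet the bit of the product would flip.
    sensitive : ∀ i j b → lookup ρ (idx i j b) ≡ nothing → idx i j b ∈ proj₁ (certificate j b)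
    sensitive i j b ρv with Dec._∈?_ Fin._≟_ (idx i j b) (proj₁ (certificate j b))
    ... | yes v∈ = v∈
    ... | no v∉  = contradiction (begin
      lookup (entry (left-factor ⊗ right-factor y) r j) b ≡⟨ cong (λ w → lookup w b) (cell≡ y y⊨ρ j) ⟨
      lookup (M y (cell j)) b                             ≡⟨ proj₂ (proj₂ (certificate j b)) y y⊨ρ (toggle-agree (idx i j b) _ v∉) ⟩
      lookup (M x (cell j)) b                             ≡⟨ cong (λ w → lookup w b) (cell≡ x x⊨ρ j) ⟩
      lookup (entry (left-factor ⊗ right-factor x) r j) b ∎) (product-toggle x r i j b)
      where
      y = toggle (idx i j b) x
      y⊨ρ = toggle-⊨ (idx i j b) ρv
    covered : ∀ v → lookup ρ v ≡ nothing → v ∈ gather certs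
    covered v ρv with i , z ← remQuot {s} (s * B) v in eq with j , b ← remQuot {s} B z in eq′ =
      gather-∈ certs z (subst (λ u → u ∈ certs z) (sym v≡)
        (subst (λ p → idx i j b ∈ proj₁ (certificate (proj₁ p) (proj₂ p))) (sym eq′)
          (sensitive i j b (trans (cong (lookup ρ) (sym v≡)) ρv))))
      where
      v≡ : v ≡ idx i j b
      v≡ = trans (sym (Fin.combine-remQuot {s} (s * B) v)) (trans (cong (λ p → combine (proj₁ p) (proj₂ p)) eq)
        (cong (combine i) (trans (sym (Fin.combine-remQuot {s} B z)) (cong (λ p → combine (proj₁ p) (proj₂ p)) eq′))))

  start-≈ : ∀ x y → start n s (0 ∷ n * s ∷ []) (input x) ≈ state 0 (reg (start n s (0 ∷ n * s ∷ []) (input y))) (memory x)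
  start-≈ x y = mk≈ refl same refl
    where
    same : ∀ r → reg (start n s (0 ∷ n * s ∷ []) (input x)) r ≡ reg (start n s (0 ∷ n * s ∷ []) (input y)) r
    same 0 = refl
    same 1 = refl
    same 2 = refl
    same 3 = refl
    same 4 = refl
    same 5 = refl
    same (suc (suc (suc (suc (suc (suc _)))))) = refl

  -- Initially all `s * B * s` bits of the right factor are free, and at the end at most
  -- `s * B * suc t` remain. The common factor `s * B` cancels, so the bound is independent of the
  -- bit-width and of `n`.
  lower-bound : ∀ κ (P : Algorithm) → Avoids MMU P → ∀ t D k T → 1 ≤ s → 1 ≤ n → 1 ≤ B →
    (∀ f m → Circuit.depth (VectorOp.circuit (List.lookup (ops P) f) m B s) ≤ D) →
    rate (8 * suc t) * s ^ k ≤ 2 ^ suc (suc t) →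
    (∀ (X : Matrix (Word B) n s) (Y : Matrix (Word B) s s) →
       ∃₂ λ u w → u ≤ T × w ≤ s ^ k × MultipliesIn κ P s X Y u w) →
    s ≤ suc t * (2 * rate (8 * suc t) ^ suc D) ^ T
  lower-bound κ P avoids t D k T 1≤s 1≤n 1≤B depth≤D small runs =
    *-cancelˡ-≤ (s * B) {{m*n≢0 s B {{>-nonZero 1≤s}} {{>-nonZero 1≤B}}}} (begin
      s * B * s                       ≡⟨ *-comm (s * B) s ⟩
      V                               ≡⟨ free-all V ⟨
      free (replicate V nothing)      ≤⟨ simulate (code P s) (avoids s) Correct (s * B * suc t)
                                           (λ ρ M → few-free (fromℕ< 1≤n) M) T (replicate V nothing) 0 _ memory
                                           (write-cert (λ _ _ → fromℤ B 0ℤ) 0 input (λ q b → cert-const _) input-cert)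
                                           (λ x _ → run x (runs left-factor (right-factor x))) ⟩
      bound (code P s) (avoids s) Correct (s * B * suc t) (λ ρ M → few-free (fromℕ< 1≤n) M) T
        ≤⟨ bound-^ (code P s) (avoids s) Correct (s * B * suc t) (λ ρ M → few-free (fromℕ< 1≤n) M)
             (*-monoˡ-≤ (suc t) (m≤n*m B s {{>-nonZero 1≤s}})) T ⟩
      s * B * suc t * (2 * A) ^ T     ≡⟨ *-assoc (s * B) (suc t) _ ⟩
      s * B * (suc t * (2 * A) ^ T)   ∎)
    where
    open ≤-Reasoning hiding (start)
    open Simulation {V} t D {ops P} {B} κ s depth≤D (s ^ k) small
    y : Vec Bool V
    y = replicate V false
    run : ∀ x → (∃₂ λ u w → u ≤ T × w ≤ s ^ k × MultipliesIn κ P s left-factor (right-factor x) u w) →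
      ∃₂ λ u w → u ≤ T × w ≤ s ^ k × ∃ λ σ →
        Run κ s (code P s) (state 0 (reg (start n s (0 ∷ n * s ∷ []) (input y))) (memory x)) u w σ × Correct x (mem σ)
    run x (u , w , u≤T , w≤ , σ , r , correct) with run-≈ (start-≈ x y) r
    ... | σ′ , r′ , σ≈σ′ = u , w , u≤T , w≤ , σ′ , r′ , subst (Correct x) (_≈_.mem-≡ σ≈σ′) correct

-- Logarithms and the choice of parameters

n<2^[1+log] : ∀ n → n < 2 ^ suc ⌊log₂ n ⌋
n<2^[1+log] n = ≰⇒> λ le → <-irrefl refl (begin-strict
  ⌊log₂ n ⌋                       <⟨ n<1+n _ ⟩
  suc ⌊log₂ n ⌋                   ≡⟨ ⌊log₂[2^n]⌋≡n (suc ⌊log₂ n ⌋) ⟨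
  ⌊log₂ (2 ^ suc ⌊log₂ n ⌋) ⌋     ≤⟨ ⌊log₂⌋-mono-≤ le ⟩
  ⌊log₂ n ⌋                       ∎)
  where open ≤-Reasoning

2^log≤n : ∀ n → 1 ≤ n → 2 ^ ⌊log₂ n ⌋ ≤ n
2^log≤n = <-rec _ go
  where
  open ≤-Reasoning
  twice-half : ∀ n → 2 * ⌊ n /2⌋ ≤ n
  twice-half 0 = z≤n
  twice-half 1 = z≤n
  twice-half (suc (suc n)) = ≤-trans (≤-reflexive (lemma ⌊ n /2⌋)) (s≤s (s≤s (twice-half n)))
    where
    lemma : ∀ h → 2 * suc h ≡ 2 + 2 * h
    lemma = solve-∀
  double-pred : ∀ n → 1 ≤ ⌊log₂ n ⌋ → 2 ^ ⌊log₂ n ⌋ ≡ 2 * 2 ^ (⌊log₂ n ⌋ ∸ 1)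
  double-pred n 1≤ with ⌊log₂ n ⌋
  ... | suc m = refl
  go : ∀ n → (∀ {m} → m < n → 1 ≤ m → 2 ^ ⌊log₂ m ⌋ ≤ m) → 1 ≤ n → 2 ^ ⌊log₂ n ⌋ ≤ n
  go 1 rec _ = ≤-refl
  go n@(suc (suc m)) rec _ = begin
    2 ^ ⌊log₂ n ⌋             ≡⟨ double-pred n (≤-trans (≤-reflexive (sym (⌊log₂[2^n]⌋≡n 1))) (⌊log₂⌋-mono-≤ {2} {n} (s≤s (s≤s z≤n)))) ⟩
    2 * 2 ^ (⌊log₂ n ⌋ ∸ 1)   ≡⟨ cong (λ l → 2 * 2 ^ l) (⌊log₂⌊n/2⌋⌋≡⌊log₂n⌋∸1 n) ⟨
    2 * 2 ^ ⌊log₂ ⌊ n /2⌋ ⌋   ≤⟨ *-monoʳ-≤ 2 (rec (⌊n/2⌋<n (suc m)) (s≤s z≤n)) ⟩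
    2 * ⌊ n /2⌋               ≤⟨ twice-half n ⟩
    n ∎

n<2^n : ∀ n → suc n ≤ 2 ^ n
n<2^n zero    = ≤-refl
n<2^n (suc n) = begin
  suc (suc n)       ≤⟨ s≤s (n<2^n n) ⟩
  1 + 2 ^ n         ≤⟨ +-monoˡ-≤ (2 ^ n) (m^n>0 2 n) ⟩
  2 ^ n + 2 ^ n     ≡⟨ cong (2 ^ n +_) (+-identityʳ (2 ^ n)) ⟨
  2 ^ suc n         ∎
  where open ≤-Reasoning

square≤2^ : ∀ j → (4 + j) * (4 + j) ≤ 2 ^ (4 + j)
square≤2^ zero    = ≤-refl
square≤2^ (suc j) = begin
  (4 + suc j) * (4 + suc j)             ≤⟨ m≤m+n _ (7 + 6 * j + j * j) ⟩
  (4 + suc j) * (4 + suc j) + (7 + 6 * j + j * j) ≡⟨ lemma j ⟩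
  2 * ((4 + j) * (4 + j))               ≤⟨ *-monoʳ-≤ 2 (square≤2^ j) ⟩
  2 ^ (4 + suc j)                       ∎
  where
  open ≤-Reasoning
  lemma : ∀ j → (4 + suc j) * (4 + suc j) + (7 + 6 * j + j * j) ≡ 2 * ((4 + j) * (4 + j))
  lemma = solve-∀

^-distribʳ-* : ∀ t m n → (m * n) ^ t ≡ m ^ t * n ^ t
^-distribʳ-* zero    m n = refl
^-distribʳ-* (suc t) m n = trans (cong (m * n *_) (^-distribʳ-* t m n)) (lemma m n (m ^ t) (n ^ t))
  where
  lemma : ∀ m n p q → m * n * (p * q) ≡ m * p * (n * q)
  lemma = solve-∀

depth-bound : (ops : List VectorOp) →
  ∃ λ D → ∀ f n B s → Circuit.depth (VectorOp.circuit (List.lookup ops f) n B s) ≤ D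
depth-bound []        = 0 , λ ()
depth-bound (o ∷ ops) =
  let d , ok = VectorOp.constantDepth o
      D , oks = depth-bound ops
  in d + D , λ { zero n B s → ≤-trans (ok n B s) (m≤m+n d D)
               ; (suc f) n B s → ≤-trans (oks f n B s) (m≤n+m D d) }

module _ (k D s : ℕ) (large : 2 ^ (17 * suc k) ≤ s) where

  -- The factor `suc k` in `τ` makes `2 ^ τ` larger than `s ^ k` by a spare `2 ^ suc ℓ`, which has
  -- to absorb the loss of a layer. Since `rate (8 * τ) ≤ 2 * (17 * τ)`, this asks for
  -- `17 * τ ≤ 2 ^ suc ℓ`; with `17 * suc k ≤ ℓ` it follows from the square of `suc ℓ` being at most
  -- `2 ^ suc ℓ`.
  ℓ λ′ τ : ℕ
  ℓ  = ⌊log₂ s ⌋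
  λ′ = ⌊log₂ ℓ ⌋
  τ  = suc k * suc ℓ

  open ≤-Reasoning

  17k≤ℓ : 17 * suc k ≤ ℓ
  17k≤ℓ = ≤-trans (≤-reflexive (sym (⌊log₂[2^n]⌋≡n _))) (⌊log₂⌋-mono-≤ large)

  17≤ℓ : 17 ≤ ℓ
  17≤ℓ = ≤-trans (m≤m*n 17 (suc k)) 17k≤ℓ

  1≤λ : 1 ≤ λ′
  1≤λ = ≤-trans (≤-reflexive (sym (⌊log₂[2^n]⌋≡n 1))) (⌊log₂⌋-mono-≤ (≤-trans (m≤m+n 2 15) 17≤ℓ))

  instance
    λ-nonZero : NonZero λ′
    λ-nonZero = >-nonZero 1≤λ

  1≤s : 1 ≤ s
  1≤s = ≤-trans (m^n>0 2 (17 * suc k)) large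

  17τ≤2^[1+ℓ] : 17 * τ ≤ 2 ^ suc ℓ
  17τ≤2^[1+ℓ] = begin
    17 * (suc k * suc ℓ)        ≡⟨ *-assoc 17 (suc k) (suc ℓ) ⟨
    17 * suc k * suc ℓ          ≤⟨ *-monoˡ-≤ (suc ℓ) (m≤n⇒m≤1+n 17k≤ℓ) ⟩
    suc ℓ * suc ℓ               ≡⟨ cong (λ m → m * m) shift ⟨
    (4 + j) * (4 + j)           ≤⟨ square≤2^ j ⟩
    2 ^ (4 + j)                 ≡⟨ cong (2 ^_) shift ⟩
    2 ^ suc ℓ                   ∎
    where
    j = suc ℓ ∸ 4
    shift : 4 + j ≡ suc ℓ
    shift = m+[n∸m]≡n (≤-trans (m≤m+n 4 14) (s≤s 17≤ℓ))

  rate≤34τ : rate (8 * τ) ≤ 34 * τ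
  rate≤34τ = begin
    2 * (2 * (8 * τ) + 1)   ≤⟨ *-monoʳ-≤ 2 (+-monoʳ-≤ (2 * (8 * τ)) (s≤s (z≤n {ℓ + k * suc ℓ}))) ⟩
    2 * (2 * (8 * τ) + τ)   ≡⟨ lemma τ ⟩
    34 * τ                  ∎
    where
    lemma : ∀ t → 2 * (2 * (8 * t) + t) ≡ 34 * t
    lemma = solve-∀

  small : rate (8 * τ) * s ^ k ≤ 2 ^ suc τ
  small = begin
    rate (8 * τ) * s ^ k                    ≤⟨ *-mono-≤ rate≤34τ (^-monoˡ-≤ k (<⇒≤ (n<2^[1+log] s))) ⟩
    34 * τ * (2 ^ suc ℓ) ^ k                ≡⟨ cong₂ _*_ (*-assoc 2 17 τ) (^-*-assoc 2 (suc ℓ) k) ⟩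
    2 * (17 * τ) * 2 ^ (suc ℓ * k)          ≤⟨ *-monoˡ-≤ (2 ^ (suc ℓ * k)) (*-monoʳ-≤ 2 17τ≤2^[1+ℓ]) ⟩
    2 ^ suc (suc ℓ) * 2 ^ (suc ℓ * k)       ≡⟨ ^-distribˡ-+-* 2 (suc (suc ℓ)) (suc ℓ * k) ⟨
    2 ^ (suc (suc ℓ) + suc ℓ * k)           ≡⟨ cong (λ e → 2 ^ suc (suc ℓ + e)) (*-comm (suc ℓ) k) ⟩
    2 ^ suc τ                               ∎

  -- Every quantity is measured in powers of `2 ^ λ′`, roughly `log s`. The summands are the
  -- exponents for the factor 2, for `τ`, and for `rate` raised to `suc D`; `k + 8` is `k + 2` for
  -- `τ` plus 6 for the constant 34.
  c : ℕ
  c = 1 + (k + 2) + (k + 8) * suc D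

  raise : ∀ {a e} → a ≤ 2 ^ e → a ≤ 2 ^ (e * λ′)
  raise {e = e} a≤ = ≤-trans a≤ (^-monoʳ-≤ 2 (m≤m*n e λ′))

  τ≤ : τ ≤ 2 ^ ((k + 2) * λ′)
  τ≤ = begin
    suc k * suc ℓ                     ≤⟨ *-mono-≤ (raise {suc k} {k} (n<2^n k)) (n<2^[1+log] ℓ) ⟩
    2 ^ (k * λ′) * 2 ^ (1 + λ′)       ≤⟨ *-monoʳ-≤ (2 ^ (k * λ′)) (^-monoʳ-≤ 2 (+-monoˡ-≤ λ′ 1≤λ)) ⟩
    2 ^ (k * λ′) * 2 ^ (λ′ + λ′)      ≡⟨ ^-distribˡ-+-* 2 (k * λ′) (λ′ + λ′) ⟨
    2 ^ (k * λ′ + (λ′ + λ′))          ≡⟨ cong (2 ^_) (lemma k λ′) ⟩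
    2 ^ ((k + 2) * λ′)                ∎
    where
    lemma : ∀ k l → k * l + (l + l) ≡ (k + 2) * l
    lemma = solve-∀

  rate≤ : rate (8 * τ) ≤ 2 ^ ((k + 8) * λ′)
  rate≤ = begin
    rate (8 * τ)                          ≤⟨ rate≤34τ ⟩
    34 * τ                                ≤⟨ *-mono-≤ (raise {34} {6} (m≤m+n 34 30)) τ≤ ⟩
    2 ^ (6 * λ′) * 2 ^ ((k + 2) * λ′)     ≡⟨ ^-distribˡ-+-* 2 (6 * λ′) ((k + 2) * λ′) ⟨
    2 ^ (6 * λ′ + (k + 2) * λ′)           ≡⟨ cong (2 ^_) (lemma k λ′) ⟩
    2 ^ ((k + 8) * λ′)                    ∎
    where
    lemma : ∀ k l → 6 * l + (k + 2) * l ≡ (k + 8) * l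
    lemma = solve-∀

  base≤ : τ * (2 * rate (8 * τ) ^ suc D) ≤ 2 ^ (c * λ′)
  base≤ = begin
    τ * (2 * rate (8 * τ) ^ suc D)                  ≤⟨ *-mono-≤ τ≤ (*-mono-≤ (raise {2} {1} ≤-refl) (^-monoˡ-≤ (suc D) rate≤)) ⟩
    2 ^ ((k + 2) * λ′) * (2 ^ (1 * λ′) * (2 ^ ((k + 8) * λ′)) ^ suc D)
      ≡⟨ cong (λ x → 2 ^ ((k + 2) * λ′) * (2 ^ (1 * λ′) * x)) (^-*-assoc 2 ((k + 8) * λ′) (suc D)) ⟩
    2 ^ ((k + 2) * λ′) * (2 ^ (1 * λ′) * 2 ^ ((k + 8) * λ′ * suc D))
      ≡⟨ cong (2 ^ ((k + 2) * λ′) *_) (^-distribˡ-+-* 2 (1 * λ′) _) ⟨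
    2 ^ ((k + 2) * λ′) * 2 ^ (1 * λ′ + (k + 8) * λ′ * suc D)
      ≡⟨ ^-distribˡ-+-* 2 ((k + 2) * λ′) _ ⟨
    2 ^ ((k + 2) * λ′ + (1 * λ′ + (k + 8) * λ′ * suc D))
      ≡⟨ cong (2 ^_) (lemma k D λ′) ⟩
    2 ^ (c * λ′) ∎
    where
    lemma : ∀ k d l → (k + 2) * l + (1 * l + (k + 8) * l * suc d) ≡ (1 + (k + 2) + (k + 8) * suc d) * l
    lemma = solve-∀

  log-bound : ∀ T → s ≤ τ * (2 * rate (8 * τ) ^ suc D) ^ T → ℓ ≤ c * (T * λ′)
  -- Zero steps would give `s ≤ τ`, hence `17 * τ ≤ 2 ^ suc ℓ ≤ 2 * s ≤ 2 * τ`.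
  log-bound zero s≤ = contradiction (≤-trans 17τ≤2^[1+ℓ] (*-monoʳ-≤ 2 (≤-trans (2^log≤n s 1≤s) (≤-trans s≤ (≤-reflexive (*-identityʳ τ))))))
    (<⇒≱ (*-monoˡ-< τ {2} {17} (m≤m+n 3 14)))
  log-bound T@(suc T-1) s≤ = 2^-cancel (begin
    2 ^ ℓ                       ≤⟨ 2^log≤n s 1≤s ⟩
    s                           ≤⟨ s≤ ⟩
    -- As `T` is positive, the lone factor `τ` can be raised to the power `T` as well.
    τ * b ^ T                   ≤⟨ *-monoˡ-≤ (b ^ T) (≤-trans (≤-reflexive (sym (^-identityʳ τ))) (^-monoʳ-≤ τ {1} {T} (s≤s z≤n))) ⟩
    τ ^ T * b ^ T               ≡⟨ ^-distribʳ-* T τ b ⟨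
    (τ * b) ^ T                 ≤⟨ ^-monoˡ-≤ T base≤ ⟩
    (2 ^ (c * λ′)) ^ T          ≡⟨ ^-*-assoc 2 (c * λ′) T ⟩
    2 ^ (c * λ′ * T)            ≡⟨ cong (2 ^_) (lemma c λ′ T) ⟩
    2 ^ (c * (T * λ′))          ∎)
    where
    b = 2 * rate (8 * τ) ^ suc D
    lemma : ∀ c l t → c * l * t ≡ c * (t * l)
    lemma = solve-∀
    2^-cancel : ∀ {m n} → 2 ^ m ≤ 2 ^ n → m ≤ n
    2^-cancel {m} {n} le = ≤-trans (≤-reflexive (sym (⌊log₂[2^n]⌋≡n m))) (≤-trans (⌊log₂⌋-mono-≤ le) (≤-reflexive (⌊log₂[2^n]⌋≡n n)))

matmul-steps : ∀ κ P → Avoids MMU P → ∀ k → ∃₂ λ c s₀ →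
  ∀ s n B T → 2 ≤ s → s₀ ≤ s → 1 ≤ n → 1 ≤ B →
  (∀ (X : Matrix (Word B) n s) (Y : Matrix (Word B) s s) →
     ∃₂ λ t w → t ≤ T × w ≤ s ^ k × MultipliesIn κ P s X Y t w) →
  ⌊log₂ s ⌋ ≤ c * (T * ⌊log₂ ⌊log₂ s ⌋ ⌋)
matmul-steps κ P avoids k =
  let D , depth≤D = depth-bound (ops P)
  in 1 + (k + 2) + (k + 8) * suc D , 2 ^ (17 * suc k) , λ s n B T 2≤s s₀≤s 1≤n 1≤B runs →
     log-bound k D s s₀≤s T
       -- The successor of this `t` computes to `suc k * suc ⌊log₂ s ⌋`, which is `τ`.
       (LowerBound.lower-bound s n B κ P avoids (⌊log₂ s ⌋ + k * suc ⌊log₂ s ⌋) D k T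
          (≤-trans (n≤1+n 1) 2≤s) 1≤n 1≤B (λ f m → depth≤D f m B s) (small k D s s₀≤s) runs)

-- Matrix multiplication by one MMU instruction

matrix-ext : ∀ {A : Set} {m n} {X Y : Matrix A m n} → (∀ i j → entry X i j ≡ entry Y i j) → X ≡ Y
matrix-ext eq = lookup-ext λ i → lookup-ext (eq i)

module _ {A : Set} (M : ℕ → A) where

  readMatrix-writeMatrix : ∀ {m n} a (X : Matrix A m n) → readMatrix (writeMatrix M a X) a m n ≡ X
  readMatrix-writeMatrix {m} {n} a X = matrix-ext λ i j →
    trans (lookup-readMatrix (writeMatrix M a X) a m n i j)
      (trans (write-at M a (concat X) (combine i j)) (lookup-concat X i j))

  readMatrix-++ˡ : ∀ {m n k} (X : Matrix A m n) (ys : Vec A k) →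
                   readMatrix (write M 0 (concat X ++ ys)) 0 m n ≡ X
  readMatrix-++ˡ {m} {n} {k} X ys = matrix-ext λ i j → begin
    entry (readMatrix M′ 0 m n) i j              ≡⟨ lookup-readMatrix M′ 0 m n i j ⟩
    M′ (toℕ (combine i j))                       ≡⟨ cong M′ (Fin.toℕ-↑ˡ (combine i j) k) ⟨
    M′ (toℕ (combine i j ↑ˡ k))                  ≡⟨ write-at M 0 (concat X ++ ys) (combine i j ↑ˡ k) ⟩
    lookup (concat X ++ ys) (combine i j ↑ˡ k)   ≡⟨ lookup-++ˡ (concat X) ys (combine i j) ⟩
    lookup (concat X) (combine i j)              ≡⟨ lookup-concat X i j ⟩
    entry X i j                                  ∎
    where
    open ≡-Reasoning
    M′ = write M 0 (concat X ++ ys)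

  readMatrix-++ʳ : ∀ {m n k} (xs : Vec A k) (Y : Matrix A m n) →
                   readMatrix (write M 0 (xs ++ concat Y)) k m n ≡ Y
  readMatrix-++ʳ {m} {n} {k} xs Y = matrix-ext λ i j → begin
    entry (readMatrix M′ k m n) i j              ≡⟨ lookup-readMatrix M′ k m n i j ⟩
    M′ (k + toℕ (combine i j))                   ≡⟨ cong M′ (Fin.toℕ-↑ʳ k (combine i j)) ⟨
    M′ (toℕ (k ↑ʳ combine i j))                  ≡⟨ write-at M 0 (xs ++ concat Y) (k ↑ʳ combine i j) ⟩
    lookup (xs ++ concat Y) (k ↑ʳ combine i j)   ≡⟨ lookup-++ʳ xs (concat Y) (combine i j) ⟩
    lookup (concat Y) (combine i j)              ≡⟨ lookup-concat Y i j ⟩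
    entry Y i j                                  ∎
    where
    open ≡-Reasoning
    M′ = write M 0 (xs ++ concat Y)

-- `start` puts `n` into register 0, the addresses of the two factors into 3 and 4, and that of the
-- result into 5.
matmul-algorithm : Algorithm
matmul-algorithm = record { ops = [] ; code = λ _ → matmul 5 3 4 0 ∷ [] }

matmul-one-step : ∀ κ s n B (X : Matrix (Word B) n s) (Y : Matrix (Word B) s s) →
                  ∃ λ w → MultipliesIn κ matmul-algorithm s X Y 1 w
matmul-one-step κ s n B X Y = _ , _ , step refl (halt refl) ,
  trans (readMatrix-writeMatrix M (n * s + s * s) (readMatrix M 0 n s ⊗ readMatrix M (n * s) s s))
    (cong₂ _⊗_ (readMatrix-++ˡ (λ _ → fromℤ B 0ℤ) X (concat Y)) (readMatrix-++ʳ (λ _ → fromℤ B 0ℤ) (concat X) Y))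
  where
  M : Memory B
  M = write (λ _ → fromℤ B 0ℤ) 0 (concat X ++ concat Y)

-- Linearity of the MMU

module _ {B : ℕ} where

  mod-sym : ∀ {x y} → x ≡ y [2^ B ] → y ≡ x [2^ B ]
  mod-sym x≡y = fromℤ-injective B (sym (fromℤ-cong B x≡y))

  mod-trans : ∀ {x y z} → x ≡ y [2^ B ] → y ≡ z [2^ B ] → x ≡ z [2^ B ]
  mod-trans x≡y y≡z = fromℤ-injective B (trans (fromℤ-cong B x≡y) (fromℤ-cong B y≡z))

  mod-reflexive : ∀ {x y} → x ≡ y → x ≡ y [2^ B ]
  mod-reflexive refl = mod-refl

  mod-*ˡ : ∀ c {x y} → x ≡ y [2^ B ] → c ℤ.* x ≡ c ℤ.* y [2^ B ]
  mod-*ˡ c {x} {y} (mk≡ q refl) = mk≡ (c ℤ.* q) (lemma c y (2^ B) q)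
    where
    lemma : ∀ c y b q → c ℤ.* (y ℤ.+ b ℤ.* q) ≡ c ℤ.* y ℤ.+ b ℤ.* (c ℤ.* q)
    lemma = ℤ.solve-∀

  mod-*ʳ : ∀ c {x y} → x ≡ y [2^ B ] → x ℤ.* c ≡ y ℤ.* c [2^ B ]
  mod-*ʳ c {x} {y} x≡y = subst₂ (λ u v → u ≡ v [2^ B ]) (ℤ.*-comm c x) (ℤ.*-comm c y) (mod-*ˡ c x≡y)

  fromℤ-mod : ∀ {w : Word B} {z} → ⟦ w ⟧ ≡ z [2^ B ] → w ≡ fromℤ B z
  fromℤ-mod {w} eq = trans (sym (fromℤ-⟦⟧ w)) (fromℤ-cong B eq)

  module _ (α β : ℤ) where

    -- A relation between three runs, for arbitrary fixed coefficients: the pair `1ℤ`, `1ℤ` yields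
    -- additivity and the pair `⟦ a ⟧`, `0ℤ` homogeneity. A call preserves it because its other
    -- factor is the same in all three runs, and wrapping to `B` bits is harmless because it is a
    -- congruence.
    Combination : Word B → Word B → Word B → Set
    Combination x y z = ⟦ z ⟧ ≡ α ℤ.* ⟦ x ⟧ ℤ.+ β ℤ.* ⟦ y ⟧ [2^ B ]

    CombinationMem : Memory B → Memory B → Memory B → Set
    CombinationMem L M N = ∀ q → Combination (L q) (M q) (N q)

    CombinationMat : ∀ {m n} → Matrix (Word B) m n → Matrix (Word B) m n → Matrix (Word B) m n → Set
    CombinationMat X Y Z = ∀ i j → Combination (entry X i j) (entry Y i j) (entry Z i j)

    write-combination : ∀ {n} L M N a (x y z : Vec (Word B) n) → CombinationMem L M N →
      (∀ i → Combination (lookup x i) (lookup y i) (lookup z i)) →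
      CombinationMem (write L a x) (write M a y) (write N a z)
    write-combination {n} L M N a x y z LMN xyz q with write-source {Word B} a n q
    ... | inj₁ old rewrite old L x | old M y | old N z = LMN q
    ... | inj₂ (i , _ , new) rewrite new L x | new M y | new N z = xyz i

    writeMatrix-combination : ∀ {m n} L M N a (X Y Z : Matrix (Word B) m n) → CombinationMem L M N →
      CombinationMat X Y Z → CombinationMem (writeMatrix L a X) (writeMatrix M a Y) (writeMatrix N a Z)
    writeMatrix-combination {m} {n} L M N a X Y Z LMN XYZ = write-combination L M N a (concat X) (concat Y) (concat Z) LMN λ k →
      subst (λ k → Combination (lookup (concat X) k) (lookup (concat Y) k) (lookup (concat Z) k))
        (Fin.combine-remQuot {m} n k) (cell (proj₁ (remQuot {m} n k)) (proj₂ (remQuot {m} n k)))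
      where
      cell : ∀ i j → Combination (lookup (concat X) (combine i j)) (lookup (concat Y) (combine i j)) (lookup (concat Z) (combine i j))
      cell i j rewrite lookup-concat X i j | lookup-concat Y i j | lookup-concat Z i j = XYZ i j

    readMatrix-combination : ∀ L M N a m n → CombinationMem L M N →
      CombinationMat (readMatrix L a m n) (readMatrix M a m n) (readMatrix N a m n)
    readMatrix-combination L M N a m n LMN i j
      rewrite lookup-readMatrix L a m n i j | lookup-readMatrix M a m n i j | lookup-readMatrix N a m n i j =
      LMN (a + toℕ (combine i j))

    sum-combination : ∀ {n} (f g : Fin n → ℤ) → sum (λ k → α ℤ.* f k ℤ.+ β ℤ.* g k) ≡ α ℤ.* sum f ℤ.+ β ℤ.* sum g
    sum-combination {zero}  f g = sym (trans (cong₂ ℤ._+_ (ℤ.*-zeroʳ α) (ℤ.*-zeroʳ β)) refl)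
    sum-combination {suc n} f g = trans (cong (λ z → α ℤ.* f zero ℤ.+ β ℤ.* g zero ℤ.+ z) (sum-combination (f ∘ suc) (g ∘ suc)))
      (lemma α β (f zero) (g zero) (sum (f ∘ suc)) (sum (g ∘ suc)))
      where
      lemma : ∀ a b f g s t → a ℤ.* f ℤ.+ b ℤ.* g ℤ.+ (a ℤ.* s ℤ.+ b ℤ.* t) ≡ a ℤ.* (f ℤ.+ s) ℤ.+ b ℤ.* (g ℤ.+ t)
      lemma = ℤ.solve-∀

    inner-combination : ∀ {n} {f g h : Fin n → ℤ} → (∀ k → h k ≡ α ℤ.* f k ℤ.+ β ℤ.* g k [2^ B ]) →
      Combination (fromℤ B (sum f)) (fromℤ B (sum g)) (fromℤ B (sum h))
    inner-combination {f = f} {g} {h} eq =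
      mod-trans (⟦fromℤ⟧ (sum h)) (mod-trans (mod-sum eq) (mod-trans (mod-reflexive (sum-combination f g))
        (mod-+ (mod-*ˡ α (mod-sym (⟦fromℤ⟧ (sum f)))) (mod-*ˡ β (mod-sym (⟦fromℤ⟧ (sum g)))))))

    ⊗-combinationˡ : ∀ {m n l} (X Y Z : Matrix (Word B) m n) (W : Matrix (Word B) n l) →
      CombinationMat X Y Z → CombinationMat (X ⊗ W) (Y ⊗ W) (Z ⊗ W)
    ⊗-combinationˡ X Y Z W XYZ i j rewrite entry-⊗ X W i j | entry-⊗ Y W i j | entry-⊗ Z W i j =
      inner-combination λ k → mod-trans (mod-*ʳ ⟦ entry W k j ⟧ (XYZ i k))
        (mod-reflexive (lemma α β ⟦ entry X i k ⟧ ⟦ entry Y i k ⟧ ⟦ entry W k j ⟧))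
      where
      lemma : ∀ a b x y w → (a ℤ.* x ℤ.+ b ℤ.* y) ℤ.* w ≡ a ℤ.* (x ℤ.* w) ℤ.+ b ℤ.* (y ℤ.* w)
      lemma = ℤ.solve-∀

    ⊗-combinationʳ : ∀ {m n l} (W : Matrix (Word B) m n) (X Y Z : Matrix (Word B) n l) →
      CombinationMat X Y Z → CombinationMat (W ⊗ X) (W ⊗ Y) (W ⊗ Z)
    ⊗-combinationʳ W X Y Z XYZ i j rewrite entry-⊗ W X i j | entry-⊗ W Y i j | entry-⊗ W Z i j =
      inner-combination λ k → mod-trans (mod-*ˡ ⟦ entry W i k ⟧ (XYZ k j))
        (mod-reflexive (lemma α β ⟦ entry X k j ⟧ ⟦ entry Y k j ⟧ ⟦ entry W i k ⟧))
      where
      lemma : ∀ a b x y w → w ℤ.* (a ℤ.* x ℤ.+ b ℤ.* y) ≡ a ℤ.* (w ℤ.* x) ℤ.+ b ℤ.* (w ℤ.* y)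
      lemma = ℤ.solve-∀

    calls-combination : ∀ {s N} L M O (cs : List (Call B s N)) → CombinationMem L M O →
      CombinationMem (List.foldl call L cs) (List.foldl call M cs) (List.foldl call O cs)
    calls-combination L M O [] LMO = LMO
    calls-combination {s} L M O (c@(right {k} src dst _ _ Y) ∷ cs) LMO =
      calls-combination (call L c) (call M c) (call O c) cs
        (writeMatrix-combination L M O dst (r L ⊗ Y) (r M ⊗ Y) (r O ⊗ Y) LMO
          (⊗-combinationˡ (r L) (r M) (r O) Y (readMatrix-combination L M O src k s LMO)))
      where
      r : Memory B → Matrix (Word B) k s
      r L = readMatrix L src k s
    calls-combination {s} L M O (c@(left src dst _ _ X) ∷ cs) LMO =
      calls-combination (call L c) (call M c) (call O c) cs
        (writeMatrix-combination L M O dst (X ⊗ r L) (X ⊗ r M) (X ⊗ r O) LMO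
          (⊗-combinationʳ X (r L) (r M) (r O) (readMatrix-combination L M O src s s LMO)))
      where
      r : Memory B → Matrix (Word B) s s
      r L = readMatrix L src s s

    -- On constant input vectors the first cell of the result is the value of `f`. The zeros behind
    -- the input satisfy the relation as well.
    implements-combination : ∀ {s n} {f : Word B → Word B} (cs : List (Call B s n)) → Implements cs (Vec.map f) →
      1 ≤ n → ∀ {x y z} → Combination x y z → Combination (f x) (f y) (f z)
    implements-combination {s} {n} {f} cs implements 1≤n {x} {y} {z} xyz =
      subst₂ (λ u v → Combination u v (f z)) (first x) (first y)
        (subst (Combination (out x) (out y)) (first z) (calls-combination (initial x) (initial y) (initial z) cs
          (write-combination zeroes zeroes zeroes 0 (replicate n x) (replicate n y) (replicate n z) (λ _ → zeros) (λ i → subst₂ (λ u v → Combination u v (lookup (replicate n z) i))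
            (sym (lookup-replicate i x)) (sym (lookup-replicate i y))
            (subst (Combination x y) (sym (lookup-replicate i z)) xyz))) (toℕ i₀)))
      where
      i₀ = fromℕ< 1≤n
      zeroes : Memory B
      zeroes _ = fromℤ B 0ℤ
      initial : Word B → Memory B
      initial w = write zeroes 0 (replicate n w)
      out : Word B → Word B
      out w = List.foldl call (initial w) cs (toℕ i₀)
      first : ∀ w → out w ≡ f w
      first w = trans (sym (lookup∘tabulate _ i₀)) (trans (cong (λ v → lookup v i₀) (implements (replicate n w)))
        (trans (lookup-map i₀ f (replicate n w)) (cong f (lookup-replicate i₀ w))))
      zero-combination : 0ℤ ≡ α ℤ.* 0ℤ ℤ.+ β ℤ.* 0ℤ
      zero-combination = sym (trans (cong₂ ℤ._+_ (ℤ.*-zeroʳ α) (ℤ.*-zeroʳ β)) refl)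
      zeros : Combination (fromℤ B 0ℤ) (fromℤ B 0ℤ) (fromℤ B 0ℤ)
      zeros = mod-trans (⟦fromℤ⟧ 0ℤ) (mod-trans (mod-reflexive zero-combination)
        (mod-+ (mod-*ˡ α (mod-sym (⟦fromℤ⟧ 0ℤ))) (mod-*ˡ β (mod-sym (⟦fromℤ⟧ 0ℤ)))))

  implements⇒linear : ∀ {s n} {f : Word B → Word B} (cs : List (Call B s n)) → 1 ≤ n → Implements cs (Vec.map f) → Linear f
  implements⇒linear {f = f} cs 1≤n implements = additive , homogeneous
    where
    lemma₁ : ∀ x y → x ℤ.+ y ≡ 1ℤ ℤ.* x ℤ.+ 1ℤ ℤ.* y
    lemma₁ = ℤ.solve-∀
    lemma₂ : ∀ a x → a ℤ.* x ≡ a ℤ.* x ℤ.+ 0ℤ ℤ.* x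
    lemma₂ = ℤ.solve-∀
    additive : ∀ x y → f (x +ʷ y) ≡ f x +ʷ f y
    additive x y = trans
      (fromℤ-mod (implements-combination 1ℤ 1ℤ cs implements 1≤n {x} {y} {x +ʷ y}
        (mod-trans (⟦fromℤ⟧ (⟦ x ⟧ ℤ.+ ⟦ y ⟧)) (mod-reflexive (lemma₁ ⟦ x ⟧ ⟦ y ⟧)))))
      (cong (fromℤ B) (sym (lemma₁ ⟦ f x ⟧ ⟦ f y ⟧)))
    homogeneous : ∀ a x → f (a *ʷ x) ≡ a *ʷ f x
    homogeneous a x = trans
      (fromℤ-mod (implements-combination ⟦ a ⟧ 0ℤ cs implements 1≤n {x} {x} {a *ʷ x}
        (mod-trans (⟦fromℤ⟧ (⟦ a ⟧ ℤ.* ⟦ x ⟧)) (mod-reflexive (lemma₂ ⟦ a ⟧ ⟦ x ⟧)))))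
      (cong (fromℤ B) (sym (lemma₂ ⟦ a ⟧ ⟦ f x ⟧)))

⟦zero⟧ : ∀ B → ⟦ fromℤ B 0ℤ ⟧ ≡ 0ℤ
⟦zero⟧ zero          = refl
⟦zero⟧ (suc zero)    = refl
⟦zero⟧ (suc (suc B)) = cong (λ z → 0ℤ ℤ.+ (ℤ.+ 2) ℤ.* z) (⟦zero⟧ (suc B))

-- The sum of 1 and -1 is sent to 0, while their images add up to 1. The value 1 needs two bits; on
-- one-bit words `relu` is constantly zero.
relu-nonlinear : ∀ B → 2 ≤ B → ¬ Linear (relu {B})
relu-nonlinear (suc zero) (s≤s ())
relu-nonlinear (suc (suc B)) _ (additive , _) = contradiction (cong (λ w → lookup w zero) (begin
  fromℤ (2 + B) 0ℤ                  ≡⟨ cong (λ z → fromℤ (2 + B) (z ℤ.⊔ 0ℤ)) (⟦zero⟧ (2 + B)) ⟨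
  relu (fromℤ (2 + B) 0ℤ)           ≡⟨ cong relu (cong (fromℤ (2 + B)) (cong₂ ℤ._+_ ⟦one⟧ (⟦ones⟧ (suc B)))) ⟨
  relu (one +ʷ minus-one)           ≡⟨ additive one minus-one ⟩
  relu one +ʷ relu minus-one        ≡⟨ cong₂ (λ y z → fromℤ (2 + B) (y ℤ.⊔ 0ℤ) +ʷ fromℤ (2 + B) (z ℤ.⊔ 0ℤ)) ⟦one⟧ (⟦ones⟧ (suc B)) ⟩
  one +ʷ fromℤ (2 + B) 0ℤ           ≡⟨ cong (fromℤ (2 + B)) (cong₂ ℤ._+_ ⟦one⟧ (⟦zero⟧ (2 + B))) ⟩
  one                               ∎)) (λ ())
  where
  open ≡-Reasoning
  one minus-one : Word (2 + B)
  one = fromℤ (2 + B) 1ℤ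
  minus-one = replicate (2 + B) true
  ⟦one⟧ : ⟦ one ⟧ ≡ 1ℤ
  ⟦one⟧ = cong (λ z → 1ℤ ℤ.+ (ℤ.+ 2) ℤ.* z) (⟦zero⟧ (suc B))

-- Data dependencies of MMU calls

Monotone : (ℕ → ℕ) → Set
Monotone f = ∀ {p q} → p ≤ q → f p ≤ f q

-- The identity for cells that are not overwritten, `2 * s` shifts for a right multiplication,
-- `s * s` constants for a left one.
fan : ℕ → ℕ
fan s = 1 + 2 * s + s * s

-- Cell p depends on the cells f p only; each f is a shift or a constant, hence
-- monotone.
call-dependencies : ∀ {B s N} (c : Call B s N) → ∃ λ fs → All Monotone fs × length fs ≤ fan s ×
  (∀ (M M′ : Memory B) p → All (λ f → M (f p) ≡ M′ (f p)) fs → call M c p ≡ call M′ c p)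
call-dependencies {B} {s} c@(right {k} src dst _ _ Y) = id ∷ shifts , id ∷ monotone , bound , ok
  where
  -- Column `j` of the result reads column `l` of the same source row, an offset between `- s` and
  -- `s`. It is encoded as `e = l + (s ∸ j)`, with `s` subtracted again at the end; truncated
  -- subtraction keeps the map monotone on all of ℕ.
  shift : ℕ → ℕ → ℕ
  shift e q = (q + src + e) ∸ (dst + s)
  shifts = List.applyUpTo shift (2 * s)
  monotone : All Monotone shifts
  monotone = All.applyUpTo⁺₁ shift (2 * s) λ {e} _ p≤q → ∸-monoˡ-≤ (dst + s) (+-monoˡ-≤ e (+-monoˡ-≤ src p≤q))
  bound : suc (length shifts) ≤ fan s
  bound = ≤-trans (≤-reflexive (cong suc (List.length-applyUpTo shift (2 * s)))) (m≤m+n (1 + 2 * s) (s * s))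
  source : ∀ (i : Fin k) (j l : Fin s) → ∃ λ e → e < 2 * s × shift e (dst + toℕ (combine i j)) ≡ src + toℕ (combine i l)
  source i j l = toℕ l + d , e< , (begin
    (dst + toℕ (combine i j) + src + (toℕ l + d)) ∸ (dst + s) ≡⟨ cong (λ z → (dst + z + src + (toℕ l + d)) ∸ (dst + s)) (Fin.toℕ-combine i j) ⟩
    (dst + (s * toℕ i + toℕ j) + src + (toℕ l + d)) ∸ (dst + s) ≡⟨ cong (_∸ (dst + s)) (lemma dst src (s * toℕ i) (toℕ j) (toℕ l) d) ⟩
    (src + (s * toℕ i + toℕ l) + (dst + (toℕ j + d))) ∸ (dst + s) ≡⟨ cong (λ z → (src + (s * toℕ i + toℕ l) + (dst + z)) ∸ (dst + s)) (m+[n∸m]≡n (<⇒≤ (Fin.toℕ<n j))) ⟩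
    (src + (s * toℕ i + toℕ l) + (dst + s)) ∸ (dst + s)       ≡⟨ m+n∸n≡m _ (dst + s) ⟩
    src + (s * toℕ i + toℕ l)                                 ≡⟨ cong (src +_) (Fin.toℕ-combine i l) ⟨
    src + toℕ (combine i l)                                   ∎)
    where
    open ≡-Reasoning
    d = s ∸ toℕ j
    e< : toℕ l + d < 2 * s
    e< = ≤-trans (+-mono-≤ (Fin.toℕ<n l) (m∸n≤m s (toℕ j))) (≤-reflexive (cong (s +_) (sym (+-identityʳ s))))
    lemma : ∀ d s i j l e → d + (i + j) + s + (l + e) ≡ s + (i + l) + (d + (j + e))
    lemma = solve-∀
  ok : ∀ M M′ p → All (λ f → M (f p) ≡ M′ (f p)) (id ∷ shifts) →
       call M c p ≡ call M′ c p
  ok M M′ p (same ∷ agree) with write-source {Word B} dst (k * s) p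
  ... | inj₁ old rewrite old M (concat (readMatrix M src k s ⊗ Y)) | old M′ (concat (readMatrix M′ src k s ⊗ Y)) = same
  ... | inj₂ (x , p≡ , new)
    rewrite new M (concat (readMatrix M src k s ⊗ Y)) | new M′ (concat (readMatrix M′ src k s ⊗ Y))
    with i , j ← remQuot {k} s x in eq = begin
      lookup (concat (readMatrix M src k s ⊗ Y)) x             ≡⟨ cell M ⟩
      fromℤ B (sum λ l → ⟦ M (src + toℕ (combine i l)) ⟧ ℤ.* ⟦ entry Y l j ⟧)
        ≡⟨ cong (fromℤ B) (sum-cong-≗ λ l → cong (λ w → ⟦ w ⟧ ℤ.* ⟦ entry Y l j ⟧) (agree-at l)) ⟩
      fromℤ B (sum λ l → ⟦ M′ (src + toℕ (combine i l)) ⟧ ℤ.* ⟦ entry Y l j ⟧) ≡⟨ cell M′ ⟨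
      lookup (concat (readMatrix M′ src k s ⊗ Y)) x            ∎
    where
    open ≡-Reasoning
    x≡ : x ≡ combine i j
    x≡ = trans (sym (Fin.combine-remQuot {k} s x)) (cong (λ z → combine (proj₁ z) (proj₂ z)) eq)
    cell : ∀ M → lookup (concat (readMatrix M src k s ⊗ Y)) x ≡ fromℤ B (sum λ l → ⟦ M (src + toℕ (combine i l)) ⟧ ℤ.* ⟦ entry Y l j ⟧)
    cell M = trans (cong (lookup (concat (readMatrix M src k s ⊗ Y))) x≡) (trans (lookup-concat (readMatrix M src k s ⊗ Y) i j)
      (trans (entry-⊗ (readMatrix M src k s) Y i j) (cong (fromℤ B) (sum-cong-≗ λ l →
        cong (λ w → ⟦ w ⟧ ℤ.* ⟦ entry Y l j ⟧) (lookup-readMatrix M src k s i l)))))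
    agree-at : ∀ l → M (src + toℕ (combine i l)) ≡ M′ (src + toℕ (combine i l))
    agree-at l with source i j l
    ... | e , e< , shift≡ = subst (λ q → M q ≡ M′ q) (trans (cong (shift e) (trans p≡ (cong (λ z → dst + toℕ z) x≡))) shift≡)
          (All.applyUpTo⁻ shift (2 * s) agree e<)
call-dependencies {B} {s} c@(left {k} src dst _ _ X) = id ∷ constants , id ∷ monotone , bound , ok
  where
  constants = List.applyUpTo (λ e _ → src + e) (s * s)
  monotone : All Monotone constants
  monotone = All.applyUpTo⁺₁ _ (s * s) λ _ _ → ≤-refl
  bound : suc (length constants) ≤ fan s
  bound = ≤-trans (≤-reflexive (cong suc (List.length-applyUpTo _ (s * s)))) (s≤s (m≤n+m (s * s) (2 * s)))
  ok : ∀ M M′ p → All (λ f → M (f p) ≡ M′ (f p)) (id ∷ constants) →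
       call M c p ≡ call M′ c p
  ok M M′ p (same ∷ agree) with write-source {Word B} dst (k * s) p
  ... | inj₁ old rewrite old M (concat (X ⊗ readMatrix M src s s)) | old M′ (concat (X ⊗ readMatrix M′ src s s)) = same
  ... | inj₂ (x , p≡ , new)
    rewrite new M (concat (X ⊗ readMatrix M src s s)) | new M′ (concat (X ⊗ readMatrix M′ src s s)) =
    cong (λ Z → lookup (concat (X ⊗ Z)) x) (matrix-ext {X = readMatrix M src s s} {readMatrix M′ src s s} λ i j →
      trans (lookup-readMatrix M src s s i j)
        (trans (All.applyUpTo⁻ (λ e _ → src + e) (s * s) agree (Fin.toℕ<n (combine i j)))
          (sym (lookup-readMatrix M′ src s s i j))))

-- Maps compose against the order of the calls: a cell `p` depends on cells `f p` just before `cs`,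
-- and these on `g (f p)` before `c`. Composition keeps maps monotone, and their number depends on
-- `s` and the number of calls, not on `N`.
dependencies : ∀ {B s N} (cs : List (Call B s N)) → ∃ λ fs → All Monotone fs × length fs ≤ fan s ^ length cs ×
  (∀ (M M′ : Memory B) p → All (λ f → M (f p) ≡ M′ (f p)) fs → List.foldl call M cs p ≡ List.foldl call M′ cs p)
dependencies [] = id ∷ [] , id ∷ [] , ≤-refl , λ { M M′ p (same ∷ []) → same }
dependencies {s = s} (c ∷ cs) =
  let fs , monotone-fs , bound-fs , ok-fs = dependencies cs
      gs , monotone-gs , bound-gs , ok-gs = call-dependencies c
      product = List.cartesianProductWith (λ g f → g ∘ f) gs fs
  in product ,
     All.cartesianProductWith⁺ (setoid _) (setoid _) (λ g f → g ∘ f) gs fs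
       (λ g∈ f∈ p≤q → All.lookup monotone-gs g∈ (All.lookup monotone-fs f∈ p≤q)) ,
     ≤-trans (≤-reflexive (length-product gs fs)) (*-mono-≤ bound-gs bound-fs) ,
     λ M M′ p agree → ok-fs (call M c) (call M′ c) p (All.tabulate λ {f} f∈ →
       ok-gs M M′ (f p) (All.tabulate λ {g} g∈ →
         All.lookup agree (∈-cartesianProductWith⁺ (λ g f → g ∘ f) g∈ f∈)))
  where
  length-product : ∀ (gs fs : List (ℕ → ℕ)) → length (List.cartesianProductWith (λ g f → g ∘ f) gs fs) ≡ length gs * length fs
  length-product []       fs = refl
  length-product (g ∷ gs) fs = trans (List.length-++ (List.map (λ f → g ∘ f) fs))
    (cong₂ _+_ (List.length-map (λ f → g ∘ f) fs) (length-product gs fs))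

module _ {B s n : ℕ} (cs : List (Call B s n)) (implements : Implements cs (permute (reverse {n}))) (1≤B : 1 ≤ B) where

  fs : List (ℕ → ℕ)
  fs = proj₁ (dependencies cs)

  -- Changing the input at the mirror image of `p` alone must change output cell `p`. If no map sent
  -- `p` to that position, both runs would agree at `p`.
  reversal-dependency : ∀ (p : Fin n) → Any (λ f → f (toℕ p) ≡ toℕ (opposite p)) fs
  reversal-dependency p with Any.any? (λ f → f (toℕ p) ≟ toℕ (opposite p)) fs
  ... | yes found = found
  ... | no none   = contradiction (begin
    false                                ≡⟨ lookup-replicate b₀ false ⟨
    lookup (replicate B false) b₀        ≡⟨ cong (λ w → lookup w b₀) (lookup-replicate v (replicate B false)) ⟨
    lookup (lookup x v) b₀               ≡⟨ cong (λ w → lookup w b₀) (output x) ⟨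
    lookup (List.foldl call (memory x) cs (toℕ p)) b₀ ≡⟨ cong (λ w → lookup w b₀)
        (proj₂ (proj₂ (proj₂ (dependencies cs))) (memory x) (memory y) (toℕ p)
          (All.map (λ f≢ → same _ f≢) (All.¬Any⇒All¬ fs none))) ⟩
    lookup (List.foldl call (memory y) cs (toℕ p)) b₀ ≡⟨ cong (λ w → lookup w b₀) (output y) ⟩
    lookup (lookup y v) b₀               ≡⟨ cong (λ w → lookup w b₀) (lookup∘update v x (replicate B true)) ⟩
    lookup (replicate B true) b₀         ≡⟨ lookup-replicate b₀ true ⟩
    true                                 ∎) (λ ())
    where
    open ≡-Reasoning
    b₀ = fromℕ< 1≤B
    v = opposite p
    x y : Vec (Word B) n
    x = replicate n (replicate B false)
    y = x [ v ]≔ replicate B true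
    memory : Vec (Word B) n → Memory B
    memory = write (λ _ → fromℤ B 0ℤ) 0
    same : ∀ q → q ≢ toℕ v → memory x q ≡ memory y q
    same q q≢v with write-source {Word B} 0 n q
    ... | inj₁ old = trans (old _ x) (sym (old _ y))
    ... | inj₂ (i , refl , new) = trans (new _ x) (trans (sym (lookup∘update′ (λ i≡v → q≢v (cong toℕ i≡v)) x _)) (sym (new _ y)))
    output : ∀ z → List.foldl call (memory z) cs (toℕ p) ≡ lookup z v
    output z = trans (sym (lookup∘tabulate _ p)) (trans (cong (λ u → lookup u p) (implements z)) (lookup∘tabulate _ p))

  source-index : Fin n → Fin (length fs)
  source-index p = Any.index (reversal-dependency p)

  source-index-spec : ∀ p → List.lookup fs (source-index p) (toℕ p) ≡ toℕ (opposite p)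
  source-index-spec p = Any.lookup-index (reversal-dependency p)

  source-index-< : ∀ {p q} → toℕ p < toℕ q → source-index p ≢ source-index q
  source-index-< {p} {q} p<q eq = <⇒≱ decreasing increasing
    where
    f = List.lookup fs (source-index p)
    increasing : toℕ (opposite p) ≤ toℕ (opposite q)
    increasing = subst₂ _≤_ (source-index-spec p)
      (trans (cong (λ i → List.lookup fs i (toℕ q)) eq) (source-index-spec q))
      (All.lookup (proj₁ (proj₂ (dependencies cs))) (∈-lookup (source-index p)) (<⇒≤ p<q))
    decreasing : toℕ (opposite q) < toℕ (opposite p)
    decreasing = subst₂ _<_ (sym (Fin.opposite-prop q)) (sym (Fin.opposite-prop p))
      (∸-monoʳ-< (s≤s p<q) (Fin.toℕ<n q))

  -- A monotone map meets the strictly decreasing reversal at most once.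
  source-index-injective : Injective _≡_ _≡_ source-index
  source-index-injective {p} {q} eq with Fin.<-cmp p q
  ... | tri< p<q _ _ = contradiction eq (source-index-< p<q)
  ... | tri≈ _ p≡q _ = p≡q
  ... | tri> _ _ q<p = contradiction (sym eq) (source-index-< q<p)

  reversal-few : n ≤ fan s ^ length cs
  reversal-few = ≤-trans (Fin.injective⇒≤ source-index-injective) (proj₁ (proj₂ (proj₂ (dependencies cs))))

-- Fewer than `s` calls would leave `n ≤ fan s ^ s`, so `n₀` is one more than that.
reversal-calls : ∀ s → 2 ≤ s → ∃ λ n₀ → ∀ n B → n₀ ≤ n → 1 ≤ B → (cs : List (Call B s n)) →
                 Implements cs (permute (reverse {n})) → s ≤ 1 * length cs
reversal-calls s _ = suc (fan s ^ s) , λ n B n₀≤n 1≤B cs implements →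
  ≤-trans (≮⇒≥ λ few → <⇒≱ n₀≤n (≤-trans (reversal-few cs implements 1≤B) (^-monoʳ-≤ (fan s) (<⇒≤ few))))
    (≤-reflexive (sym (*-identityˡ _)))

-- The reversal circuit and its uniformity

*-monus : ∀ n B q → q < n → (n ∸ suc q) * B + q * B + B ≡ n * B
*-monus n B q q<n = trans (lemma (n ∸ suc q) q B) (cong (_* B) (m∸n+n≡m q<n))
  where
  lemma : ∀ m q b → m * b + q * b + b ≡ (m + suc q) * b
  lemma = solve-∀

toℕ-combine′ : ∀ {n B} (i : Fin n) (b : Fin B) → toℕ (combine i b) ≡ toℕ i * B + toℕ b
toℕ-combine′ {B = B} i b = trans (Fin.toℕ-combine i b) (cong (_+ toℕ b) (*-comm B (toℕ i)))

combine-unique : ∀ {n B} (i : Fin n) (b : Fin B) {q r} → q < n → r < B → toℕ (combine i b) ≡ q * B + r →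
                 toℕ i ≡ q × toℕ b ≡ r
combine-unique i b {q} {r} q<n r<B eq = trans (cong toℕ i≡) (Fin.toℕ-fromℕ< q<n) , trans (cong toℕ b≡) (Fin.toℕ-fromℕ< r<B)
  where
  same : combine i b ≡ combine (fromℕ< q<n) (fromℕ< r<B)
  same = Fin.toℕ-injective (trans eq (sym (trans (toℕ-combine′ (fromℕ< q<n) (fromℕ< r<B))
    (cong₂ (λ x y → x * _ + y) (Fin.toℕ-fromℕ< q<n) (Fin.toℕ-fromℕ< r<B)))))
  i≡ = proj₁ (Fin.combine-injective i b (fromℕ< q<n) (fromℕ< r<B) same)
  b≡ = proj₂ (Fin.combine-injective i b (fromℕ< q<n) (fromℕ< r<B) same)

⊥⇔ : ∀ {A B : Set} → ¬ A → ¬ B → A ⇔ B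
⊥⇔ ¬a ¬b = mk⇔ (λ a → contradiction a ¬a) (λ b → contradiction b ¬b)

false′ : ∀ {v} → Formula v
false′ = lit 0 ≺ lit 0

module Reversal where

  rev : ∀ n B → Fin (n * B) → Fin (n * B)
  rev n B j = combine (opposite (proj₁ (remQuot {n} B j))) (proj₂ (remQuot {n} B j))

  rev-combine : ∀ {n B} (i : Fin n) (b : Fin B) → rev n B (combine i b) ≡ combine (opposite i) b
  rev-combine {n} {B} i b = cong (λ z → combine (opposite (proj₁ z)) (proj₂ z)) (Fin.remQuot-combine {n} {B} i b)

  reversal : ∀ n B → ℕ → Circuit (1 * (n * B)) (n * B)
  -- There are no gates, the outputs are wired to the inputs; `↑ˡ 0` appears because `1 * (n * B)`
  -- computes to `n * B + 0`.
  reversal n B _ = record { levels = inputs ; outputs = tabulate (λ j → rev n B j ↑ˡ 0) }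

  toℕ-rev : ∀ {n B} (i : Fin n) (b : Fin B) → toℕ (rev n B (combine i b)) ≡ (n ∸ suc (toℕ i)) * B + toℕ b
  toℕ-rev {n} {B} i b = trans (cong toℕ (rev-combine i b))
    (trans (toℕ-combine′ (opposite i) b) (cong (λ x → x * B + toℕ b) (Fin.opposite-prop i)))

  -- j = q B + r and g = (n - 1 - q) B + r
  output-formula : Formula 5
  output-formula = ∃≺ (var (# 0)) (∃≺ (var (# 2)) (
    (var (# 5) ≐ ((var (# 1) ⊙ var (# 3)) ⊕ var (# 0))) ∧′
    (((var (# 6) ⊕ (var (# 1) ⊙ var (# 3))) ⊕ var (# 3)) ≐ ((var (# 2) ⊙ var (# 3)) ⊕ var (# 0)))))

  -- Terms have no subtraction, so the formula carries the equation for `g` with `suc q` words moved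
  -- to the other side.
  rev-spec : ∀ n B q r → q < n → ∀ {g} → g + q * B + B ≡ n * B + r ⇔ (n ∸ suc q) * B + r ≡ g
  rev-spec n B q r q<n {g} = mk⇔
    (λ eq → sym (+-cancelʳ-≡ (q * B + B) g _ (trans (sym (+-assoc g (q * B) B)) (trans eq (sym shifted)))))
    (λ { refl → trans (+-assoc ((n ∸ suc q) * B + r) (q * B) B) shifted })
    where
    lemma : ∀ m r a b → m + r + (a + b) ≡ m + a + b + r
    lemma = solve-∀
    shifted : (n ∸ suc q) * B + r + (q * B + B) ≡ n * B + r
    shifted = trans (lemma ((n ∸ suc q) * B) r (q * B) B) (cong (_+ r) (*-monus n B q q<n))

  output-correct : ∀ n B s j g → Holds output-formula (n ∷ B ∷ s ∷ toℕ j ∷ toℕ g ∷ []) ⇔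
                   lookup (Circuit.outputs (reversal n B s)) j ≡ g
  output-correct n B s j g with Fin.combine-surjective {n} {B} j
  ... | i , b , refl = mk⇔
    (λ (q , q<n , r , r<B , j≡ , g≡) →
      let i≡ , b≡ = combine-unique i b q<n r<B j≡
      in trans looked (Fin.toℕ-injective (trans toℕ-looked (trans (cong₂ (λ x y → (n ∸ suc x) * B + y) i≡ b≡)
           (Equivalence.to (rev-spec n B q r q<n) g≡)))))
    (λ eq → toℕ i , Fin.toℕ<n i , toℕ b , Fin.toℕ<n b , toℕ-combine′ i b ,
      Equivalence.from (rev-spec n B (toℕ i) (toℕ b) (Fin.toℕ<n i)) (trans (sym toℕ-looked) (cong toℕ (trans (sym looked) eq))))
    where
    looked : lookup (Circuit.outputs (reversal n B s)) (combine i b) ≡ rev n B (combine i b) ↑ˡ 0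
    looked = lookup∘tabulate _ (combine i b)
    toℕ-looked : toℕ (rev n B (combine i b) ↑ˡ 0) ≡ (n ∸ suc (toℕ i)) * B + toℕ b
    toℕ-looked = trans (Fin.toℕ-↑ˡ (rev n B (combine i b)) 0) (toℕ-rev i b)

  reversalOp : VectorOp
  reversalOp = record
    { arity         = 1
    ; circuit       = reversal
    ; constantDepth = 0 , λ _ _ _ → z≤n
    ; polynomial    = 2 , λ n B s → m≤n⇒m≤o+n 2 (≤-trans
        (*-mono-≤ (≤-trans (m≤m+n n B) (m≤m+n (n + B) s)) (≤-trans (m≤n+m B n) (m≤m+n (n + B) s)))
        (≤-reflexive (cong ((n + B + s) *_) (sym (*-identityʳ (n + B + s))))))
    ; uniform       = record
      { node    = var (# 3) ≺ (var (# 0) ⊙ var (# 1))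
      ; gate    = λ _ → false′
      ; edge    = false′
      ; output  = output-formula
      ; node⇔   = λ n B s g → subst (λ N → g < n * B ⇔ g < N) (sym (+-identityʳ (n * B))) (mk⇔ id id)
      ; gate⇔   = λ _ _ _ _ _ → ⊥⇔ (λ ()) (λ ())
      ; edge⇔   = λ _ _ _ _ _ → ⊥⇔ (λ ()) ∉⊥
      ; output⇔ = output-correct
      }
    }

  apply-reversal : ∀ {B} s n (x : Vec (Word B) n) → VectorOp.apply reversalOp s n (x ∷ []) ≡ permute (reverse {n}) x
  apply-reversal {B} s n x = lookup-ext λ i → lookup-ext λ b → begin
    lookup (lookup (VectorOp.apply reversalOp s n (x ∷ [])) i) b ≡⟨ apply-bit {0} reversalOp s n (x ∷ []) i b ⟩
    lookup (concat x ++ []) (lookup (tabulate (λ j → rev n B j ↑ˡ 0)) (combine i b))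
      ≡⟨ cong (lookup (concat x ++ [])) (trans (lookup∘tabulate _ (combine i b)) (cong (_↑ˡ 0) (rev-combine i b))) ⟩
    lookup (concat x ++ []) (combine (opposite i) b ↑ˡ 0)        ≡⟨ lookup-++ˡ (concat x) [] (combine (opposite i) b) ⟩
    lookup (concat x) (combine (opposite i) b)                   ≡⟨ lookup-concat x (opposite i) b ⟩
    lookup (lookup x (opposite i)) b                             ≡⟨ cong (λ w → lookup w b) (lookup∘tabulate _ i) ⟨
    lookup (lookup (permute (reverse {n}) x) i) b                ∎
    where open ≡-Reasoning

-- The ReLU circuit and its uniformity

data Node {a b c} : Fin ((a + b) + c) → Set where
  first  : ∀ i → Node ((i ↑ˡ b) ↑ˡ c)
  second : ∀ i → Node ((a ↑ʳ i) ↑ˡ c)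
  third  : ∀ i → Node ((a + b) ↑ʳ i)

node? : ∀ a b c g → Node {a} {b} {c} g
node? a b c g with splitAt (a + b) g in eq
... | inj₂ i with refl ← Fin.splitAt⁻¹-↑ʳ {a + b} eq = third i
... | inj₁ h with refl ← Fin.splitAt⁻¹-↑ˡ eq with splitAt a h in eq′
...   | inj₁ i with refl ← Fin.splitAt⁻¹-↑ˡ eq′ = first i
...   | inj₂ i with refl ← Fin.splitAt⁻¹-↑ʳ {a} eq′ = second i

module _ {i m w d} (C : Levels i m d) (gs : Vec (Gate m) w) where

  opAt-old : ∀ g → opAt (C ▷ gs) (g ↑ˡ w) ≡ opAt C g
  opAt-old g rewrite Fin.splitAt-↑ˡ m g w = refl

  opAt-new : ∀ j → opAt (C ▷ gs) (m ↑ʳ j) ≡ just (op (lookup gs j))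
  opAt-new j rewrite Fin.splitAt-↑ʳ m w j = refl

  faninAt-old : ∀ g → faninAt (C ▷ gs) (g ↑ˡ w) ≡ faninAt C g ++ ⊥ {w}
  faninAt-old g rewrite Fin.splitAt-↑ˡ m g w = refl

  faninAt-new : ∀ j → faninAt (C ▷ gs) (m ↑ʳ j) ≡ fanin (lookup gs j) ++ ⊥ {w}
  faninAt-new j rewrite Fin.splitAt-↑ʳ m w j = refl

∈-++⊥⁻ : ∀ {m} w (p : Subset m) {h} → h ∈ˢ p ++ ⊥ {w} → ∃ λ h′ → h′ ∈ˢ p × toℕ h ≡ toℕ h′
∈-++⊥⁻ {m} w p {h} h∈ with splitAt m h in eq
... | inj₁ h′ with refl ← Fin.splitAt⁻¹-↑ˡ eq =
  h′ , lookup⇒[]= h′ p (trans (sym (lookup-++ˡ p (⊥ {w}) h′)) ([]=⇒lookup h∈)) , Fin.toℕ-↑ˡ h′ w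
... | inj₂ h′ with refl ← Fin.splitAt⁻¹-↑ʳ {m} eq =
  contradiction (lookup⇒[]= h′ (⊥ {w}) (trans (sym (lookup-++ʳ p (⊥ {w}) h′)) ([]=⇒lookup h∈))) ∉⊥

∈-++⊥⁺ : ∀ {m} w (p : Subset m) {h h′} → h′ ∈ˢ p → toℕ h ≡ toℕ h′ → h ∈ˢ p ++ ⊥ {w}
∈-++⊥⁺ w p {h} {h′} h′∈ eq with refl ← Fin.toℕ-injective {i = h} {h′ ↑ˡ w} (trans eq (sym (Fin.toℕ-↑ˡ h′ w))) =
  lookup⇒[]= (h′ ↑ˡ w) (p ++ ⊥) (trans (lookup-++ˡ p (⊥ {w}) h′) ([]=⇒lookup h′∈))

evalGate-⋀⊥ : ∀ {m} (v : Vec Bool m) → evalGate v (⋀ ⊥) ≡ true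
evalGate-⋀⊥ []      = refl
evalGate-⋀⊥ (_ ∷ v) = evalGate-⋀⊥ v

evalGate-⋀⁅⁆ : ∀ {m} (v : Vec Bool m) h → evalGate v (⋀ ⁅ h ⁆) ≡ lookup v h
evalGate-⋀⁅⁆ (b ∷ v) zero    = trans (cong (b ∧_) (evalGate-⋀⊥ v)) (Bool.∧-identityʳ b)
evalGate-⋀⁅⁆ (b ∷ v) (suc h) = evalGate-⋀⁅⁆ v h

evalGate-⋀∪ : ∀ {m} (v : Vec Bool m) p q → evalGate v (⋀ (p ∪ q)) ≡ evalGate v (⋀ p) ∧ evalGate v (⋀ q)
evalGate-⋀∪ []      []      []      = refl
evalGate-⋀∪ (b ∷ v) (c ∷ p) (d ∷ q) = trans (cong ((not (c ∨ d) ∨ b) ∧_) (evalGate-⋀∪ v p q)) (lemma c d b _ _)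
  where
  lemma : ∀ c d b x y → (not (c ∨ d) ∨ b) ∧ (x ∧ y) ≡ ((not c ∨ b) ∧ x) ∧ ((not d ∨ b) ∧ y)
  lemma false false b x y = refl
  lemma false true  b x y = trans (sym (Bool.∧-assoc b x y)) (trans (cong (_∧ y) (Bool.∧-comm b x)) (Bool.∧-assoc x b y))
  lemma true  false b x y = sym (Bool.∧-assoc b x y)
  lemma true  true  true  x y = refl
  lemma true  true  false x y = refl

∣∪∣≤ : ∀ {m} (p q : Subset m) → ∣ p ∪ q ∣ ≤ ∣ p ∣ + ∣ q ∣
∣∪∣≤ []          []          = z≤n
∣∪∣≤ (false ∷ p) (false ∷ q) = ∣∪∣≤ p q
∣∪∣≤ (false ∷ p) (true ∷ q)  = ≤-trans (s≤s (∣∪∣≤ p q)) (≤-reflexive (sym (+-suc ∣ p ∣ ∣ q ∣)))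
∣∪∣≤ (true ∷ p)  (false ∷ q) = s≤s (∣∪∣≤ p q)
∣∪∣≤ (true ∷ p)  (true ∷ q)  = s≤s (≤-trans (∣∪∣≤ p q) (+-monoʳ-≤ ∣ p ∣ (n≤1+n ∣ q ∣)))

sum-tabulate≤ : ∀ {A : Set} n (f : A → ℕ) (g : Fin n → A) c → (∀ i → f (g i) ≤ c) → Vec.sum (Vec.map f (tabulate g)) ≤ n * c
sum-tabulate≤ zero    f g c f≤c = z≤n
sum-tabulate≤ (suc n) f g c f≤c = +-mono-≤ (f≤c zero) (sum-tabulate≤ n f (g ∘ suc) c (f≤c ∘ suc))

module ReLU where

  -- The argument witnesses that `B` is positive, without which there is no sign bit.
  top : ∀ {B} → Fin B → Fin B
  top {suc B} _ = fromℕ B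

  toℕ-top : ∀ {B} (b : Fin B) → suc (toℕ (top b)) ≡ B
  toℕ-top {suc B} b = cong suc (Fin.toℕ-fromℕ B)

  sgn : ∀ n B → Fin (n * B) → Fin (n * B)
  sgn n B j = combine (proj₁ (remQuot {n} B j)) (top (proj₂ (remQuot {n} B j)))

  sgn-combine : ∀ {n B} (i : Fin n) (b : Fin B) → sgn n B (combine i b) ≡ combine i (top b)
  sgn-combine {n} {B} i b = cong (λ z → combine (proj₁ z) (top (proj₂ z))) (Fin.remQuot-combine {n} {B} i b)

  module _ (n B : ℕ) where

    N N′ : ℕ
    N  = n * B
    N′ = 1 * (n * B)

    -- All bits are negated, not only the signs, so that the gate at distance `n * B` from an input
    -- negates it; this keeps the connection formula to one addition.
    negations : Vec (Gate N′) N′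
    negations = tabulate ~_

    input negated-sign : Fin N → Fin (N′ + N′)
    input j        = (j ↑ˡ 0) ↑ˡ N′
    negated-sign j = N′ ↑ʳ (sgn n B j ↑ˡ 0)

    conjunction : Fin N → Gate (N′ + N′)
    conjunction j = ⋀ (⁅ input j ⁆ ∪ ⁅ negated-sign j ⁆)

    conjunctions : Vec (Gate (N′ + N′)) N
    conjunctions = tabulate conjunction

    all-levels : Levels N′ ((N′ + N′) + N) 2
    all-levels = (inputs ▷ negations) ▷ conjunctions

    circuit : Circuit N′ N
    circuit = record
      { levels  = all-levels
      ; outputs = tabulate ((N′ + N′) ↑ʳ_)
      }

    toℕ-first : ∀ (i : Fin N′) → toℕ ((i ↑ˡ N′) ↑ˡ N) ≡ toℕ i
    toℕ-first i = trans (Fin.toℕ-↑ˡ (i ↑ˡ N′) N) (Fin.toℕ-↑ˡ i N′)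

    toℕ-second : ∀ (i : Fin N′) → toℕ ((N′ ↑ʳ i) ↑ˡ N) ≡ N + toℕ i
    toℕ-second i = trans (Fin.toℕ-↑ˡ (N′ ↑ʳ i) N) (trans (Fin.toℕ-↑ʳ N′ i) (cong (_+ toℕ i) (+-identityʳ N)))

    toℕ-third : ∀ (i : Fin N) → toℕ ((N′ + N′) ↑ʳ i) ≡ N + N + toℕ i
    toℕ-third i = trans (Fin.toℕ-↑ʳ (N′ + N′) i) (cong (λ x → x + x + toℕ i) (+-identityʳ N))

    i<N : ∀ (i : Fin N′) → toℕ i < N
    i<N i = ≤-trans (Fin.toℕ<n i) (≤-reflexive (+-identityʳ N))

    toℕ-input : ∀ j → toℕ (input j) ≡ toℕ j
    toℕ-input j = trans (Fin.toℕ-↑ˡ (j ↑ˡ 0) N′) (Fin.toℕ-↑ˡ j 0)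

    -- The successor on the left avoids `B ∸ 1`, as the edge formula has to.
    toℕ-negated-sign : ∀ (i : Fin n) (b : Fin B) → suc (toℕ (negated-sign (combine i b))) ≡ N + (toℕ i * B + B)
    toℕ-negated-sign i b = begin
      suc (toℕ (negated-sign (combine i b)))      ≡⟨ cong suc (Fin.toℕ-↑ʳ N′ _) ⟩
      suc (N′ + toℕ (sgn n B (combine i b) ↑ˡ 0)) ≡⟨ cong suc (cong₂ _+_ (+-identityʳ N) (trans (Fin.toℕ-↑ˡ (sgn n B (combine i b)) 0) (trans (cong toℕ (sgn-combine i b)) (toℕ-combine′ i (top b))))) ⟩
      suc (N + (toℕ i * B + toℕ (top b)))         ≡⟨ lemma N (toℕ i * B) (toℕ (top b)) ⟩
      N + (toℕ i * B + suc (toℕ (top b)))         ≡⟨ cong (λ x → N + (toℕ i * B + x)) (toℕ-top b) ⟩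
      N + (toℕ i * B + B)                         ∎
      where
      open ≡-Reasoning
      lemma : ∀ x y z → suc (x + (y + z)) ≡ x + (y + suc z)
      lemma = solve-∀

    opAt-first : ∀ i → opAt all-levels ((i ↑ˡ N′) ↑ˡ N) ≡ nothing
    opAt-first i = trans (opAt-old (inputs ▷ negations) conjunctions (i ↑ˡ N′)) (opAt-old inputs negations i)

    opAt-second : ∀ i → opAt all-levels ((N′ ↑ʳ i) ↑ˡ N) ≡ just neg
    opAt-second i = trans (opAt-old (inputs ▷ negations) conjunctions (N′ ↑ʳ i))
      (trans (opAt-new inputs negations i) (cong (just ∘ op) (lookup∘tabulate ~_ i)))

    opAt-third : ∀ j → opAt all-levels ((N′ + N′) ↑ʳ j) ≡ just and
    opAt-third j = trans (opAt-new (inputs ▷ negations) conjunctions j) (cong (just ∘ op) (lookup∘tabulate conjunction j))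

    fanin-first : ∀ h i → ¬ h ∈ˢ faninAt all-levels ((i ↑ˡ N′) ↑ˡ N)
    fanin-first h i h∈ = go (subst (h ∈ˢ_) fanin≡ h∈)
      where
      fanin≡ : faninAt all-levels ((i ↑ˡ N′) ↑ˡ N) ≡ (⊥ {N′} ++ ⊥ {N′}) ++ ⊥ {N}
      fanin≡ = trans (faninAt-old (inputs ▷ negations) conjunctions (i ↑ˡ N′)) (cong (_++ ⊥) (faninAt-old inputs negations i))
      go : ¬ h ∈ˢ (⊥ {N′} ++ ⊥ {N′}) ++ ⊥ {N}
      go h∈ with h′ , h′∈ , _ ← ∈-++⊥⁻ N (⊥ {N′} ++ ⊥ {N′}) h∈
        with _ , h″∈ , _ ← ∈-++⊥⁻ N′ (⊥ {N′}) h′∈ = ∉⊥ h″∈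

    fanin-second : ∀ h i → h ∈ˢ faninAt all-levels ((N′ ↑ʳ i) ↑ˡ N) ⇔ toℕ h ≡ toℕ i
    fanin-second h i = mk⇔ (to ∘ subst (h ∈ˢ_) fanin≡) (subst (h ∈ˢ_) (sym fanin≡) ∘ from)
      where
      fanin≡ : faninAt all-levels ((N′ ↑ʳ i) ↑ˡ N) ≡ (⁅ i ⁆ ++ ⊥ {N′}) ++ ⊥ {N}
      fanin≡ = trans (faninAt-old (inputs ▷ negations) conjunctions (N′ ↑ʳ i)) (cong (_++ ⊥)
        (trans (faninAt-new inputs negations i) (cong (λ g → fanin g ++ ⊥) (lookup∘tabulate ~_ i))))
      to : h ∈ˢ (⁅ i ⁆ ++ ⊥ {N′}) ++ ⊥ {N} → toℕ h ≡ toℕ i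
      to h∈ with h′ , h′∈ , eq ← ∈-++⊥⁻ N (⁅ i ⁆ ++ ⊥ {N′}) h∈ with h″ , h″∈ , eq′ ← ∈-++⊥⁻ N′ ⁅ i ⁆ h′∈ =
        trans eq (trans eq′ (cong toℕ (x∈⁅y⁆⇒x≡y i h″∈)))
      from : toℕ h ≡ toℕ i → h ∈ˢ (⁅ i ⁆ ++ ⊥ {N′}) ++ ⊥ {N}
      from eq = ∈-++⊥⁺ N (⁅ i ⁆ ++ ⊥ {N′}) (∈-++⊥⁺ N′ ⁅ i ⁆ {i ↑ˡ N′} (x∈⁅x⁆ i) (Fin.toℕ-↑ˡ i N′)) (trans eq (sym (Fin.toℕ-↑ˡ i N′)))

    fanin-third : ∀ h j → h ∈ˢ faninAt all-levels ((N′ + N′) ↑ʳ j) ⇔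
                  (toℕ h ≡ toℕ (input j) ⊎ toℕ h ≡ toℕ (negated-sign j))
    fanin-third h j = mk⇔ (to ∘ subst (h ∈ˢ_) fanin≡) (subst (h ∈ˢ_) (sym fanin≡) ∘ from)
      where
      P = ⁅ input j ⁆ ∪ ⁅ negated-sign j ⁆
      fanin≡ : faninAt all-levels ((N′ + N′) ↑ʳ j) ≡ P ++ ⊥ {N}
      fanin≡ = trans (faninAt-new (inputs ▷ negations) conjunctions j) (cong (λ g → fanin g ++ ⊥) (lookup∘tabulate conjunction j))
      to : h ∈ˢ P ++ ⊥ {N} → toℕ h ≡ toℕ (input j) ⊎ toℕ h ≡ toℕ (negated-sign j)
      to h∈ with h′ , h′∈ , eq ← ∈-++⊥⁻ N P h∈ =
        Sum.map (λ m → trans eq (cong toℕ (x∈⁅y⁆⇒x≡y _ m))) (λ m → trans eq (cong toℕ (x∈⁅y⁆⇒x≡y _ m)))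
          (x∈p∪q⁻ ⁅ input j ⁆ ⁅ negated-sign j ⁆ h′∈)
      from : toℕ h ≡ toℕ (input j) ⊎ toℕ h ≡ toℕ (negated-sign j) → h ∈ˢ P ++ ⊥ {N}
      from (inj₁ eq) = ∈-++⊥⁺ N P (x∈p∪q⁺ (inj₁ (x∈⁅x⁆ (input j)))) eq
      from (inj₂ eq) = ∈-++⊥⁺ N P (x∈p∪q⁺ {p = ⁅ input j ⁆} (inj₂ (x∈⁅x⁆ (negated-sign j)))) eq

  product : ∀ {v} → Fin v → Fin v → Term v
  product n B = var n ⊙ var B

  node-formula : Formula 4
  node-formula = var (# 3) ≺ ((product (# 0) (# 1) ⊕ product (# 0) (# 1)) ⊕ product (# 0) (# 1))

  gate-formula : Op → Formula 4
  gate-formula and = ¬′ (var (# 3) ≺ (product (# 0) (# 1) ⊕ product (# 0) (# 1)))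
  gate-formula or  = false′
  gate-formula neg = (¬′ (var (# 3) ≺ product (# 0) (# 1))) ∧′
                     (var (# 3) ≺ (product (# 0) (# 1) ⊕ product (# 0) (# 1)))

  -- Either h is an input and g its negation, or g = 2nB + q B + r is a
  -- conjunction and h is bit r of word q or the negated top bit of word q.
  edge-formula : Formula 5
  edge-formula =
    ((var (# 3) ≺ product (# 0) (# 1)) ∧′ (var (# 4) ≐ (var (# 3) ⊕ product (# 0) (# 1)))) ∨′
    ∃≺ (var (# 0)) (∃≺ (var (# 2)) (
      (var (# 6) ≐ ((product (# 2) (# 3) ⊕ product (# 2) (# 3)) ⊕ (product (# 1) (# 3) ⊕ var (# 0)))) ∧′
      ((var (# 5) ≐ (product (# 1) (# 3) ⊕ var (# 0))) ∨′
       ((lit 1 ⊕ var (# 5)) ≐ (product (# 2) (# 3) ⊕ (product (# 1) (# 3) ⊕ var (# 3)))))))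

  output-formula : Formula 5
  output-formula = var (# 4) ≐ ((product (# 0) (# 1) ⊕ product (# 0) (# 1)) ⊕ var (# 3))

  module _ (n B s : ℕ) where

    private
      M M′ : ℕ
      M  = n * B
      M′ = 1 * (n * B)

    node-correct : ∀ g → Holds node-formula (n ∷ B ∷ s ∷ g ∷ []) ⇔ g < Circuit.nodes (circuit n B)
    node-correct g = subst (λ x → g < M + M + M ⇔ g < x + x + M) (sym (+-identityʳ M)) (mk⇔ id id)

    GateCorrect : ℕ → Maybe Op → Set
    GateCorrect g o = ∀ f → Holds (gate-formula f) (n ∷ B ∷ s ∷ g ∷ []) ⇔ o ≡ just f

    gate-correct : ∀ f g → Holds (gate-formula f) (n ∷ B ∷ s ∷ toℕ g ∷ []) ⇔ opAt (all-levels n B) g ≡ just f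
    gate-correct f g with node? M′ M′ M g
    ... | first i  = subst₂ GateCorrect (sym (toℕ-first n B i)) (sym (opAt-first n B i)) go f
      where
      go : GateCorrect (toℕ i) nothing
      go and = ⊥⇔ (λ ¬lt → ¬lt (≤-trans (i<N n B i) (m≤m+n M M))) (λ ())
      go or  = ⊥⇔ (λ ()) (λ ())
      go neg = ⊥⇔ (λ (¬lt , _) → ¬lt (i<N n B i)) (λ ())
    ... | second i = subst₂ GateCorrect (sym (toℕ-second n B i)) (sym (opAt-second n B i)) go f
      where
      go : GateCorrect (M + toℕ i) (just neg)
      go and = ⊥⇔ (λ ¬lt → ¬lt (+-monoʳ-< M (i<N n B i))) (λ ())
      go or  = ⊥⇔ (λ ()) (λ ())
      go neg = mk⇔ (λ _ → refl) (λ _ → (λ lt → <⇒≱ lt (m≤m+n M (toℕ i))) , +-monoʳ-< M (i<N n B i))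
    ... | third j  = subst₂ GateCorrect (sym (toℕ-third n B j)) (sym (opAt-third n B j)) go f
      where
      go : GateCorrect (M + M + toℕ j) (just and)
      go and = mk⇔ (λ _ → refl) (λ _ lt → <⇒≱ lt (m≤m+n (M + M) (toℕ j)))
      go or  = ⊥⇔ (λ ()) (λ ())
      go neg = ⊥⇔ (λ (_ , lt) → <⇒≱ lt (m≤m+n (M + M) (toℕ j))) (λ ())

    Edge : ℕ → ℕ → Set
    Edge h g = Holds edge-formula (n ∷ B ∷ s ∷ h ∷ g ∷ [])

    ⇔-trans : ∀ {P Q R : Set} → P ⇔ Q → R ⇔ Q → P ⇔ R
    ⇔-trans p r = mk⇔ (Equivalence.from r ∘ Equivalence.to p) (Equivalence.from p ∘ Equivalence.to r)

    edge-correct : ∀ h g → Edge (toℕ h) (toℕ g) ⇔ h ∈ˢ faninAt (all-levels n B) g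
    edge-correct h g with node? M′ M′ M g
    ... | first i = ⊥⇔ (impossible ∘ subst (Edge (toℕ h)) (toℕ-first n B i)) (fanin-first n B h i)
      where
      impossible : ¬ Edge (toℕ h) (toℕ i)
      impossible (inj₁ (_ , i≡)) = <⇒≱ (i<N n B i) (≤-trans (m≤n+m M (toℕ h)) (≤-reflexive (sym i≡)))
      impossible (inj₂ (q , _ , r , _ , i≡ , _)) =
        <⇒≱ (i<N n B i) (≤-trans (≤-trans (m≤m+n M M) (m≤m+n (M + M) (q * B + r))) (≤-reflexive (sym i≡)))
    ... | second i = ⇔-trans (subst (λ g → Edge (toℕ h) g ⇔ toℕ h ≡ toℕ i) (sym (toℕ-second n B i)) (mk⇔ to from))
                       (fanin-second n B h i)
      where
      to : Edge (toℕ h) (M + toℕ i) → toℕ h ≡ toℕ i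
      to (inj₁ (_ , i≡)) = sym (+-cancelˡ-≡ M (toℕ i) (toℕ h) (trans i≡ (+-comm (toℕ h) M)))
      to (inj₂ (q , _ , r , _ , i≡ , _)) = contradiction (≤-trans (m≤m+n (M + M) (q * B + r)) (≤-reflexive (sym i≡)))
        (<⇒≱ (+-monoʳ-< M (i<N n B i)))
      from : toℕ h ≡ toℕ i → Edge (toℕ h) (M + toℕ i)
      from h≡ = inj₁ (≤-trans (s≤s (≤-reflexive h≡)) (i<N n B i) , trans (+-comm M (toℕ i)) (cong (_+ M) (sym h≡)))
    ... | third j with Fin.combine-surjective {n} {B} j
    ...   | i , b , refl = ⇔-trans (subst (λ g → Edge (toℕ h) g ⇔ Source) (sym (toℕ-third n B (combine i b))) (mk⇔ to from))
                             (fanin-third n B h (combine i b))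
      where
      Source : Set
      Source = toℕ h ≡ toℕ (input n B (combine i b)) ⊎ toℕ h ≡ toℕ (negated-sign n B (combine i b))
      to : Edge (toℕ h) (M + M + toℕ (combine i b)) → Source
      to (inj₁ (h<M , i≡)) = contradiction (≤-trans (m≤m+n (M + M) (toℕ (combine i b))) (≤-reflexive i≡))
        (<⇒≱ (+-monoˡ-< M h<M))
      to (inj₂ (q , q<n , r , r<B , g≡ , h≡)) with combine-unique i b q<n r<B (+-cancelˡ-≡ (M + M) _ _ g≡)
      ... | refl , refl = Sum.map
        (λ eq → trans eq (sym (trans (toℕ-input n B (combine i b)) (toℕ-combine′ i b))))
        (λ eq → suc-injective (trans eq (sym (toℕ-negated-sign n B i b)))) h≡
      from : Source → Edge (toℕ h) (M + M + toℕ (combine i b))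
      from source = inj₂ (toℕ i , Fin.toℕ<n i , toℕ b , Fin.toℕ<n b , cong (M + M +_) (toℕ-combine′ i b) , Sum.map
        (λ eq → trans eq (trans (toℕ-input n B (combine i b)) (toℕ-combine′ i b)))
        (λ eq → trans (cong suc eq) (toℕ-negated-sign n B i b)) source)

    output-correct : ∀ j g → Holds output-formula (n ∷ B ∷ s ∷ toℕ j ∷ toℕ g ∷ []) ⇔
                     lookup (Circuit.outputs (circuit n B)) j ≡ g
    output-correct j g = mk⇔
      (λ g≡ → trans (lookup∘tabulate _ j) (Fin.toℕ-injective (trans (toℕ-third n B j) (sym g≡))))
      (λ eq → trans (cong toℕ (trans (sym eq) (lookup∘tabulate _ j))) (toℕ-third n B j))

    -- The wires are `n * B` for the negations, twice that for the conjunctions and `n * B` for the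
    -- outputs. The inequality of arithmetic and geometric means fits these `4 * (n * B)` into a
    -- square, so exponent 2 is enough.
    size≤ : Circuit.size (circuit n B) ≤ 2 + (n + B + s) ^ 2
    size≤ = m≤n⇒m≤o+n 2 (begin
      Vec.sum (Vec.map (∣_∣ ∘ fanin) (negations n B)) + Vec.sum (Vec.map (∣_∣ ∘ fanin) (conjunctions n B)) + M
        ≤⟨ +-monoˡ-≤ M (+-mono-≤
             (sum-tabulate≤ M′ (∣_∣ ∘ fanin) ~_ 1 (λ i → ≤-reflexive (∣⁅x⁆∣≡1 i)))
             (sum-tabulate≤ M (∣_∣ ∘ fanin) (conjunction n B) 2 (λ j → ≤-trans
               (∣∪∣≤ ⁅ input n B j ⁆ ⁅ negated-sign n B j ⁆)
               (≤-reflexive (cong₂ _+_ (∣⁅x⁆∣≡1 (input n B j)) (∣⁅x⁆∣≡1 (negated-sign n B j))))))) ⟩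
      M′ * 1 + M * 2 + M        ≡⟨ lemma n B ⟩
      4 * (n * B)               ≤⟨ am-gm n B ⟩
      (n + B) * (n + B)         ≤⟨ *-mono-≤ (m≤m+n (n + B) s) (m≤m+n (n + B) s) ⟩
      (n + B + s) * (n + B + s) ≡⟨ cong ((n + B + s) *_) (*-identityʳ (n + B + s)) ⟨
      (n + B + s) ^ 2           ∎)
      where
      open ≤-Reasoning hiding (start)
      lemma : ∀ n b → 1 * (n * b) * 1 + n * b * 2 + n * b ≡ 4 * (n * b)
      lemma = solve-∀
      am-gm-+ : ∀ a d → 4 * (a * (a + d)) ≤ (a + (a + d)) * (a + (a + d))
      am-gm-+ a d = ≤-trans (m≤m+n _ (d * d)) (≤-reflexive (square a d))
        where
        square : ∀ a d → 4 * (a * (a + d)) + d * d ≡ (a + (a + d)) * (a + (a + d))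
        square = solve-∀
      am-gm : ∀ a b → 4 * (a * b) ≤ (a + b) * (a + b)
      am-gm a b with ≤-total a b
      ... | inj₁ a≤b = subst (λ c → 4 * (a * c) ≤ (a + c) * (a + c)) (m+[n∸m]≡n a≤b) (am-gm-+ a (b ∸ a))
      ... | inj₂ b≤a = subst₂ _≤_ (cong (4 *_) (*-comm b a)) (cong (λ x → x * x) (+-comm b a))
        (subst (λ c → 4 * (b * c) ≤ (b + c) * (b + c)) (m+[n∸m]≡n b≤a) (am-gm-+ b (a ∸ b)))

  reluOp : VectorOp
  reluOp = record
    { arity         = 1
    ; circuit       = λ n B _ → circuit n B
    ; constantDepth = 2 , λ _ _ _ → ≤-refl
    ; polynomial    = 2 , size≤
    ; uniform       = record
      { node    = node-formula
      ; gate    = gate-formula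
      ; edge    = edge-formula
      ; output  = output-formula
      ; node⇔   = node-correct
      ; gate⇔   = gate-correct
      ; edge⇔   = edge-correct
      ; output⇔ = output-correct
      }
    }

  -- Doubling and adding a lower bit preserves both alternatives; the bound -1 is kept because
  -- `1 + 2 * -1` is -1 again.
  ⟦⟧-sign : ∀ {B} (w : Word B) b → if lookup w (top b) then ⟦ w ⟧ ℤ.≤ -1ℤ else 0ℤ ℤ.≤ ⟦ w ⟧
  ⟦⟧-sign (false ∷ [])        _ = ℤ.≤-refl
  ⟦⟧-sign (true ∷ [])         _ = ℤ.≤-refl
  ⟦⟧-sign {suc (suc B)} (c ∷ w@(_ ∷ _)) _ with lookup w (fromℕ B) | ⟦⟧-sign w zero
  ... | false | 0≤w  = ℤ.+-mono-≤ (0≤bit c) (ℤ.*-monoˡ-≤-nonNeg (ℤ.+ 2) 0≤w)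
    where
    0≤bit : ∀ c → 0ℤ ℤ.≤ (if c then 1ℤ else 0ℤ)
    0≤bit false = ℤ.≤-refl
    0≤bit true  = ℤ.+≤+ z≤n
  ... | true  | w≤-1 = ℤ.+-mono-≤ (bit≤1 c) (ℤ.*-monoˡ-≤-nonNeg (ℤ.+ 2) w≤-1)
    where
    bit≤1 : ∀ c → (if c then 1ℤ else 0ℤ) ℤ.≤ 1ℤ
    bit≤1 false = ℤ.+≤+ z≤n
    bit≤1 true  = ℤ.≤-refl

  lookup-zero : ∀ {B} (b : Fin B) → lookup (fromℤ B 0ℤ) b ≡ false
  lookup-zero zero    = refl
  lookup-zero (suc b) = lookup-zero b

  lookup-relu : ∀ {B} (w : Word B) b → lookup (relu w) b ≡ lookup w b ∧ not (lookup w (top b))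
  lookup-relu {B} w b with lookup w (top b) | ⟦⟧-sign w b
  ... | false | 0≤w  = trans (cong (λ z → lookup (fromℤ B z) b) (ℤ.i≥j⇒i⊔j≡i 0≤w))
                         (trans (cong (λ v → lookup v b) (fromℤ-⟦⟧ w)) (sym (Bool.∧-identityʳ _)))
  ... | true  | w≤-1 = trans (cong (λ z → lookup (fromℤ B z) b) (ℤ.i≤j⇒i⊔j≡j (ℤ.≤-trans w≤-1 ℤ.-≤+)))
                         (trans (lookup-zero b) (sym (Bool.∧-zeroʳ _)))

  apply-relu : ∀ {B} s n (x : Vec (Word B) n) → VectorOp.apply reluOp s n (x ∷ []) ≡ Vec.map relu x
  apply-relu {B} s n x = lookup-ext λ i → lookup-ext λ b → begin
    lookup (lookup (VectorOp.apply reluOp s n (x ∷ [])) i) b    ≡⟨ apply-bit {0} reluOp s n (x ∷ []) i b ⟩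
    lookup (v ++ Vec.map (evalGate v) (conjunctions n B)) (lookup (tabulate ((N′ n B + N′ n B) ↑ʳ_)) (combine i b))
      ≡⟨ cong (lookup (v ++ Vec.map (evalGate v) (conjunctions n B))) (lookup∘tabulate _ (combine i b)) ⟩
    lookup (v ++ Vec.map (evalGate v) (conjunctions n B)) ((N′ n B + N′ n B) ↑ʳ combine i b)
      ≡⟨ lookup-++ʳ v _ (combine i b) ⟩
    lookup (Vec.map (evalGate v) (conjunctions n B)) (combine i b)
      ≡⟨ trans (lookup-map (combine i b) (evalGate v) (conjunctions n B)) (cong (evalGate v) (lookup∘tabulate (conjunction n B) (combine i b))) ⟩
    evalGate v (conjunction n B (combine i b))
      ≡⟨ evalGate-⋀∪ v ⁅ input n B (combine i b) ⁆ ⁅ negated-sign n B (combine i b) ⁆ ⟩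
    evalGate v (⋀ ⁅ input n B (combine i b) ⁆) ∧ evalGate v (⋀ ⁅ negated-sign n B (combine i b) ⁆)
      ≡⟨ cong₂ _∧_ (evalGate-⋀⁅⁆ v (input n B (combine i b))) (evalGate-⋀⁅⁆ v (negated-sign n B (combine i b))) ⟩
    lookup v (input n B (combine i b)) ∧ lookup v (negated-sign n B (combine i b))
      ≡⟨ cong₂ _∧_ (trans (lookup-++ˡ u _ (combine i b ↑ˡ 0)) (source i b))
           (trans (lookup-++ʳ u _ (sgn n B (combine i b) ↑ˡ 0))
             (trans (lookup-map (sgn n B (combine i b) ↑ˡ 0) (evalGate u) (negations n B))
               (trans (cong (evalGate u) (lookup∘tabulate ~_ (sgn n B (combine i b) ↑ˡ 0)))
                 (cong not (trans (cong (λ k → lookup u (k ↑ˡ 0)) (sgn-combine i b)) (source i (top b))))))) ⟩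
    lookup (lookup x i) b ∧ not (lookup (lookup x i) (top b))
      ≡⟨ lookup-relu (lookup x i) b ⟨
    lookup (relu (lookup x i)) b
      ≡⟨ cong (λ w → lookup w b) (lookup-map i relu x) ⟨
    lookup (lookup (Vec.map relu x) i) b ∎
    where
    open ≡-Reasoning
    u : Vec Bool (N′ n B)
    u = concat x ++ []
    v : Vec Bool (N′ n B + N′ n B)
    v = u ++ Vec.map (evalGate u) (negations n B)
    source : ∀ i b → lookup u (combine i b ↑ˡ 0) ≡ lookup (lookup x i) b
    source i b = trans (lookup-++ˡ (concat x) [] (combine i b)) (lookup-concat x i b)

-- Programs of one vector instruction

-- With a single operand address, `start` holds that address in register 3, the address of the
-- result in 4 and the length in 0. All operands are the same vector.
apply-once : VectorOp → Algorithm
apply-once f = record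
  { ops  = f ∷ []
  ; code = λ _ → vector zero 4 (replicate (VectorOp.arity f) 3) 0 ∷ []
  }

apply-once-maps : ∀ κ f s {n B} (x : Vec (Word B) n) →
  MapsIn κ (apply-once f) s x (VectorOp.apply f s n (replicate (VectorOp.arity f) x)) 1 (VectorOp.cost f s B n + 0)
apply-once-maps κ f s {n} {B} x = _ , step refl (halt refl) , (begin
  read (write M n out) n n                  ≡⟨ read-write M n out ⟩
  out                                       ≡⟨ cong (VectorOp.apply f s n) operands ⟩
  VectorOp.apply f s n (replicate _ x)      ∎)
  where
  open ≡-Reasoning
  M = write (λ _ → fromℤ B 0ℤ) 0 x
  out = VectorOp.apply f s n (Vec.map (λ a → vec (start n s (0 ∷ []) x) a n) (replicate (VectorOp.arity f) 3))
  read-write : ∀ (M : Memory B) a {m} (y : Vec (Word B) m) → read (write M a y) a m ≡ y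
  read-write M a y = lookup-ext λ i → trans (lookup∘tabulate _ i) (write-at M a y i)
  operands : Vec.map (λ a → vec (start n s (0 ∷ []) x) a n) (replicate (VectorOp.arity f) 3) ≡ replicate _ x
  operands = trans (map-replicate _ 3 (VectorOp.arity f)) (cong (replicate _) (read-write (λ _ → fromℤ B 0ℤ) 0 x))

theorem3p5 : (κ : ℕ → ℕ → ℕ) →
  -- 1. The VCU computes ReLU in one step; ReLU is not linear, and the MMU
  -- cannot execute any non-linear element-wise function.
  ( (∃ λ P → Uses VCU P × (∀ s n B → 2 ≤ s → 1 ≤ B → (x : Vec (Word B) n) →
       ∃ λ w → MapsIn κ P s x (map relu x) 1 w))
  × (∀ B → 2 ≤ B → ¬ Linear (relu {B}))
  × (∀ B (f : Word B → Word B) → 1 ≤ B → ¬ Linear f →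
       ∀ s n → 2 ≤ s → 1 ≤ n → (cs : List (Call B s n)) → ¬ Implements cs (map f)))
  ×
  -- 2. One step on the MMU; Ω(log s / log log s) steps for every algorithm
  -- without the MMU whose work is at most s ^ k.
  ( (∃ λ P → Uses MMU P × (∀ s n B → 2 ≤ s → 1 ≤ B →
       (X : Matrix (Word B) n s) (Y : Matrix (Word B) s s) →
       ∃ λ w → MultipliesIn κ P s X Y 1 w))
  × (∀ P → Avoids MMU P → ∀ k → ∃₂ λ c s₀ →
       ∀ s n B T → 2 ≤ s → s₀ ≤ s → 1 ≤ n → 1 ≤ B →
       (∀ (X : Matrix (Word B) n s) (Y : Matrix (Word B) s s) →
          ∃₂ λ t w → t ≤ T × w ≤ s ^ k × MultipliesIn κ P s X Y t w) →
       ⌊log₂ s ⌋ ≤ c * (T * ⌊log₂ ⌊log₂ s ⌋ ⌋)))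
  ×
  -- 3. A permutation of the entries computed by the VCU in one step with
  -- linear work, but requiring Ω(s) calls to the MMU.
  (Σ ((n : ℕ) → Permutation′ n) λ π →
    (∃₂ λ P c → Uses VCU P × (∀ s n B → 2 ≤ s → 1 ≤ B → (x : Vec (Word B) n) →
       ∃ λ w → w ≤ c * (n * B) × MapsIn κ P s x (permute (π n) x) 1 w))
  × (∃ λ c → ∀ s → 2 ≤ s → ∃ λ n₀ → ∀ n B → n₀ ≤ n → 1 ≤ B → (cs : List (Call B s n)) →
       Implements cs (permute (π n)) → s ≤ c * length cs))
theorem3p5 κ =
  ( (apply-once ReLU.reluOp , (λ _ → refl ∷ []) , λ s n B _ _ x → _ ,
      subst (λ y → MapsIn κ (apply-once ReLU.reluOp) s x y 1 _) (ReLU.apply-relu s n x)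
        (apply-once-maps κ ReLU.reluOp s x))
  , relu-nonlinear
  , λ B f 1≤B nonlinear s n 2≤s 1≤n cs implements → nonlinear (implements⇒linear cs 1≤n implements)) ,
  ( (matmul-algorithm , (λ _ → refl ∷ []) , λ s n B _ _ → matmul-one-step κ s n B)
  , matmul-steps κ) ,
  ( (λ n → reverse {n})
  -- The constant is 1 because the circuit consists of its `n * B` output edges.
  , (apply-once Reversal.reversalOp , 1 , (λ _ → refl ∷ []) , λ s n B _ _ x →
      _ , ≤-reflexive (trans (+-identityʳ (n * B)) (sym (*-identityˡ (n * B)))) ,
      subst (λ y → MapsIn κ (apply-once Reversal.reversalOp) s x y 1 _) (Reversal.apply-reversal s n x)
        (apply-once-maps κ Reversal.reversalOp s x))
  , 1 , reversal-calls)
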